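{- Let $G$ be a connected noncomplete graph of order $n \geq 5$ with minimum degree $\delta(G) \geq n/4$. If $G$ is isomorphic to neither $G_1$ nor $G_2$, then $pc(G)=2$.
   Context: All graphs are finite, simple and undirected. In an edge-colored graph, a path is a proper path if no two adjacent (consecutive) edges of the path receive the same color. For a connected graph $G$, the proper connection number $pc(G)$ is the minimum number of colors in an edge-coloring of $G$ (adjacent edges may share colors) such that every pair of distinct vertices of $G$ is joined by at least one proper path. $G_1$ is the graph on 7 vertices consisting of three triangles sharing exactly one common vertex (i.e., a vertex $v$ together with three disjoint edges $u_1u_2$, $u_3u_4$, $u_5u_6$, with $v$ adjacent to all of $u_1,\dots,u_6$). $G_2$ is the graph on 8 vertices with vertex set $\{v,u_1,u_2,w_1,w_2,w_3,w_4,w_5\}$ and edge set $\{vu_1, vu_2, u_1u_2, vw_1, w_1w_2, w_1w_5, w_2w_5, w_1w_3, w_1w_4, w_3w_4\}$ (a triangle $vu_1u_2$ joined by the edge $vw_1$ to the center $w_1$ of two triangles $w_1w_2w_5$ and $w_1w_3w_4$ sharing $w_1$). Both satisfy $pc(G_1)=pc(G_2)=3$. -}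

module Defs where

open import Data.Nat using (ℕ; zero; suc; _+_; _*_; _≤_; _<_; _≡ᵇ_)
open import Data.Fin using (Fin; toℕ)
open import Data.Bool using (Bool; true; false; if_then_else_; _∧_; _∨_)
open import Data.List using (List; []; _∷_; _++_; map; allFin)
open import Data.Nat.ListAction using (sum)
open import Data.Bool.ListAction using (any)
open import Data.List.Relation.Unary.Unique.Propositional using (Unique)
open import Data.List.Relation.Unary.Linked using (Linked)
open import Data.Product using (Σ; ∃; _×_; _,_)
open import Data.Unit using (⊤)
open import Relation.Nullary using (¬_)
open import Relation.Binary.PropositionalEquality using (_≡_; _≢_)
open import Function.Bundles using (Bijection; _⤖_)

record Graph (n : ℕ) : Set where
  constructor mkGraph
  field
    adj : Fin n → Fin n → Bool

open Graph public

Edge : ∀ {n} → Graph n → Fin n → Fin n → Set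
Edge G u v = adj G u v ≡ true

IsSimple : ∀ {n} → Graph n → Set
IsSimple {n} G = (∀ (u v : Fin n) → adj G u v ≡ adj G v u) × (∀ (u : Fin n) → adj G u u ≡ false)

IsPath : ∀ {n} → Graph n → Fin n → Fin n → List (Fin n) → Set
IsPath G u v xs = Unique (u ∷ xs ++ v ∷ []) × Linked (Edge G) (u ∷ xs ++ v ∷ [])

Connected : ∀ {n} → Graph n → Set
Connected {n} G = ∀ (u v : Fin n) → u ≢ v → ∃ λ xs → IsPath G u v xs

Complete : ∀ {n} → Graph n → Set
Complete {n} G = ∀ (u v : Fin n) → u ≢ v → Edge G u v

degree : ∀ {n} → Graph n → Fin n → ℕ
degree {n} G v = sum (map (λ u → if adj G v u then 1 else 0) (allFin n))

MinDegreeAtLeastQuarter : ∀ {n} → Graph n → Set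
MinDegreeAtLeastQuarter {n} G = ∀ (v : Fin n) → n ≤ 4 * degree G v

-- Edge colourings with k colours: a colour for every ordered pair,
-- symmetric so that the colour of edge uv is well defined
-- (values on non-edges are irrelevant).
record Coloring (n k : ℕ) : Set where
  constructor mkColoring
  field
    col : Fin n → Fin n → Fin k
    col-sym : ∀ u v → col u v ≡ col v u

open Coloring public

ProperSeq : ∀ {n k} → Coloring n k → List (Fin n) → Set
ProperSeq c (x ∷ y ∷ z ∷ rest) = (col c x y ≢ col c y z) × ProperSeq c (y ∷ z ∷ rest)
ProperSeq c _ = ⊤

ProperPath : ∀ {n k} → Graph n → Coloring n k → Fin n → Fin n → List (Fin n) → Set
ProperPath G c u v xs = IsPath G u v xs × ProperSeq c (u ∷ xs ++ v ∷ [])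

ProperlyConnecting : ∀ {n k} → Graph n → Coloring n k → Set
ProperlyConnecting {n} G c = ∀ (u v : Fin n) → u ≢ v → ∃ λ xs → ProperPath G c u v xs

ProperlyConnectableWith : ∀ {n} → Graph n → ℕ → Set
ProperlyConnectableWith {n} G k = Σ (Coloring n k) λ c → ProperlyConnecting G c

PCEquals : ∀ {n} → Graph n → ℕ → Set
PCEquals G k = ProperlyConnectableWith G k × (∀ j → j < k → ¬ ProperlyConnectableWith G j)

Isomorphic : ∀ {n m} → Graph n → Graph m → Set
Isomorphic {n} {m} G H = Σ (Fin n ⤖ Fin m) λ f →
  ∀ (u v : Fin n) → adj G u v ≡ adj H (Bijection.to f u) (Bijection.to f v)

fromEdges : ∀ n → List (ℕ × ℕ) → Graph n
fromEdges n es = mkGraph λ u v →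
  any (λ { (a , b) → ((toℕ u ≡ᵇ a) ∧ (toℕ v ≡ᵇ b)) ∨ ((toℕ u ≡ᵇ b) ∧ (toℕ v ≡ᵇ a)) }) es

-- G₁: vertices v=0, u₁..u₆ = 1..6; three triangles sharing v.
G₁ : Graph 7
G₁ = fromEdges 7
  ( (0 , 1) ∷ (0 , 2) ∷ (1 , 2)
  ∷ (0 , 3) ∷ (0 , 4) ∷ (3 , 4)
  ∷ (0 , 5) ∷ (0 , 6) ∷ (5 , 6) ∷ [])

-- G₂: v=0, u₁=1, u₂=2, w₁..w₅ = 3..7
G₂ : Graph 8
G₂ = fromEdges 8
  ( (0 , 1) ∷ (0 , 2) ∷ (1 , 2) ∷ (0 , 3)
  ∷ (3 , 4) ∷ (3 , 7) ∷ (4 , 7)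
  ∷ (3 , 5) ∷ (3 , 6) ∷ (5 , 6) ∷ [])

{-# OPTIONS --safe #-}
module Submission where

-- If σ splits the vertices into two sides and D orients some edges between the sides, colour
-- the arc x → y by σ x: directed paths become proper paths.  So two colours suffice as soon as a
-- spanning bipartite subgraph H has an orientation in which, of any two vertices, one reaches
-- the other; by a variant of Robbins' theorem this holds if H is connected and some two vertices
-- s, t are separated by every bridge of H.
--
-- Let d be the minimum degree and n ≥ 9, so d ≥ 3.  Take for H a maximum cut.  A set with
-- one boundary edge in H has at most two in G, hence at least d + 1 vertices.  If no s, t
-- exist, H has three disjoint such sets; as n ≤ 4 d, what remains is a single vertex v.
-- Then v and one of the three sets span a 4-cycle through v; a maximum cut among those that keep
-- this cycle bipartite cannot produce the same configuration again.
--
-- For 5 ≤ n ≤ 8, branching on the edges outside a longest path always ends in a spanning walk that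
-- induces such an orientation, in a contradiction, or in an exceptional graph.

open import Defs
open import Data.Bool using (Bool; true; false; _∧_; _∨_; not; _xor_; if_then_else_)
open import Data.Bool.Properties using (xor-comm; xor-identityʳ) renaming (_≟_ to _≟ᵇ_)
open import Data.Empty using (⊥; ⊥-elim)
open import Data.Fin using (Fin; zero; suc; inject₁; fromℕ<)
open import Data.Fin.Patterns
open import Data.Fin.Properties using (_≟_; any?; all?)
open import Data.List using (List; []; _∷_; _++_; allFin; cartesianProduct; map; take; tabulate)
open import Data.List.Membership.DecPropositional using () renaming (_∈?_ to mem?)
open import Data.List.Membership.Propositional using (_∈_)
open import Data.List.Membership.Propositional.Properties using (∈-allFin; ∈-cartesianProduct⁺)
open import Data.List.Relation.Unary.All as All using (All; []; _∷_)
open import Data.List.Relation.Unary.All.Properties using (¬Any⇒All¬)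
open import Data.List.Relation.Unary.AllPairs using ([]; _∷_)
open import Data.List.Relation.Unary.Any using (here; there)
open import Data.List.Relation.Unary.Linked using (Linked; [-]; _∷_)
open import Data.List.Relation.Unary.Unique.Propositional using (Unique)
open import Data.Maybe using (Maybe; just; nothing; from-just)
open import Data.Nat using (ℕ; zero; suc; _+_; _*_; _≤_; _<_; z≤n; s≤s; _≤?_; _<?_; _∸_)
import Data.Nat.ListAction as ListAction
open import Data.Nat.Properties renaming (_≟_ to _≟ⁿ_)
open import Data.Nat.Tactic.RingSolver using (solve-∀)
open import Data.Product using (Σ; ∃; _×_; _,_; proj₁; proj₂)
open import Data.Product.Properties using (≡-dec)
open import Data.Sum as Sum using (_⊎_; inj₁; inj₂; [_,_]′)
open import Data.Unit using (tt)
open import Data.Vec using (Vec; []; _∷_; lookup)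
open import Function using (_∘_; id)
open import Function.Bundles using (_↔_; mk↔ₛ′; Inverse)
open import Function.Properties.Inverse using (↔-sym; ↔⇒⤖)
open import Function.Construct.Composition using (_↔-∘_)
open import Relation.Binary.Construct.Closure.ReflexiveTransitive as Star using (Star; ε; _◅_; _◅◅_; reverse)
open import Relation.Binary.PropositionalEquality
open import Relation.Nullary using (¬_; Dec; yes; no)
open import Relation.Nullary.Decidable using (⌊_⌋; toWitness; map′; _×-dec_; _⊎-dec_; _→-dec_; ¬?)

open import Algebra.Properties.CommutativeMonoid.Sum +-0-commutativeMonoid using (sum; sum-cong-≗; ∑-distrib-+; ∑-comm)
open import Data.List.Extrema ≤-totalOrder using (argmin; f[argmin]≤f[xs])

-- Flipping a set cannot improve a maximum cut, so at least half of the edges across any set lie in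
-- `H`; in particular `H` is connected. A set of s vertices has at least s (d + 1 - s) boundary
-- edges, which is at least d for s from 1 to d; this is why two boundary edges and d ≥ 3 force more
-- than d vertices. For d = 2 it fails: in `G₁` two adjacent outer vertices have only two boundary
-- edges. Hence the separate treatment of small orders. Three disjoint sets take at least 3 d + 3 of
-- at most 4 d vertices. The others, at most d - 3, have at most six boundary edges, and the same
-- count leaves only one of them. A cycle in `H` meets every cut in an even number of edges, so no
-- set with at most one boundary edge in `H` splits the retained 4-cycle, and the estimate by halves
-- survives for such sets. If the configuration arose again, one of its three sets would contain the
-- whole cycle. Uncrossing it with the old set yields a nonempty set with at most four boundary
-- edges and at most d - 4 vertices, which is impossible.

VSet : ℕ → Set
VSet n = Fin n → Bool

BRel : ℕ → Set
BRel n = Fin n → Fin n → Bool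

Arc : ∀ {n} → BRel n → Fin n → Fin n → Set
Arc D x y = D x y ≡ true

∁ : ∀ {n} → VSet n → VSet n
∁ S x = not (S x)

true≢false : ∀ {b} → b ≡ true → b ≡ false → ⊥
true≢false refl ()

-- `one-way` lets every used edge take its colour from its tail, and `alt` makes consecutive tails
-- differ. One direction in `total` is enough, since a proper path stays proper when read backwards;
-- digraphs of this kind are called unilaterally connected.
record Unilateral {n} (A : BRel n) : Set where
  constructor unilateral
  field
    D       : BRel n
    σ       : VSet n
    D⊆A     : ∀ x y → Arc D x y → Arc A x y
    one-way : ∀ x y → Arc D x y → Arc D y x → ⊥
    alt     : ∀ x y → Arc D x y → σ x ≢ σ y
    total   : ∀ x y → Star (Arc D) x y ⊎ Star (Arc D) y x

-- Proper paths from directed walks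

data Path {n} (R : Fin n → Fin n → Set) (v : Fin n) : Fin n → List (Fin n) → Set where
  stop : Path R v v (v ∷ [])
  step : ∀ {x y l} → R x y → Path R v y l → Path R v x (x ∷ l)

module _ {n} {R : Fin n → Fin n → Set} {v : Fin n} where

  suffix : ∀ {w x l} → w ∈ l → Path R v x l → Unique l → ∃ λ l′ → Path R v w l′ × Unique l′
  suffix (here refl) stop       u        = _ , stop , u
  suffix (here refl) (step r p) u        = _ , step r p , u
  suffix (there ())  stop       u
  suffix (there w∈l) (step r p) (_ ∷ u) = suffix w∈l p u

  -- Loop erasure: if the new first vertex already occurs further on, the path restarts from that
  -- occurrence.
  Star⇒Path : ∀ {x} → Star R x v → ∃ λ l → Path R v x l × Unique l
  Star⇒Path ε = _ , stop , [] ∷ []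
  Star⇒Path (_◅_ {x} r s) with Star⇒Path s
  ... | l , p , u with mem? _≟_ x l
  ...   | yes x∈l = suffix x∈l p u
  ...   | no  x∉l = _ , step r p , ¬Any⇒All¬ l x∉l ∷ u

  tail-shape : ∀ {y l} → Path R v y l → ∃ λ xs → l ≡ xs ++ v ∷ []
  tail-shape stop = [] , refl
  tail-shape (step {x} r p) with tail-shape p
  ... | xs , eq = x ∷ xs , cong (x ∷_) eq

  Path-shape : ∀ {x l} → Path R v x l → x ≢ v → ∃ λ xs → l ≡ x ∷ xs ++ v ∷ []
  Path-shape stop           x≢v = ⊥-elim (x≢v refl)
  Path-shape (step {x} r p) x≢v with tail-shape p
  ... | xs , eq = xs , cong (x ∷_) eq

  Path⇒Linked : ∀ {x l} {Q : Fin n → Fin n → Set} → (∀ {a b} → R a b → Q a b) → Path R v x l → Linked Q l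
  Path⇒Linked f stop                  = [-]
  Path⇒Linked f (step r stop)         = f r ∷ [-]
  Path⇒Linked f (step r (step r′ p)) = f r ∷ Path⇒Linked f (step r′ p)

  Path⇒ProperSeq : ∀ {k x l} (c : Coloring n k) →
    (∀ {a b d} → R a b → R b d → col c a b ≢ col c b d) → Path R v x l → ProperSeq c l
  Path⇒ProperSeq c f stop                         = tt
  Path⇒ProperSeq c f (step r stop)                = tt
  Path⇒ProperSeq c f (step r (step r′ stop))      = f r r′ , tt
  Path⇒ProperSeq c f (step r (step r′ (step s p))) = f r r′ , Path⇒ProperSeq c f (step r′ (step s p))

tint : Bool → Fin 2
tint true  = zero
tint false = suc zero

tint-injective : ∀ {a b} → tint a ≡ tint b → a ≡ b
tint-injective {true}  {true}  _ = refl
tint-injective {false} {false} _ = refl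

Star⇒ProperPath : ∀ {n k} {G : Graph n} (c : Coloring n k) {R : Fin n → Fin n → Set} →
  (∀ {a b} → R a b → Edge G a b) → (∀ {a b d} → R a b → R b d → col c a b ≢ col c b d) →
  ∀ {u v} → u ≢ v → Star R u v → ∃ λ xs → ProperPath G c u v xs
Star⇒ProperPath c f g u≢v s with Star⇒Path s
... | l , p , u with Path-shape p u≢v
... | xs , refl = xs , (u , Path⇒Linked f p) , Path⇒ProperSeq c g p

Unilateral⇒connectable : ∀ {n} (G : Graph n) → (∀ u v → adj G u v ≡ adj G v u) →
  Unilateral (adj G) → ProperlyConnectableWith G 2
Unilateral⇒connectable {n} G adj-sym U = colouring , connecting
  where
  open Unilateral U

  -- The colour of the tail; an edge without an arc in `D` gets the arbitrary colour `zero`, as the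
  -- constructed paths avoid it.
  hue : Fin n → Fin n → Fin 2
  hue x y = if D x y then tint (σ x) else (if D y x then tint (σ y) else zero)

  hue-sym : ∀ x y → hue x y ≡ hue y x
  hue-sym x y with D x y in p | D y x in q
  ... | true  | true  = ⊥-elim (one-way x y p q)
  ... | true  | false = refl
  ... | false | true  = refl
  ... | false | false = refl

  colouring : Coloring n 2
  colouring = mkColoring hue hue-sym

  hue-arc : ∀ {x y} → Arc D x y → hue x y ≡ tint (σ x)
  hue-arc {x} {y} p rewrite p = refl

  forward : ∀ {x y z} → Arc D x y → Arc D y z → hue x y ≢ hue y z
  forward {x} {y} p q e = alt x y p (tint-injective (trans (sym (hue-arc p)) (trans e (hue-arc q))))

  backward : ∀ {x y z} → Arc D y x → Arc D z y → hue x y ≢ hue y z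
  backward {x} {y} {z} p q e = forward q p (trans (hue-sym z y) (trans (sym e) (hue-sym x y)))

  connecting : ProperlyConnecting G colouring
  connecting u v u≢v with total u v
  ... | inj₁ s = Star⇒ProperPath colouring (λ {a} {b} r → D⊆A a b r) forward u≢v s
  -- The walk leads from `v` to `u`. Reversed, each edge carries the side of the vertex it enters,
  -- so the colours still alternate.
  ... | inj₂ s = Star⇒ProperPath colouring (λ {a} {b} r → trans (adj-sym a b) (D⊆A b a r)) backward u≢v (reverse id s)

-- Sums and reachability

⟦_⟧ : Bool → ℕ
⟦ b ⟧ = if b then 1 else 0

∣_∣ : ∀ {n} → VSet n → ℕ
∣ S ∣ = sum (λ x → ⟦ S x ⟧)

sum-mono-≤ : ∀ {n} {f g : Fin n → ℕ} → (∀ x → f x ≤ g x) → sum f ≤ sum g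
sum-mono-≤ {zero}  f≤g = z≤n
sum-mono-≤ {suc n} f≤g = +-mono-≤ (f≤g zero) (sum-mono-≤ (f≤g ∘ suc))

sum-mono-< : ∀ {n} {f g : Fin n → ℕ} → (∀ x → f x ≤ g x) → ∀ i → f i < g i → sum f < sum g
sum-mono-< f≤g zero    lt = +-mono-<-≤ lt (sum-mono-≤ (f≤g ∘ suc))
sum-mono-< f≤g (suc i) lt = +-mono-≤-< (f≤g zero) (sum-mono-< (f≤g ∘ suc) i lt)

sum-zero : ∀ {n} {f : Fin n → ℕ} → (∀ x → f x ≡ 0) → sum f ≡ 0
sum-zero {zero}  h = refl
sum-zero {suc n} h = cong₂ _+_ (h zero) (sum-zero (h ∘ suc))

sum-one : ∀ n → sum {n} (λ _ → 1) ≡ n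
sum-one zero    = refl
sum-one (suc n) = cong suc (sum-one n)

term≤sum : ∀ {n} (f : Fin n → ℕ) i → f i ≤ sum f
term≤sum f zero    = m≤m+n _ _
term≤sum f (suc i) = ≤-trans (term≤sum (f ∘ suc) i) (m≤n+m _ _)

two-terms≤sum : ∀ {n} (f : Fin n → ℕ) {i j} → i ≢ j → f i + f j ≤ sum f
two-terms≤sum f {zero}  {zero}  i≢j = ⊥-elim (i≢j refl)
two-terms≤sum f {zero}  {suc j} i≢j = +-monoʳ-≤ (f zero) (term≤sum (f ∘ suc) j)
two-terms≤sum f {suc i} {zero}  i≢j rewrite +-comm (f (suc i)) (f zero) = +-monoʳ-≤ (f zero) (term≤sum (f ∘ suc) i)
two-terms≤sum f {suc i} {suc j} i≢j = ≤-trans (two-terms≤sum (f ∘ suc) (i≢j ∘ cong suc)) (m≤n+m _ _)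

sum-single : ∀ {n} (f : Fin n → ℕ) i → (∀ x → x ≢ i → f x ≡ 0) → sum f ≡ f i
sum-single f zero    h = trans (cong (f zero +_) (sum-zero (λ x → h (suc x) λ ()))) (+-identityʳ _)
sum-single f (suc i) h = cong₂ _+_ (h zero λ ()) (sum-single (f ∘ suc) i (λ x x≢i → h (suc x) (λ { refl → x≢i refl })))

⟦⟧-mono : ∀ {a b} → (a ≡ true → b ≡ true) → ⟦ a ⟧ ≤ ⟦ b ⟧
⟦⟧-mono {false}         h = z≤n
⟦⟧-mono {true}  {true}  h = ≤-refl
⟦⟧-mono {true}  {false} h with () ← h refl

⟦⟧≤1 : ∀ b → ⟦ b ⟧ ≤ 1
⟦⟧≤1 false = z≤n
⟦⟧≤1 true  = ≤-refl

∣∣≤n : ∀ {n} (S : VSet n) → ∣ S ∣ ≤ n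
∣∣≤n {n} S = ≤-trans (sum-mono-≤ {n} (λ x → ⟦⟧≤1 (S x))) (≤-reflexive (sum-one n))

member⇒1≤∣∣ : ∀ {n} (S : VSet n) {x} → S x ≡ true → 1 ≤ ∣ S ∣
member⇒1≤∣∣ S {x} p = ≤-trans (≤-reflexive (sym (cong ⟦_⟧ p))) (term≤sum (⟦_⟧ ∘ S) x)

∣∣-strict : ∀ {n} {S T : VSet n} → (∀ x → S x ≡ true → T x ≡ true) →
  ∀ {x} → T x ≡ true → S x ≡ false → ∣ S ∣ < ∣ T ∣
∣∣-strict {S = S} {T} S⊆T {x} Tx Sx = sum-mono-< (λ y → ⟦⟧-mono (S⊆T y)) x lt
  where
  lt : ⟦ S x ⟧ < ⟦ T x ⟧
  lt rewrite Tx | Sx = ≤-refl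

∧-intro : ∀ {a b} → a ≡ true → b ≡ true → a ∧ b ≡ true
∧-intro refl refl = refl

∧-left : ∀ {a b} → a ∧ b ≡ true → a ≡ true
∧-left {true} _ = refl

∧-right : ∀ {a b} → a ∧ b ≡ true → b ≡ true
∧-right {true} p = p

∨-inv : ∀ {a b} → a ∨ b ≡ true → a ≡ true ⊎ b ≡ true
∨-inv {true}  p = inj₁ refl
∨-inv {false} p = inj₂ p

∨-introʳ : ∀ a {b} → b ≡ true → a ∨ b ≡ true
∨-introʳ true  p = refl
∨-introʳ false p = p

∨-introˡ : ∀ {a b} → a ≡ true → a ∨ b ≡ true
∨-introˡ refl = refl

-- Connectivity is phrased through closed sets, so that unions and intersections of sets replace the
-- handling of walks.
Closed : ∀ {n} → BRel n → VSet n → Set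
Closed D Z = ∀ x y → Z x ≡ true → Arc D x y → Z y ≡ true

Closed-Star : ∀ {n} {D : BRel n} {Z} → Closed D Z → ∀ {x y} → Star (Arc D) x y → Z x ≡ true → Z y ≡ true
Closed-Star c ε       p = p
Closed-Star c (a ◅ s) p = Closed-Star c s (c _ _ p a)

insert : ∀ {n} → Fin n → VSet n → VSet n
insert v S x = S x ∨ ⌊ x ≟ v ⌋

insert-self : ∀ {n} v (S : VSet n) → insert v S v ≡ true
insert-self v S with S v | v ≟ v
... | true  | _       = refl
... | false | yes _   = refl
... | false | no  v≢v = ⊥-elim (v≢v refl)

insert-⊇ : ∀ {n} v (S : VSet n) x → S x ≡ true → insert v S x ≡ true
insert-⊇ v S x p rewrite p = refl

insert-inv : ∀ {n} v (S : VSet n) x → insert v S x ≡ true → S x ≡ true ⊎ x ≡ v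
insert-inv v S x p with S x | x ≟ v
... | true  | _       = inj₁ refl
... | false | yes x≡v = inj₂ x≡v
insert-inv v S x () | false | no _

record Reachable {n} (D : BRel n) (v : Fin n) : Set where
  field
    Z      : VSet n
    source : Z v ≡ true
    closed : Closed D Z
    sound  : ∀ y → Z y ≡ true → Star (Arc D) v y

-- An out-neighbour is added as long as a new one exists. Each addition shrinks the complement,
-- whose size, at most `n`, is the fuel.
reachable : ∀ {n} (D : BRel n) v → Reachable D v
reachable {n} D v = grow n (λ x → ⌊ x ≟ v ⌋) (insert-self v (λ _ → false)) start bound
  where
  start : ∀ y → ⌊ y ≟ v ⌋ ≡ true → Star (Arc D) v y
  start y p with y ≟ v
  start y p  | yes refl = ε
  start y () | no _

  bound : ∣ ∁ (λ x → ⌊ x ≟ v ⌋) ∣ ≤ n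
  bound = ∣∣≤n _

  grow : ∀ k (Z : VSet n) → Z v ≡ true → (∀ y → Z y ≡ true → Star (Arc D) v y) → ∣ ∁ Z ∣ ≤ k → Reachable D v
  grow k Z Zv sd le with any? (λ x → any? (λ y → (Z x ≟ᵇ true) ×-dec (Z y ≟ᵇ false) ×-dec (D x y ≟ᵇ true)))
  ... | no none = record { Z = Z ; source = Zv ; closed = closed ; sound = sd }
    where
    closed : Closed D Z
    closed x y p a with Z y in q
    ... | true  = refl
    ... | false = ⊥-elim (none (x , y , p , q , a))
  grow zero Z Zv sd le | yes (x , y , p , q , a)
    with () ← ≤-trans (member⇒1≤∣∣ (∁ Z) {y} (cong not q)) le
  grow (suc k) Z Zv sd le | yes (x , y , p , q , a) =
    grow k (insert y Z) (insert-⊇ y Z v Zv) sd′ (≤-pred (≤-trans shrink le))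
    where
    sd′ : ∀ z → insert y Z z ≡ true → Star (Arc D) v z
    sd′ z r with insert-inv y Z z r
    ... | inj₁ Zz   = sd z Zz
    ... | inj₂ refl = sd x p ◅◅ a ◅ ε
    shrink : ∣ ∁ (insert y Z) ∣ < ∣ ∁ Z ∣
    shrink = ∣∣-strict {S = ∁ (insert y Z)} (λ z r → sub z r) {y} (cong not q) (cong not (insert-self y Z))
      where
      sub : ∀ z → ∁ (insert y Z) z ≡ true → ∁ Z z ≡ true
      sub z r with Z z
      sub z () | true
      sub z r  | false = refl

-- Orientations

-- Equivalently, every vertex is reachable from every other.
Strong : ∀ {n} → BRel n → Set
Strong D = ∀ Z → Closed D Z → ∀ {x} → Z x ≡ true → ∀ y → Z y ≡ true

-- A bridge is represented by one of its sides, with `u` the inner end; the other side is a second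
-- witness of the same bridge, by `∁-BridgeAt`.
record BridgeAt {n} (H : BRel n) (S : VSet n) (u v : Fin n) : Set where
  constructor bridgeAt
  field
    inside  : S u ≡ true
    outside : S v ≡ false
    edge    : Arc H u v
    only    : ∀ x y → S x ≡ true → S y ≡ false → Arc H x y → x ≡ u × y ≡ v

Bridge : ∀ {n} → BRel n → VSet n → Set
Bridge H S = ∃ λ u → ∃ λ v → BridgeAt H S u v

not-true : ∀ {b} → not b ≡ true → b ≡ false
not-true {false} _ = refl

not-false : ∀ {b} → not b ≡ false → b ≡ true
not-false {true} _ = refl

Symm : ∀ {n} → BRel n → Set
Symm A = ∀ x y → A x y ≡ A y x

∁-BridgeAt : ∀ {n} {H : BRel n} → Symm H → ∀ {S u v} → BridgeAt H S u v → BridgeAt H (∁ S) v u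
∁-BridgeAt H-sym {u = u} {v} (bridgeAt i o e only) = bridgeAt (cong not o) (cong not i) (trans (H-sym v u) e)
  (λ x y p q a → let (y≡u , x≡v) = only y x (not-false q) (not-true p) (trans (H-sym y x) a) in x≡v , y≡u)

removeArc : ∀ {n} → BRel n → Fin n → Fin n → BRel n
removeArc D u v x y = D x y ∧ not (⌊ x ≟ u ⌋ ∧ ⌊ y ≟ v ⌋)

removeArc-⊆ : ∀ {n} (D : BRel n) {u v} x y → Arc (removeArc D u v) x y → Arc D x y
removeArc-⊆ D x y a with D x y
... | true = refl
removeArc-⊆ D x y () | false

removeArc-gone : ∀ {n} (D : BRel n) u v → removeArc D u v u v ≡ false
removeArc-gone D u v with D u v | u ≟ u | v ≟ v
... | false | _      | _      = refl
... | true  | yes _  | yes _  = refl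
... | true  | no u≢u | _      = ⊥-elim (u≢u refl)
... | true  | yes _  | no v≢v = ⊥-elim (v≢v refl)

removeArc-keep : ∀ {n} (D : BRel n) u v x y → Arc D x y → Arc (removeArc D u v) x y ⊎ (x ≡ u × y ≡ v)
removeArc-keep D u v x y a with x ≟ u | y ≟ v
... | yes p | yes q = inj₂ (p , q)
... | yes _ | no _  = inj₁ (cong (_∧ true) a)
... | no _  | yes _ = inj₁ (cong (_∧ true) a)
... | no _  | no _  = inj₁ (cong (_∧ true) a)

-- A mixed graph on the edges of H; an edge with arcs in both directions is undirected.
record Orientation {n} (H : BRel n) : Set where
  field
    D      : BRel n
    D⊆H    : ∀ x y → Arc D x y → Arc H x y
    cover  : ∀ x y → Arc H x y → Arc D x y ⊎ Arc D y x
    strong : Strong D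

OneWay : ∀ {n} → BRel n → Fin n → Fin n → Set
OneWay D u v = Arc D u v → Arc D v u → ⊥

module _ {n} (H : BRel n) (H-irr : ∀ x → H x x ≡ false) where

  open Orientation

  -- Thanks to the walk, a set closed without the arc `u → v` is closed with it, so strength is
  -- inherited. The edge stays covered by `v → u`, which differs from the removed arc because `H`
  -- has no loops.
  drop-redundant : (O : Orientation H) → ∀ {u v} → Arc (D O) v u → Star (Arc (removeArc (D O) u v)) u v →
    Orientation H
  drop-redundant O {u} {v} vu s = record
    { D      = removeArc (D O) u v
    ; D⊆H    = λ x y a → D⊆H O x y (removeArc-⊆ (D O) x y a)
    ; cover  = cover′
    ; strong = λ Z c → strong O Z (reclose Z c)
    }
    where
    vu-kept : Arc (removeArc (D O) u v) v u
    vu-kept with removeArc-keep (D O) u v v u vu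
    ... | inj₁ a          = a
    ... | inj₂ (refl , _) = ⊥-elim (true≢false (D⊆H O v v vu) (H-irr v))

    cover′ : ∀ x y → Arc H x y → Arc (removeArc (D O) u v) x y ⊎ Arc (removeArc (D O) u v) y x
    cover′ x y e with cover O x y e
    ... | inj₁ a with removeArc-keep (D O) u v x y a
    ...   | inj₁ a′            = inj₁ a′
    ...   | inj₂ (refl , refl) = inj₂ vu-kept
    cover′ x y e | inj₂ a with removeArc-keep (D O) u v y x a
    ...   | inj₁ a′            = inj₂ a′
    ...   | inj₂ (refl , refl) = inj₁ vu-kept

    reclose : ∀ Z → Closed (removeArc (D O) u v) Z → Closed (D O) Z
    reclose Z c x y p a with removeArc-keep (D O) u v x y a
    ... | inj₁ a′            = c x y p a′
    ... | inj₂ (refl , refl) = Closed-Star c s p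

  -- If neither direction is redundant, the sets S and T reachable from u and v without
  -- the edge are disjoint and cover everything, because S ∩ T and S ∪ T are closed.
  irredundant⇒bridge : (O : Orientation H) → ∀ {u v} → Arc (D O) u v →
    (S : Reachable (removeArc (D O) u v) u) (T : Reachable (removeArc (D O) v u) v) →
    Reachable.Z S v ≡ false → Reachable.Z T u ≡ false → BridgeAt H (Reachable.Z S) u v
  irredundant⇒bridge O {u} {v} uv RS RT Sv Tu = bridgeAt (Reachable.source RS) Sv (D⊆H O u v uv) only
    where
    S = Reachable.Z RS
    T = Reachable.Z RT

    leaveS : ∀ x y → S x ≡ true → Arc (D O) x y → S y ≡ true ⊎ (x ≡ u × y ≡ v)
    leaveS x y p a with removeArc-keep (D O) u v x y a
    ... | inj₁ a′ = inj₁ (Reachable.closed RS x y p a′)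
    ... | inj₂ e  = inj₂ e

    leaveT : ∀ x y → T x ≡ true → Arc (D O) x y → T y ≡ true ⊎ (x ≡ v × y ≡ u)
    leaveT x y p a with removeArc-keep (D O) v u x y a
    ... | inj₁ a′ = inj₁ (Reachable.closed RT x y p a′)
    ... | inj₂ e  = inj₂ e

    disjoint : ∀ x → S x ≡ true → T x ≡ true → ⊥
    disjoint x p q = true≢false (∧-right {S u} (strong O (λ z → S z ∧ T z) closed {x} (∧-intro p q) u)) Tu
      where
      closed : Closed (D O) (λ z → S z ∧ T z)
      closed y z r a with leaveS y z (∧-left r) a | leaveT y z (∧-right {S y} r) a
      ... | inj₁ p          | inj₁ q          = ∧-intro p q
      ... | inj₂ (refl , _) | _               = ⊥-elim (true≢false (∧-right {S y} r) Tu)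
      ... | _               | inj₂ (refl , _) = ⊥-elim (true≢false (∧-left r) Sv)

    exhaust : ∀ x → S x ≡ true ⊎ T x ≡ true
    exhaust x = ∨-inv (strong O (λ z → S z ∨ T z) closed {u} (∨-introˡ (Reachable.source RS)) x)
      where
      closed : Closed (D O) (λ z → S z ∨ T z)
      closed y z r a with ∨-inv {S y} r
      closed y z r a | inj₁ p with leaveS y z p a
      ... | inj₁ q          = ∨-introˡ q
      ... | inj₂ (_ , refl) = ∨-introʳ (S z) (Reachable.source RT)
      closed y z r a | inj₂ p with leaveT y z p a
      ... | inj₁ q          = ∨-introʳ (S z) q
      ... | inj₂ (_ , refl) = ∨-introˡ (Reachable.source RS)

    only : ∀ x y → S x ≡ true → S y ≡ false → Arc H x y → x ≡ u × y ≡ v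
    only x y p q e with cover O x y e
    ... | inj₁ a with leaveS x y p a
    ...   | inj₁ r = ⊥-elim (true≢false r q)
    ...   | inj₂ e′ = e′
    only x y p q e | inj₂ a with exhaust y
    ... | inj₁ r = ⊥-elim (true≢false r q)
    ... | inj₂ r with leaveT y x r a
    ...   | inj₁ r′ = ⊥-elim (disjoint x p r′)
    ...   | inj₂ (y≡v , x≡u) = x≡u , y≡v

  -- A direction of an undirected edge may go if a detour replaces it. Without a detour either way
  -- `irredundant⇒bridge` applies, so bridges alone stay undirected. The inclusion of arcs is
  -- recorded so that edges treated earlier stay one-way.
  orient-edge : (O : Orientation H) → ∀ u v → ∃ λ (O′ : Orientation H) → (∀ x y → Arc (D O′) x y → Arc (D O) x y) ×
    (OneWay (D O′) u v ⊎ ∃ λ S → BridgeAt H S u v)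
  orient-edge O u v with D O u v in uv | D O v u in vu
  ... | false | _     = O , (λ _ _ a → a) , inj₁ (λ a _ → true≢false a uv)
  ... | true  | false = O , (λ _ _ a → a) , inj₁ (λ _ a → true≢false a vu)
  ... | true  | true  with reachable (removeArc (D O) u v) u | reachable (removeArc (D O) v u) v
  ...   | RS | RT with Reachable.Z RS v in Sv | Reachable.Z RT u in Tu
  ...     | true  | _     = drop-redundant O vu (Reachable.sound RS v Sv) , (λ x y → removeArc-⊆ (D O) x y) ,
                            inj₁ (λ a _ → true≢false a (removeArc-gone (D O) u v))
  ...     | false | true  = drop-redundant O uv (Reachable.sound RT u Tu) , (λ x y → removeArc-⊆ (D O) x y) ,
                            inj₁ (λ _ a → true≢false a (removeArc-gone (D O) v u))
  ...     | false | false = O , (λ _ _ a → a) , inj₂ (Reachable.Z RS , irredundant⇒bridge O uv RS RT Sv Tu)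

module _ {n} (H : BRel n) (H-irr : ∀ x → H x x ≡ false) where

  open Orientation

  orient-edges : (O : Orientation H) (ps : List (Fin n × Fin n)) → ∃ λ (O′ : Orientation H) →
    (∀ x y → Arc (D O′) x y → Arc (D O) x y) ×
    All (λ (u , v) → OneWay (D O′) u v ⊎ ∃ λ S → BridgeAt H S u v) ps
  orient-edges O [] = O , (λ _ _ a → a) , []
  orient-edges O ((u , v) ∷ ps) with orient-edge H H-irr O u v
  ... | O₁ , ⊆₁ , done with orient-edges O₁ ps
  ... | O₂ , ⊆₂ , rest = O₂ , (λ x y a → ⊆₁ x y (⊆₂ x y a)) , keep done ∷ rest
    where
    keep : _ → _
    keep (inj₁ ow) = inj₁ (λ a b → ow (⊆₂ u v a) (⊆₂ v u b))
    keep (inj₂ br) = inj₂ br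

  -- Robbins' theorem in the presence of bridges: starting with all edges undirected, strength is
  -- kept while every edge that is not a bridge gets a direction.
  robbins : Strong H → ∃ λ (O : Orientation H) → ∀ u v → OneWay (D O) u v ⊎ ∃ λ S → BridgeAt H S u v
  robbins H-strong with orient-edges full (cartesianProduct (allFin n) (allFin n))
    where
    full : Orientation H
    full = record { D = H ; D⊆H = λ _ _ a → a ; cover = λ _ _ → inj₁ ; strong = H-strong }
  ... | O , _ , done = O , λ u v → All.lookup done (∈-cartesianProduct⁺ (∈-allFin u) (∈-allFin v))

-- Directing the bridges from `s` to `t`

_⊑_ : ∀ {n} → VSet n → VSet n → Set
S ⊑ T = ∀ x → S x ≡ true → T x ≡ true

Separates : ∀ {n} → VSet n → Fin n → Fin n → Set
Separates S s t = (S s ≡ true × S t ≡ false) ⊎ (S s ≡ false × S t ≡ true)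

-- `chain` encodes unilateral connectivity: closed sets form a chain exactly when of any two
-- vertices one reaches the other. `root` and `sink` say that `s` reaches everything and everything
-- reaches `t`; they are the invariants that let one bridge after another be directed.
record Linear {n} (H : BRel n) (s t : Fin n) (D : BRel n) : Set where
  field
    D⊆H    : ∀ x y → Arc D x y → Arc H x y
    root   : ∀ Z → Closed D Z → Z s ≡ true → ∀ y → Z y ≡ true
    sink   : ∀ Z → Closed D Z → ∀ x → Z x ≡ true → Z t ≡ true
    chain  : ∀ Z W → Closed D Z → Closed D W → Z ⊑ W ⊎ W ⊑ Z

module _ {n} (H : BRel n) (H-sym : Symm H) {s t : Fin n} where

  open Linear

  -- The only set that becomes closed on removing the arc v → u is the far side of the bridge.
  remove-back : ∀ {D S u v} → Linear H s t D → BridgeAt H S u v → S s ≡ true → S t ≡ false →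
    Linear H s t (removeArc D v u)
  remove-back {D} {S} {u} {v} L (bridgeAt Su Sv uv only) Ss St = record
    { D⊆H   = λ x y a → D⊆H L x y (removeArc-⊆ D x y a)
    ; root  = root′
    ; sink  = sink′
    ; chain = chain′
    }
    where
    D′ = removeArc D v u

    exit : ∀ x y → S x ≡ true → Arc D x y → S y ≡ true ⊎ (x ≡ u × y ≡ v)
    exit x y p a with S y in q
    ... | true  = inj₁ refl
    ... | false = inj₂ (only x y p q (D⊆H L x y a))

    -- The union of `Z` and `S` is closed in `D` and contains `s`, hence is everything.
    cover-far : ∀ Z → Closed D′ Z → Z v ≡ true → ∀ x → S x ≡ false → Z x ≡ true
    cover-far Z c Zv x Sx with ∨-inv (root L (λ y → Z y ∨ S y) cl (∨-introʳ (Z s) Ss) x)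
      where
      cl : Closed D (λ y → Z y ∨ S y)
      cl x y p a with ∨-inv {Z x} p
      cl x y p a | inj₂ q with exit x y q a
      ... | inj₁ r          = ∨-introʳ (Z y) r
      ... | inj₂ (_ , refl) = ∨-introˡ Zv
      cl x y p a | inj₁ q with removeArc-keep D v u x y a
      ... | inj₁ a′         = ∨-introˡ (c x y q a′)
      ... | inj₂ (_ , refl) = ∨-introʳ (Z y) Su
    ... | inj₁ q = q
    ... | inj₂ q = ⊥-elim (true≢false q Sx)

    -- Dually, the intersection of `Z` and `S` is closed in `D`; were it nonempty, it would contain
    -- `t`.
    miss-near : ∀ Z → Closed D′ Z → Z u ≡ false → ∀ x → S x ≡ true → Z x ≡ false
    miss-near Z c Zu x Sx with Z x in q
    ... | false = refl
    ... | true  = ⊥-elim (true≢false (∧-right {Z t} (sink L (λ y → Z y ∧ S y) cl x (∧-intro q Sx))) St)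
      where
      cl : Closed D (λ y → Z y ∧ S y)
      cl x y p a with exit x y (∧-right {Z x} p) a
      ... | inj₂ (refl , _) = ⊥-elim (true≢false (∧-left p) Zu)
      ... | inj₁ r with removeArc-keep D v u x y a
      ...   | inj₁ a′         = ∧-intro (c x y (∧-left p) a′) r
      ...   | inj₂ (refl , _) = ⊥-elim (true≢false (∧-right {Z x} p) Sv)

    IsFar : VSet n → Set
    IsFar Z = (∀ x → S x ≡ false → Z x ≡ true) × (∀ x → S x ≡ true → Z x ≡ false)

    classify : ∀ Z → Closed D′ Z → Closed D Z ⊎ IsFar Z
    classify Z c with Z v in Zv | Z u in Zu
    ... | true | false = inj₂ (cover-far Z c Zv , miss-near Z c Zu)
    ... | true | true = inj₁ cl
      where
      cl : Closed D Z
      cl x y p a with removeArc-keep D v u x y a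
      ... | inj₁ a′         = c x y p a′
      ... | inj₂ (_ , refl) = Zu
    ... | false | _ = inj₁ cl
      where
      cl : Closed D Z
      cl x y p a with removeArc-keep D v u x y a
      ... | inj₁ a′         = c x y p a′
      ... | inj₂ (refl , _) = ⊥-elim (true≢false p Zv)

    D⇒D′ : ∀ {Z} → Closed D Z → Closed D′ Z
    D⇒D′ c x y p a = c x y p (removeArc-⊆ D x y a)

    root′ : ∀ Z → Closed D′ Z → Z s ≡ true → ∀ y → Z y ≡ true
    root′ Z c p y with classify Z c
    ... | inj₁ c′      = root L Z c′ p y
    ... | inj₂ (_ , m) = ⊥-elim (true≢false p (m s Ss))

    sink′ : ∀ Z → Closed D′ Z → ∀ x → Z x ≡ true → Z t ≡ true
    sink′ Z c x p with classify Z c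
    ... | inj₁ c′      = sink L Z c′ x p
    ... | inj₂ (f , _) = f t St

    far-comparable : ∀ Z W → IsFar Z → Closed D W → Z ⊑ W ⊎ W ⊑ Z
    far-comparable Z W (f , m) c with W u in Wu
    ... | true = inj₁ far⊑
      where
      -- The arc `u → v` must be present: otherwise the intersection of `W` and `S` would be closed
      -- and nonempty but miss `t`.
      Wv : W v ≡ true
      Wv with D u v in uv′
      ... | true  = c u v Wu uv′
      ... | false = ⊥-elim (true≢false (∧-right {W t} (sink L (λ y → W y ∧ S y) cl u (∧-intro Wu Su))) St)
        where
        cl : Closed D (λ y → W y ∧ S y)
        cl x y p a with exit x y (∧-right {W x} p) a
        ... | inj₁ r             = ∧-intro (c x y (∧-left p) a) r
        ... | inj₂ (refl , refl) = ⊥-elim (true≢false a uv′)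
      far⊑ : Z ⊑ W
      far⊑ x p with S x in q
      ... | true  = ⊥-elim (true≢false p (m x q))
      ... | false = cover-far W (D⇒D′ c) Wv x q
    ... | false = inj₂ ⊑far
      where
      ⊑far : W ⊑ Z
      ⊑far x p with S x in q
      ... | true  = ⊥-elim (true≢false p (miss-near W (D⇒D′ c) Wu x q))
      ... | false = f x q

    chain′ : ∀ Z W → Closed D′ Z → Closed D′ W → Z ⊑ W ⊎ W ⊑ Z
    chain′ Z W c d with classify Z c | classify W d
    ... | inj₁ c′      | inj₁ d′      = chain L Z W c′ d′
    ... | inj₂ far     | inj₁ d′      = far-comparable Z W far d′
    ... | inj₁ c′      | inj₂ far     = [ inj₂ , inj₁ ]′ (far-comparable W Z far c′)
    ... | inj₂ (f , m) | inj₂ (f′ , m′) = inj₁ Z⊑W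
      where
      Z⊑W : Z ⊑ W
      Z⊑W x p with S x in q
      ... | true  = ⊥-elim (true≢false p (m x q))
      ... | false = f′ x q

  -- Bridges refer to `H`, which never changes, so `ob` stays applicable however many arcs `D` has
  -- lost. The side that holds `s` decides which of the two arcs points back.
  remove-backs : (∀ {S u v} → BridgeAt H S u v → Separates S s t) → ∀ {D} → Linear H s t D →
    (∀ u v → OneWay D u v ⊎ ∃ λ S → BridgeAt H S u v) → (ps : List (Fin n × Fin n)) →
    ∃ λ D′ → Linear H s t D′ × (∀ x y → Arc D′ x y → Arc D x y) × All (λ (u , v) → OneWay D′ u v) ps
  remove-backs sep {D} L ob [] = D , L , (λ _ _ a → a) , []
  remove-backs sep {D} L ob ((u , v) ∷ ps) with remove-backs sep L ob ps
  ... | D₁ , L₁ , ⊆₁ , rest with ob u v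
  ...   | inj₁ ow = D₁ , L₁ , ⊆₁ , (λ a b → ow (⊆₁ u v a) (⊆₁ v u b)) ∷ rest
  ...   | inj₂ (S , b) with sep b
  ...     | inj₁ (Ss , St) = removeArc D₁ v u , remove-back L₁ b Ss St ,
              (λ x y a → ⊆₁ x y (removeArc-⊆ D₁ x y a)) ,
              (λ _ a → true≢false a (removeArc-gone D₁ v u)) ∷
              All.map (λ ow a b → ow (removeArc-⊆ D₁ _ _ a) (removeArc-⊆ D₁ _ _ b)) rest
  ...     | inj₂ (Ss , St) = removeArc D₁ u v , remove-back L₁ (∁-BridgeAt H-sym b) (cong not Ss) (cong not St) ,
              (λ x y a → ⊆₁ x y (removeArc-⊆ D₁ x y a)) ,
              (λ a _ → true≢false a (removeArc-gone D₁ u v)) ∷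
              All.map (λ ow a b → ow (removeArc-⊆ D₁ _ _ a) (removeArc-⊆ D₁ _ _ b)) rest

  -- In the strong mixed graph given by `robbins` a closed set is empty or everything, which is a
  -- chain. Directing the remaining bridges preserves the chain; comparing the sets reachable from
  -- `x` and from `y` then yields a walk between them.
  unilateral-orientation : (∀ x → H x x ≡ false) → Strong H → (∀ {S u v} → BridgeAt H S u v → Separates S s t) →
    ∃ λ D → (∀ x y → Arc D x y → Arc H x y) × (∀ x y → OneWay D x y) ×
            (∀ x y → Star (Arc D) x y ⊎ Star (Arc D) y x)
  unilateral-orientation H-irr H-strong sep with robbins H H-irr H-strong
  ... | O , ob with remove-backs sep linear ob (cartesianProduct (allFin n) (allFin n))
    where
    linear : Linear H s t (Orientation.D O)
    linear = record
      { D⊆H   = Orientation.D⊆H O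
      ; root  = λ Z c p → Orientation.strong O Z c p
      ; sink  = λ Z c x p → Orientation.strong O Z c p t
      ; chain = λ Z W c d → comparable Z W c d
      }
      where
      comparable : ∀ Z W → Closed (Orientation.D O) Z → Closed (Orientation.D O) W → Z ⊑ W ⊎ W ⊑ Z
      comparable Z W c d with any? (λ x → W x ≟ᵇ true)
      ... | yes (x , p) = inj₁ (λ y _ → Orientation.strong O W d p y)
      ... | no none     = inj₂ (λ y p → ⊥-elim (none (y , p)))
  ... | D , L , _ , ow = D , D⊆H L , (λ x y → All.lookup ow (∈-cartesianProduct⁺ (∈-allFin x) (∈-allFin y))) , total
    where
    total : ∀ x y → Star (Arc D) x y ⊎ Star (Arc D) y x
    total x y with reachable D x | reachable D y
    ... | X | Y with chain L (Reachable.Z X) (Reachable.Z Y) (Reachable.closed X) (Reachable.closed Y)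
    ...   | inj₁ X⊑Y = inj₂ (Reachable.sound Y x (X⊑Y x (Reachable.source X)))
    ...   | inj₂ Y⊑X = inj₁ (Reachable.sound X y (Y⊑X y (Reachable.source Y)))

-- Bridges and leaves

push : ∀ {n} → Bool → VSet n → VSet (suc n)
push b S zero    = b
push b S (suc x) = S x

Extensional : ∀ {n} → (VSet n → Set) → Set
Extensional P = ∀ {S T} → S ≗ T → P S → P T

-- Exhaustive search over all subsets. `push` rebuilds a set only up to pointwise equality, hence
-- the condition `Extensional`.
anySet? : ∀ {n} {P : VSet n → Set} → Extensional P → (∀ S → Dec (P S)) → Dec (∃ P)
anySet? {zero} {P} ext P? = map′ (λ p → empty , p) (λ (S , p) → ext (λ ()) p) (P? empty)
  where
  empty : VSet 0
  empty ()
anySet? {suc n} {P} ext P? = map′ to from (half true ⊎-dec half false)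
  where
  half : ∀ b → Dec (∃ λ S → P (push b S))
  half b = anySet? (λ e → ext (λ { zero → refl ; (suc x) → e x })) (λ S → P? (push b S))
  to : (∃ λ S → P (push true S)) ⊎ (∃ λ S → P (push false S)) → ∃ P
  to (inj₁ (S , p)) = push true S , p
  to (inj₂ (S , p)) = push false S , p
  from : ∃ P → (∃ λ S → P (push true S)) ⊎ (∃ λ S → P (push false S))
  from (S , p) with S zero in eq
  ... | true  = inj₁ (S ∘ suc , ext (λ { zero → eq ; (suc x) → refl }) p)
  ... | false = inj₂ (S ∘ suc , ext (λ { zero → eq ; (suc x) → refl }) p)

minimalSet : ∀ {n} {P : VSet n → Set} → Extensional P → (∀ S → Dec (P S)) →
  (f : VSet n → ℕ) → (∀ {S T} → S ≗ T → f S ≡ f T) → ∃ P →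
  ∃ λ S → P S × (∀ T → P T → f S ≤ f T)
minimalSet {n} {P} ext P? f f-ext (S₀ , p₀) = descend (f S₀) S₀ p₀ ≤-refl
  where
  descend : ∀ k S → P S → f S ≤ k → ∃ λ S → P S × (∀ T → P T → f S ≤ f T)
  descend k S p le with anySet? {P = λ T → P T × f T < f S}
                          (λ e (q , lt) → ext e q , subst (_< f S) (f-ext e) lt)
                          (λ T → P? T ×-dec (f T <? f S))
  ... | no none = S , p , λ T q → ≮⇒≥ (λ lt → none (T , q , lt))
  descend zero    S p le | yes (T , q , lt) with () ← ≤-trans lt le
  descend (suc k) S p le | yes (T , q , lt) = descend k T q (≤-pred (≤-trans lt le))

Bridge? : ∀ {n} (H : BRel n) S → Dec (Bridge H S)
Bridge? H S = any? λ u → any? λ v → map′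
  (λ (i , o , e , f) → bridgeAt i o e f)
  (λ b → let open BridgeAt b in inside , outside , edge , only)
  ((S u ≟ᵇ true) ×-dec (S v ≟ᵇ false) ×-dec (H u v ≟ᵇ true) ×-dec
   all? λ x → all? λ y → (S x ≟ᵇ true) →-dec ((S y ≟ᵇ false) →-dec ((H x y ≟ᵇ true) →-dec ((x ≟ u) ×-dec (y ≟ v)))))

Bridge-ext : ∀ {n} (H : BRel n) → Extensional (Bridge H)
Bridge-ext H e (u , v , bridgeAt i o ed only) = u , v , bridgeAt (trans (sym (e u)) i) (trans (sym (e v)) o) ed
  (λ x y p q → only x y (trans (e x) p) (trans (e y) q))

∣∣-ext : ∀ {n} {S T : VSet n} → S ≗ T → ∣ S ∣ ≡ ∣ T ∣
∣∣-ext e = sum-cong-≗ (λ x → cong ⟦_⟧ (e x))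

Disjoint : ∀ {n} → VSet n → VSet n → Set
Disjoint S T = ∀ x → S x ≡ true → T x ≡ true → ⊥

-- An obstruction to any choice of `s` and `t`: each of the three sets would have to contain exactly
-- one of the two, but the sets are disjoint.
record ThreeLeaves {n} (H : BRel n) : Set where
  field
    L          : Fin 3 → VSet n
    bridge     : ∀ i → Bridge H (L i)
    disjoint   : ∀ {i j} → i ≢ j → Disjoint (L i) (L j)

module _ {n} (H : BRel n) (H-sym : Symm H) (H-strong : Strong H) where

  ∁-Bridge : ∀ {S} → Bridge H S → Bridge H (∁ S)
  ∁-Bridge (u , v , b) = v , u , ∁-BridgeAt H-sym b

  -- The edge of `Y` has its inner end outside `X`, so no edge joins the parts of `X` inside and
  -- outside `Y`. The single edge leaving `X` starts in one of these parts; the other is closed,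
  -- nonempty and not everything.
  half-corner : ∀ {X Y u v u′ v′} → BridgeAt H X u v → BridgeAt H Y u′ v′ → X u′ ≡ false →
    ∀ {p q} → X p ≡ true → Y p ≡ true → X q ≡ true → Y q ≡ false → ⊥
  half-corner {X} {Y} {u} {v} {u′} bX bY Xu′ {p} {q} Xp Yp Xq Yq with Y u in Yu
  ... | true = true≢false Yp (not-true (∧-right {X p} (H-strong (λ x → X x ∧ not (Y x)) closed {q} (∧-intro Xq (cong not Yq)) p)))
    where
    closed : Closed H (λ x → X x ∧ not (Y x))
    closed x y r a with X y in Xy | Y y in Yy
    ... | true  | false = refl
    ... | false | _     with refl , _ ← BridgeAt.only bX x y (∧-left r) Xy a = ⊥-elim (true≢false Yu (not-true (∧-right {X x} r)))
    ... | true  | true  with refl , _ ← BridgeAt.only bY y x Yy (not-true (∧-right {X x} r)) (trans (H-sym y x) a) = ⊥-elim (true≢false Xy Xu′)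
  ... | false = true≢false (∧-right {X q} (H-strong (λ x → X x ∧ Y x) closed {p} (∧-intro Xp Yp) q)) Yq
    where
    closed : Closed H (λ x → X x ∧ Y x)
    closed x y r a with X y in Xy | Y y in Yy
    ... | true  | true  = refl
    ... | false | _     with refl , _ ← BridgeAt.only bX x y (∧-left r) Xy a = ⊥-elim (true≢false (∧-right {X x} r) Yu)
    ... | true  | false with refl , _ ← BridgeAt.only bY x y (∧-right {X x} r) Yy a = ⊥-elim (true≢false (∧-left r) Xu′)

  -- Bridge sides never cross: the inner end of the edge of `Y` lies outside `X` or outside its
  -- complement, and `half-corner` applies to that set.
  cross-free : ∀ {X Y} → Bridge H X → Bridge H Y → ∀ {p q r w} →
    X p ≡ true → Y p ≡ true → X q ≡ true → Y q ≡ false →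
    X r ≡ false → Y r ≡ true → X w ≡ false → Y w ≡ false → ⊥
  cross-free {X} (u , v , bX) (u′ , v′ , bY) Xp Yp Xq Yq Xr Yr Xw Yw with X u′ in e
  ... | false = half-corner bX bY e Xp Yp Xq Yq
  ... | true  = half-corner (∁-BridgeAt H-sym bX) bY (cong not e) (cong not Xr) Yr (cong not Xw) Yw

  -- By `cross-free` one of the two corners outside `X` is empty, so `Y` or its complement lies in
  -- `X`; `q` or `p` makes the inclusion strict. The clause on `w` serves to rule out the second
  -- case when `Y` misses a known vertex outside `X`.
  nested : ∀ {X Y} → Bridge H X → Bridge H Y → ∀ {p q} →
    X p ≡ true → Y p ≡ true → X q ≡ true → Y q ≡ false → ∣ Y ∣ < ∣ X ∣ ⊎ (∣ ∁ Y ∣ < ∣ X ∣ × ∀ w → X w ≡ false → Y w ≡ true)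
  nested {X} {Y} bX bY {p} {q} Xp Yp Xq Yq with any? (λ r → (X r ≟ᵇ false) ×-dec (Y r ≟ᵇ true))
  ... | no none = inj₁ (∣∣-strict sub Xq Yq)
    where
    sub : Y ⊑ X
    sub r Yr with X r in Xr
    ... | true  = refl
    ... | false = ⊥-elim (none (r , Xr , Yr))
  ... | yes (r , Xr , Yr) = inj₂ (∣∣-strict sub Xp (cong not Yp) , out)
    where
    out : ∀ w → X w ≡ false → Y w ≡ true
    out w Xw with Y w in Yw
    ... | true  = refl
    ... | false = ⊥-elim (cross-free bX bY Xp Yp Xq Yq Xr Yr Xw Yw)
    sub : ∁ Y ⊑ X
    sub w Yw with X w in Xw
    ... | true  = refl
    ... | false = ⊥-elim (true≢false (out w Xw) (not-true Yw))

  -- The bridges form a tree on the pieces they separate. `X` is a smallest bridge side, `Y` a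
  -- smallest one avoiding `s`, and `s`, `t` are the inner ends of their edges. A bridge not
  -- separating `s` from `t` has a side `B` avoiding both. If `X` met `Y` or `B`, `nested` would
  -- give a smaller side than `X`. If `Y` met `B`, either `B` would be smaller than `Y` or it would
  -- contain `s`.
  separated-or-three-leaves : Fin n → (∃ λ s → ∃ λ t → ∀ {S u v} → BridgeAt H S u v → Separates S s t) ⊎ ThreeLeaves H
  separated-or-three-leaves x₀ with anySet? (Bridge-ext H) (Bridge? H)
  ... | no none = inj₁ (x₀ , x₀ , λ b → ⊥-elim (none (_ , _ , _ , b)))
  ... | yes ex with minimalSet (Bridge-ext H) (Bridge? H) ∣_∣ ∣∣-ext ex
  ... | X , bX@(s , _ , bXs) , X-min
    with minimalSet {P = λ S → Bridge H S × S s ≡ false} (λ e (b , p) → Bridge-ext H e b , trans (sym (e s)) p)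
           (λ S → Bridge? H S ×-dec (S s ≟ᵇ false)) ∣_∣ ∣∣-ext
           (∁ X , ∁-Bridge bX , cong not (BridgeAt.inside bXs))
  ... | Y , (bY@(t , _ , bYt) , Ys) , Y-min
    with anySet? {P = λ S → Bridge H S × S s ≡ false × S t ≡ false}
           (λ e (b , p , q) → Bridge-ext H e b , trans (sym (e s)) p , trans (sym (e t)) q)
           (λ S → Bridge? H S ×-dec ((S s ≟ᵇ false) ×-dec (S t ≟ᵇ false)))
  ... | no none = inj₁ (s , t , sep)
    where
    sep : ∀ {S u v} → BridgeAt H S u v → Separates S s t
    sep {S} b with S s in Ss | S t in St
    ... | true  | false = inj₁ (refl , refl)
    ... | false | true  = inj₂ (refl , refl)
    ... | false | false = ⊥-elim (none (S , (_ , _ , b) , Ss , St))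
    ... | true  | true  = ⊥-elim (none (∁ S , ∁-Bridge (_ , _ , b) , cong not Ss , cong not St))
  ... | yes (B , bB , Bs , Bt) = inj₂ record { L = L ; bridge = br ; disjoint = dis }
    where
    X-disjoint : ∀ {S} → Bridge H S → S s ≡ false → Disjoint X S
    X-disjoint b Ss p Xp Sp with nested bX b Xp Sp (BridgeAt.inside bXs) Ss
    ... | inj₁ lt       = <⇒≱ lt (X-min _ b)
    ... | inj₂ (lt , _) = <⇒≱ lt (X-min _ (∁-Bridge b))
    YB : Disjoint Y B
    YB p Yp Bp with nested bY bB Yp Bp (BridgeAt.inside bYt) Bt
    ... | inj₁ lt        = <⇒≱ lt (Y-min B (bB , Bs))
    ... | inj₂ (_ , out) = true≢false (out s Ys) Bs
    L : Fin 3 → VSet n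
    L zero             = X
    L (suc zero)       = Y
    L (suc (suc zero)) = B
    br : ∀ i → Bridge H (L i)
    br zero             = bX
    br (suc zero)       = bY
    br (suc (suc zero)) = bB
    dis : ∀ {i j} → i ≢ j → Disjoint (L i) (L j)
    dis {zero}           {zero}           i≢j = ⊥-elim (i≢j refl)
    dis {zero}           {suc zero}       _   = X-disjoint bY Ys
    dis {zero}           {suc (suc zero)} _   = X-disjoint bB Bs
    dis {suc zero}       {zero}           _   = λ x p q → X-disjoint bY Ys x q p
    dis {suc zero}       {suc zero}       i≢j = ⊥-elim (i≢j refl)
    dis {suc zero}       {suc (suc zero)} _   = YB
    dis {suc (suc zero)} {zero}           _   = λ x p q → X-disjoint bB Bs x q p
    dis {suc (suc zero)} {suc zero}       _   = λ x p q → YB x q p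
    dis {suc (suc zero)} {suc (suc zero)} i≢j = ⊥-elim (i≢j refl)

-- Edge cuts

-- Inequalities between cuts are proved pair by pair; each becomes a Boolean statement `taut` that
-- is decided by evaluating all cases.
∀ᵇ? : ∀ {P : Bool → Set} → (∀ b → Dec (P b)) → Dec (∀ b → P b)
∀ᵇ? P? = map′ (λ { (t , f) true → t ; (t , f) false → f }) (λ h → h true , h false) (P? true ×-dec P? false)

sum₂ : ∀ {n} → (Fin n → Fin n → ℕ) → ℕ
sum₂ f = sum (λ x → sum (f x))

sum₂-mono-≤ : ∀ {n} {f g : Fin n → Fin n → ℕ} → (∀ x y → f x y ≤ g x y) → sum₂ f ≤ sum₂ g
sum₂-mono-≤ {n} f≤g = sum-mono-≤ {n} (λ x → sum-mono-≤ {n} (f≤g x))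

sum₂-cong : ∀ {n} {f g : Fin n → Fin n → ℕ} → (∀ x y → f x y ≡ g x y) → sum₂ f ≡ sum₂ g
sum₂-cong {n} f≡g = sum-cong-≗ {n} (λ x → sum-cong-≗ {n} (f≡g x))

sum₂-+ : ∀ {n} (f g : Fin n → Fin n → ℕ) → sum₂ (λ x y → f x y + g x y) ≡ sum₂ f + sum₂ g
sum₂-+ {n} f g = trans (sum-cong-≗ {n} (λ x → ∑-distrib-+ (f x) (g x))) (∑-distrib-+ (λ x → sum (f x)) (λ x → sum (g x)))

sum-*ʳ : ∀ {n} (f : Fin n → ℕ) k → sum f * k ≡ sum (λ x → f x * k)
sum-*ʳ {zero}  f k = refl
sum-*ʳ {suc n} f k = trans (*-distribʳ-+ k (f zero) _) (cong (f zero * k +_) (sum-*ʳ (f ∘ suc) k))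

three-terms≤sum : ∀ {n} (f : Fin n → ℕ) {i j k} → i ≢ j → i ≢ k → j ≢ k → f i + f j + f k ≤ sum f
three-terms≤sum f {zero}  {zero}  {_}     p q r = ⊥-elim (p refl)
three-terms≤sum f {zero}  {suc _} {zero}  p q r = ⊥-elim (q refl)
three-terms≤sum f {suc _} {zero}  {zero}  p q r = ⊥-elim (r refl)
three-terms≤sum f {zero}  {suc j} {suc k} p q r rewrite +-assoc (f zero) (f (suc j)) (f (suc k)) =
  +-monoʳ-≤ (f zero) (two-terms≤sum (f ∘ suc) (r ∘ cong suc))
three-terms≤sum f {suc i} {zero}  {suc k} p q r rewrite +-comm (f (suc i)) (f zero) | +-assoc (f zero) (f (suc i)) (f (suc k)) =
  +-monoʳ-≤ (f zero) (two-terms≤sum (f ∘ suc) (q ∘ cong suc))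
three-terms≤sum f {suc i} {suc j} {zero}  p q r rewrite +-comm (f (suc i) + f (suc j)) (f zero) =
  +-monoʳ-≤ (f zero) (two-terms≤sum (f ∘ suc) (p ∘ cong suc))
three-terms≤sum f {suc i} {suc j} {suc k} p q r =
  ≤-trans (three-terms≤sum (f ∘ suc) (p ∘ cong suc) (q ∘ cong suc) (r ∘ cong suc)) (m≤n+m _ _)

one-member : ∀ {n} (P : VSet n) → 1 ≤ ∣ P ∣ → ∃ λ a → P a ≡ true
one-member {suc n} P le with P zero in e
... | true  = zero , e
... | false with one-member (P ∘ suc) le
...   | a , p = suc a , p

two-members : ∀ {n} (P : VSet n) → 2 ≤ ∣ P ∣ → ∃ λ a → ∃ λ b → a ≢ b × P a ≡ true × P b ≡ true
two-members {suc n} P le with P zero in e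
... | true with one-member (P ∘ suc) (≤-pred le)
...   | b , p = zero , suc b , (λ ()) , e , p
two-members {suc n} P le | false with two-members (P ∘ suc) le
...   | a , b , a≢b , p , q = suc a , suc b , (λ { refl → a≢b refl }) , p , q

cut : ∀ {n} → BRel n → VSet n → ℕ
cut A S = sum₂ (λ x y → ⟦ S x ∧ not (S y) ∧ A x y ⟧)

crossing : ∀ {s t a} → s ≡ true → t ≡ false → a ≡ true → s ∧ not t ∧ a ≡ true
crossing refl refl refl = refl

crossing⁻¹ : ∀ {s t a} → s ∧ not t ∧ a ≡ true → s ≡ true × t ≡ false × a ≡ true
crossing⁻¹ {true} {false} {true} refl = refl , refl , refl

⟦⟧-false : ∀ {b} → (b ≡ true → ⊥) → ⟦ b ⟧ ≡ 0
⟦⟧-false {false} h = refl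
⟦⟧-false {true}  h = ⊥-elim (h refl)

row : ∀ {n} → BRel n → VSet n → Fin n → ℕ
row A S x = sum (λ y → ⟦ S x ∧ not (S y) ∧ A x y ⟧)

edge⇒1≤row : ∀ {n} (A : BRel n) S {x y} → S x ≡ true → S y ≡ false → Arc A x y → 1 ≤ row A S x
edge⇒1≤row A S {x} {y} p q a = ≤-trans (≤-reflexive (sym (cong ⟦_⟧ (crossing {S x} p q a)))) (term≤sum (λ y → ⟦ S x ∧ not (S y) ∧ A x y ⟧) y)

edge⇒1≤cut : ∀ {n} (A : BRel n) S {x y} → S x ≡ true → S y ≡ false → Arc A x y → 1 ≤ cut A S
edge⇒1≤cut A S {x} p q a = ≤-trans (edge⇒1≤row A S p q a) (term≤sum (row A S) x)

bridge⇒cut≤1 : ∀ {n} (H : BRel n) {S} → Bridge H S → cut H S ≤ 1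
bridge⇒cut≤1 {n} H {S} (u , v , b) = ≤-trans (≤-reflexive (trans rows (columns))) (⟦⟧≤1 _)
  where
  rows : cut H S ≡ row H S u
  rows = sum-single (row H S) u λ x x≢u → sum-zero {n} λ y → ⟦⟧-false λ c →
    let (p , q , a) = crossing⁻¹ {S x} c in x≢u (proj₁ (BridgeAt.only b x y p q a))
  columns : row H S u ≡ ⟦ S u ∧ not (S v) ∧ H u v ⟧
  columns = sum-single (λ y → ⟦ S u ∧ not (S y) ∧ H u y ⟧) v λ y y≢v → ⟦⟧-false λ c →
    let (p , q , a) = crossing⁻¹ {S u} c in y≢v (proj₂ (BridgeAt.only b u y p q a))

closed⇒cut≡0 : ∀ {n} (H : BRel n) {S} → Closed H S → cut H S ≡ 0
closed⇒cut≡0 {n} H {S} c = sum-zero {n} λ x → sum-zero {n} λ y → ⟦⟧-false λ e →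
  let (p , q , a) = crossing⁻¹ {S x} e in true≢false (c x y p a) q

cut-∁ : ∀ {n} {A : BRel n} → Symm A → ∀ S → cut A (∁ S) ≡ cut A S
cut-∁ {n} {A} A-sym S = trans (∑-comm (λ x y → ⟦ ∁ S x ∧ not (∁ S y) ∧ A x y ⟧)) (sum₂-cong {n} flip)
  where
  taut : ∀ s t a → ⟦ not s ∧ not (not t) ∧ a ⟧ ≡ ⟦ t ∧ not s ∧ a ⟧
  taut = toWitness {a? = ∀ᵇ? λ s → ∀ᵇ? λ t → ∀ᵇ? λ a → ⟦ not s ∧ not (not t) ∧ a ⟧ ≟ⁿ ⟦ t ∧ not s ∧ a ⟧} tt
  flip : ∀ y x → ⟦ ∁ S x ∧ not (∁ S y) ∧ A x y ⟧ ≡ ⟦ S y ∧ not (S x) ∧ A y x ⟧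
  flip y x rewrite A-sym x y = taut (S x) (S y) (A y x)

-- Every vertex of S has at most ∣ S ∣ ∸ 1 neighbours inside S.
size-bound : ∀ {n} (A : BRel n) → (∀ x → A x x ≡ false) → ∀ {d} → (∀ x → d ≤ ∣ A x ∣) →
  ∀ S → ∣ S ∣ * suc d ≤ ∣ S ∣ * ∣ S ∣ + cut A S
size-bound {n} A irr {d} deg S = begin
  ∣ S ∣ * suc d                                        ≡⟨ sum-*ʳ (⟦_⟧ ∘ S) (suc d) ⟩
  sum (λ x → ⟦ S x ⟧ * suc d)                          ≤⟨ sum-mono-≤ {n} per-vertex ⟩
  sum (λ x → ⟦ S x ⟧ * ∣ S ∣ + row A S x)              ≡⟨ ∑-distrib-+ (λ x → ⟦ S x ⟧ * ∣ S ∣) (row A S) ⟩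
  sum (λ x → ⟦ S x ⟧ * ∣ S ∣) + cut A S                ≡⟨ cong (_+ cut A S) (sym (sum-*ʳ (⟦_⟧ ∘ S) ∣ S ∣)) ⟩
  ∣ S ∣ * ∣ S ∣ + cut A S                              ∎
  where
  open ≤-Reasoning
  taut : ∀ s a → ⟦ a ⟧ ≤ ⟦ s ⟧ + ⟦ not s ∧ a ⟧
  taut = toWitness {a? = ∀ᵇ? λ s → ∀ᵇ? λ a → ⟦ a ⟧ ≤? ⟦ s ⟧ + ⟦ not s ∧ a ⟧} tt
  per-vertex : ∀ x → ⟦ S x ⟧ * suc d ≤ ⟦ S x ⟧ * ∣ S ∣ + row A S x
  per-vertex x with S x in Sx
  ... | false = z≤n
  ... | true  rewrite +-identityʳ d | +-identityʳ ∣ S ∣ = begin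
    suc d                                              ≤⟨ s≤s (deg x) ⟩
    suc ∣ A x ∣                                        ≤⟨ sum-mono-< {n} (λ y → taut (S y) (A x y)) x at-x ⟩
    sum (λ y → ⟦ S y ⟧ + ⟦ not (S y) ∧ A x y ⟧)        ≡⟨ ∑-distrib-+ (⟦_⟧ ∘ S) _ ⟩
    ∣ S ∣ + sum (λ y → ⟦ not (S y) ∧ A x y ⟧)          ∎
    where
    -- The term at `x` is strict, as `x` lies in `S` but is not its own neighbour; this accounts for
    -- the `suc`.
    at-x : ⟦ A x x ⟧ < ⟦ S x ⟧ + ⟦ not (S x) ∧ A x x ⟧
    at-x rewrite irr x | Sx = ≤-refl

s+j≤s*[1+j] : ∀ s j → 1 ≤ s → s + j ≤ s * suc j
s+j≤s*[1+j] (suc s) j _ rewrite +-comm s j = s≤s (+-monoʳ-≤ j (m≤m*n s (suc j)))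

-- If `s ≤ d`, write d = s + j. Then s (d + 1) - s s = s (j + 1) ≥ s + j = d > c.
thick : ∀ {s d c} → s * suc d ≤ s * s + c → 1 ≤ s → c < d → suc d ≤ s
thick {s} {d} {c} le 1≤s c<d with suc d ≤? s
... | yes p = p
... | no ¬p with m≤n⇒∃[o]m+o≡n (≤-pred (≰⇒> ¬p))
...   | j , refl = ⊥-elim (<⇒≱ c<d (≤-trans (s+j≤s*[1+j] s j 1≤s) (+-cancelˡ-≤ (s * s) _ _ le′)))
  where
  le′ : s * s + s * suc j ≤ s * s + c
  le′ = ≤-trans (≤-reflexive (trans (sym (*-distribˡ-+ s s (suc j))) (cong (s *_) (+-suc s j)))) le

bipartite : ∀ {n} → BRel n → VSet n → BRel n
bipartite A σ x y = A x y ∧ (σ x xor σ y)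

bipartite-sym : ∀ {n} {A : BRel n} → Symm A → ∀ σ → Symm (bipartite A σ)
bipartite-sym A-sym σ x y = cong₂ _∧_ (A-sym x y) (xor-comm (σ x) (σ y))

uncut : ∀ {n} → BRel n → VSet n → ℕ
uncut A σ = sum₂ (λ x y → ⟦ A x y ∧ not (σ x xor σ y) ⟧)

-- Flipping `σ` on `S` leaves `K` untouched, and minimality of `uncut` says that nothing is gained:
-- at most half of the edges of `A` across `S` are uncut. `K` and `σ₀` prescribe a part of the
-- bipartition, first nothing and later a 4-cycle.
max-cut : ∀ {n} {A : BRel n} → Symm A → (K σ₀ : VSet n) → ∃ λ σ →
  (∀ x → K x ≡ true → σ x ≡ σ₀ x) ×
  (∀ S → (∀ x → K x ≡ true → S x ≡ false) → cut A S ≤ 2 * cut (bipartite A σ) S)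
max-cut {n} {A} A-sym K σ₀ with minimalSet {P = Agrees} ext (λ σ → all? λ x → (K x ≟ᵇ true) →-dec (σ x ≟ᵇ σ₀ x))
                                 (uncut A) uncut-ext (σ₀ , λ _ _ → refl)
  where
  Agrees : VSet n → Set
  Agrees σ = ∀ x → K x ≡ true → σ x ≡ σ₀ x
  ext : Extensional Agrees
  ext e h x p = trans (sym (e x)) (h x p)
  uncut-ext : ∀ {S T} → S ≗ T → uncut A S ≡ uncut A T
  uncut-ext e = sum₂-cong {n} (λ x y → cong₂ (λ a b → ⟦ A x y ∧ not (a xor b) ⟧) (e x) (e y))
... | σ , agrees , minimal = σ , agrees , λ S off → bound S off
  where
  H N : BRel n
  H = bipartite A σ
  N x y = A x y ∧ not (σ x xor σ y)

  H-sym : Symm H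
  H-sym = bipartite-sym A-sym σ

  N-sym : Symm N
  N-sym x y = cong₂ _∧_ (A-sym x y) (cong not (xor-comm (σ x) (σ y)))

  split : ∀ S → cut A S ≡ cut N S + cut H S
  split S = trans (sum₂-cong {n} (λ x y → taut (S x) (S y) (A x y) (σ x xor σ y)))
                  (sum₂-+ (λ x y → ⟦ S x ∧ not (S y) ∧ N x y ⟧) (λ x y → ⟦ S x ∧ not (S y) ∧ H x y ⟧))
    where
    taut : ∀ s t a e → ⟦ s ∧ not t ∧ a ⟧ ≡ ⟦ s ∧ not t ∧ (a ∧ not e) ⟧ + ⟦ s ∧ not t ∧ (a ∧ e) ⟧
    taut = toWitness {a? = ∀ᵇ? λ s → ∀ᵇ? λ t → ∀ᵇ? λ a → ∀ᵇ? λ e →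
      ⟦ s ∧ not t ∧ a ⟧ ≟ⁿ ⟦ s ∧ not t ∧ (a ∧ not e) ⟧ + ⟦ s ∧ not t ∧ (a ∧ e) ⟧} tt

  -- Flipping S exchanges the cut and the uncut edges across S.
  flip : ∀ S → uncut A (λ x → σ x xor S x) + (cut N S + cut N (∁ S)) ≡ uncut A σ + (cut H S + cut H (∁ S))
  flip S = begin
    uncut A τ + (cut N S + cut N (∁ S))
      ≡⟨ cong (uncut A τ +_) (sym (sum₂-+ (across S N) (across (∁ S) N))) ⟩
    uncut A τ + sum₂ (λ x y → across S N x y + across (∁ S) N x y)
      ≡⟨ sym (sum₂-+ (λ x y → ⟦ A x y ∧ not (τ x xor τ y) ⟧) (λ x y → across S N x y + across (∁ S) N x y)) ⟩
    sum₂ (λ x y → ⟦ A x y ∧ not (τ x xor τ y) ⟧ + (across S N x y + across (∁ S) N x y))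
      ≡⟨ sum₂-cong {n} (λ x y → taut (A x y) (S x) (S y) (σ x) (σ y)) ⟩
    sum₂ (λ x y → ⟦ N x y ⟧ + (across S H x y + across (∁ S) H x y))
      ≡⟨ sum₂-+ (λ x y → ⟦ N x y ⟧) (λ x y → across S H x y + across (∁ S) H x y) ⟩
    uncut A σ + sum₂ (λ x y → across S H x y + across (∁ S) H x y)
      ≡⟨ cong (uncut A σ +_) (sum₂-+ (across S H) (across (∁ S) H)) ⟩
    uncut A σ + (cut H S + cut H (∁ S)) ∎
    where
    open ≡-Reasoning
    τ : VSet n
    τ x = σ x xor S x
    across : VSet n → BRel n → Fin n → Fin n → ℕ
    across S B x y = ⟦ S x ∧ not (S y) ∧ B x y ⟧
    taut : ∀ a s t p q →
      ⟦ a ∧ not ((p xor s) xor (q xor t)) ⟧ +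
        (⟦ s ∧ not t ∧ (a ∧ not (p xor q)) ⟧ + ⟦ not s ∧ not (not t) ∧ (a ∧ not (p xor q)) ⟧) ≡
      ⟦ a ∧ not (p xor q) ⟧ +
        (⟦ s ∧ not t ∧ (a ∧ (p xor q)) ⟧ + ⟦ not s ∧ not (not t) ∧ (a ∧ (p xor q)) ⟧)
    taut = toWitness {a? = ∀ᵇ? λ a → ∀ᵇ? λ s → ∀ᵇ? λ t → ∀ᵇ? λ p → ∀ᵇ? λ q → _ ≟ⁿ _} tt

  bound : ∀ S → (∀ x → K x ≡ true → S x ≡ false) → cut A S ≤ 2 * cut H S
  bound S off = begin
    cut A S                ≡⟨ split S ⟩
    cut N S + cut H S      ≤⟨ +-monoˡ-≤ (cut H S) N≤H ⟩
    cut H S + cut H S      ≡⟨ cong (cut H S +_) (sym (+-identityʳ _)) ⟩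
    2 * cut H S            ∎
    where
    open ≤-Reasoning
    agrees′ : ∀ x → K x ≡ true → (σ x xor S x) ≡ σ₀ x
    agrees′ x p rewrite off x p = trans (xor-identityʳ (σ x)) (agrees x p)
    -- `uncut` counts ordered pairs, so the comparison arrives twice, for `S` and for its
    -- complement.
    2N≤2H : cut N S + cut N S ≤ cut H S + cut H S
    2N≤2H = subst₂ (λ a b → cut N S + a ≤ cut H S + b) (cut-∁ N-sym S) (cut-∁ H-sym S)
      (+-cancelˡ-≤ (uncut A σ) _ _ (≤-trans (+-monoˡ-≤ _ (minimal _ agrees′)) (≤-reflexive (flip S))))
    N≤H : cut N S ≤ cut H S
    N≤H with cut N S ≤? cut H S
    ... | yes p = p
    ... | no ¬p = ⊥-elim (<⇒≱ (+-mono-< (≰⇒> ¬p) (≰⇒> ¬p)) 2N≤2H)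

-- At most one edge leaves `S`. This treats together the sets without boundary, on which
-- connectivity of `H` depends, and the bridge sides.
Thin : ∀ {n} → BRel n → VSet n → Set
Thin H S = ∀ {x y x′ y′} → S x ≡ true → S y ≡ false → Arc H x y →
  S x′ ≡ true → S y′ ≡ false → Arc H x′ y′ → x ≡ x′ × y ≡ y′

Bridge⇒Thin : ∀ {n} {H : BRel n} {S} → Bridge H S → Thin H S
Bridge⇒Thin (u , v , b) p q e p′ q′ e′ with BridgeAt.only b _ _ p q e | BridgeAt.only b _ _ p′ q′ e′
... | refl , refl | refl , refl = refl , refl

Closed⇒Thin : ∀ {n} {H : BRel n} {S} → Closed H S → Thin H S
Closed⇒Thin c p q e _ _ _ = ⊥-elim (true≢false (c _ _ p e) q)

Unsplit : ∀ {n} → VSet n → VSet n → Set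
Unsplit K S = (∀ x → K x ≡ true → S x ≡ false) ⊎ (∀ x → K x ≡ true → S x ≡ true)

xor⇒≢ : ∀ {a b} → a xor b ≡ true → a ≢ b
xor⇒≢ {true} () refl
xor⇒≢ {false} () refl

-- Dense graphs and the tripod obstruction

record Dense {n} (A : BRel n) (d : ℕ) : Set where
  field
    A-sym    : Symm A
    A-irr    : ∀ x → A x x ≡ false
    A-strong : Strong A
    3≤d      : 3 ≤ d
    n≤4d     : n ≤ (d + d) + (d + d)
    deg      : ∀ x → d ≤ ∣ A x ∣

-- Three leaves around one vertex. The bound `size` holds because the other two leaves and the
-- centre take at least 2 d + 3 of the at most 4 d vertices.
record Tripod {n} (A : BRel n) (d : ℕ) (H : BRel n) : Set where
  field
    centre  : Fin n
    L       : Fin 3 → VSet n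
    bridge  : ∀ i → Bridge H (L i)
    small   : ∀ i → cut A (L i) ≤ 2
    large   : ∀ i → suc d ≤ ∣ L i ∣
    size    : ∀ i → ∣ L i ∣ + 3 ≤ d + d
    centre∉ : ∀ i → L i centre ≡ false
    covers  : ∀ x → x ≢ centre → ∃ λ i → L i x ≡ true

module _ {n} {A : BRel n} {d} (dense : Dense A d) where

  open Dense dense

  small-cut⇒large : ∀ {c} S {x} → S x ≡ true → cut A S ≤ c → c < d → suc d ≤ ∣ S ∣
  small-cut⇒large S p le lt = thick (≤-trans (size-bound A A-irr deg S) (+-monoʳ-≤ _ le)) (member⇒1≤∣∣ S p) lt

  record Balanced (σ : VSet n) : Set where
    field
      strong : Strong (bipartite A σ)
      small  : ∀ {S} → Bridge (bipartite A σ) S → cut A S ≤ 2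

  -- A thin set or its complement avoids `K`, so `half` bounds its cut in `A` by twice the cut in
  -- `H`: by 0 if the set is closed in `H`, by 2 if it is a bridge side. In the first case the set
  -- is closed in `A` as well, hence everything.
  balanced : ∀ {K σ} → (∀ S → (∀ x → K x ≡ true → S x ≡ false) → cut A S ≤ 2 * cut (bipartite A σ) S) →
    (∀ S → Thin (bipartite A σ) S → Unsplit K S) → Balanced σ
  balanced {K} {σ} half unsplit = record { strong = strong ; small = small }
    where
    H = bipartite A σ
    H-sym : Symm H
    H-sym = bipartite-sym A-sym σ
    thin-cut : ∀ S → Thin H S → cut A S ≤ 2 * cut H S
    thin-cut S th with unsplit S th
    ... | inj₁ off = half S off
    ... | inj₂ on  = subst₂ (λ a b → a ≤ 2 * b) (cut-∁ A-sym S) (cut-∁ H-sym S) (half (∁ S) (λ x p → cong not (on x p)))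
    strong : Strong H
    strong Z c = A-strong Z A-closed
      where
      A-closed : Closed A Z
      A-closed x y p a with Z y in q
      ... | true  = refl
      ... | false with () ← ≤-trans (edge⇒1≤cut A Z p q a)
                              (subst (λ k → cut A Z ≤ 2 * k) (closed⇒cut≡0 H c) (thin-cut Z (Closed⇒Thin {H = H} c)))
    small : ∀ {S} → Bridge H S → cut A S ≤ 2
    small {S} b = ≤-trans (thin-cut S (Bridge⇒Thin b)) (*-monoʳ-≤ 2 (bridge⇒cut≤1 H b))

-- The edge leaving `X` enters `Y`, so it is also the only edge leaving `Y`. Nothing leaves the
-- union, and strength forces `Z` to meet it.
joined⇒⊥ : ∀ {n} {H : BRel n} → Symm H → Strong H → ∀ {X Y Z : VSet n} {u v} → BridgeAt H X u v → Bridge H Y → Bridge H Z →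
  Disjoint X Y → Disjoint X Z → Disjoint Y Z → Y v ≡ true → ⊥
joined⇒⊥ {H = H} H-sym H-strong {X} {Y} {Z} {u} {v} bX (u′ , v′ , bY) (z , _ , bZ) XY XZ YZ Yv =
  [ (λ p → XZ z p (BridgeAt.inside bZ)) , (λ p → YZ z p (BridgeAt.inside bZ)) ]′
    (∨-inv (H-strong (λ x → X x ∨ Y x) closed {u} (∨-introˡ (BridgeAt.inside bX)) z))
  where
  Yu : Y u ≡ false
  Yu with Y u in e
  ... | false = refl
  ... | true  = ⊥-elim (XY u (BridgeAt.inside bX) e)
  closed : Closed H (λ x → X x ∨ Y x)
  closed x y p a with ∨-inv {X x} p | X y in Xy | Y y in Yy
  ... | _      | true  | _     = refl
  ... | _      | false | true  = refl
  ... | inj₁ q | false | false with refl , refl ← BridgeAt.only bX x y q Xy a = ⊥-elim (true≢false Yv Yy)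
  ... | inj₂ q | false | false
    with refl , refl ← BridgeAt.only bY v u Yv Yu (trans (H-sym v u) (BridgeAt.edge bX))
    with refl , refl ← BridgeAt.only bY x y q Yy a = ⊥-elim (true≢false (BridgeAt.inside bX) Xy)

covered⇒⊥ : ∀ {n} {H : BRel n} → Symm H → Strong H → ∀ {X Y Z : VSet n} → Bridge H X → Bridge H Y → Bridge H Z →
  Disjoint X Y → Disjoint X Z → Disjoint Y Z → (∀ x → X x ≡ true ⊎ Y x ≡ true ⊎ Z x ≡ true) → ⊥
covered⇒⊥ H-sym H-strong (u , v , bX) bY bZ XY XZ YZ cov with cov v
... | inj₁ p        = true≢false p (BridgeAt.outside bX)
... | inj₂ (inj₁ p) = joined⇒⊥ H-sym H-strong bX bY bZ XY XZ YZ p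
... | inj₂ (inj₂ p) = joined⇒⊥ H-sym H-strong bX bZ bY XZ XY (λ x p q → YZ x q p) p

centre-size : ∀ {a b c k d} → suc d ≤ a → suc d ≤ b → suc d ≤ c → a + b + c + k ≤ (d + d) + (d + d) → k + 3 ≤ d
centre-size {a} {b} {c} {k} {d} pa pb pc le = +-cancelˡ-≤ (d + d + d) _ _ (begin
  d + d + d + (k + 3)            ≡⟨ shape d k ⟩
  suc d + suc d + suc d + k      ≤⟨ +-monoˡ-≤ k (+-mono-≤ (+-mono-≤ pa pb) pc) ⟩
  a + b + c + k                  ≤⟨ le ⟩
  (d + d) + (d + d)              ≡⟨ sym (+-assoc (d + d) d d) ⟩
  d + d + d + d                  ∎)
  where
  open ≤-Reasoning
  shape : ∀ d k → d + d + d + (k + 3) ≡ suc d + suc d + suc d + k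
  shape = solve-∀

leaf-size : ∀ {a b c k d} → suc d ≤ b → suc d ≤ c → 1 ≤ k → a + b + c + k ≤ (d + d) + (d + d) → a + 3 ≤ d + d
leaf-size {a} {b} {c} {k} {d} pb pc pk le = +-cancelˡ-≤ (d + d) _ _ (begin
  d + d + (a + 3)                ≡⟨ shape d a ⟩
  a + suc d + suc d + 1          ≤⟨ +-mono-≤ (+-mono-≤ (+-monoʳ-≤ a pb) pc) pk ⟩
  a + b + c + k                  ≤⟨ le ⟩
  (d + d) + (d + d)              ∎)
  where
  open ≤-Reasoning
  shape : ∀ d a → d + d + (a + 3) ≡ a + suc d + suc d + 1
  shape = solve-∀

-- For `k ≥ 2` the second hypothesis gives k (d + 1 - k) ≥ 2 · 4 = 8. The 6 stands for two edges to
-- each of three leaves.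
singleton : ∀ {k d} → k * suc d ≤ k * k + 6 → k + 3 ≤ d → k ≤ 1
singleton {zero}        _  _  = z≤n
singleton {suc zero}    _  _  = ≤-refl
singleton {suc (suc k)} le lt with m≤n⇒∃[o]m+o≡n lt
... | j , refl = ⊥-elim (absurd (+-cancelˡ-≤ (suc (suc k) * suc (suc k)) _ _ (≤-trans (≤-reflexive (shape k j)) le)))
  where
  shape : ∀ k j → (2 + k) * (2 + k) + (8 + (4 * k + (2 + k) * j)) ≡ (2 + k) * suc (2 + k + 3 + j)
  shape = solve-∀
  absurd : ∀ {m} → 8 + m ≤ 6 → ⊥
  absurd (s≤s (s≤s (s≤s (s≤s (s≤s (s≤s ()))))))

module _ {n} {A : BRel n} {d} (dense : Dense A d) where

  open Dense dense

  -- The rest `C` is nonempty, since otherwise two leaves would share their bridge and be cut off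
  -- from the third. Each leaf has more than `d` vertices, which leaves at most d - 3 for `C`, and
  -- `singleton` applies.
  tripod : ∀ {H : BRel n} → Symm H → Strong H → (∀ {S} → Bridge H S → cut A S ≤ 2) → ThreeLeaves H → Tripod A d H
  tripod {H} H-sym H-strong small T with any? (λ x → C x ≟ᵇ true)
    where
    open ThreeLeaves T
    C : VSet n
    C x = not (L 0F x ∨ L 1F x ∨ L 2F x)
  ... | no none = ⊥-elim (covered⇒⊥ H-sym H-strong (bridge 0F) (bridge 1F) (bridge 2F)
                    (disjoint λ ()) (disjoint λ ()) (disjoint λ ()) cov)
    where
    open ThreeLeaves T
    cov : ∀ x → L 0F x ≡ true ⊎ L 1F x ≡ true ⊎ L 2F x ≡ true
    cov x with L 0F x | L 1F x | L 2F x | none ∘ (x ,_)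
    ... | true  | _     | _     | _ = inj₁ refl
    ... | false | true  | _     | _ = inj₂ (inj₁ refl)
    ... | false | false | true  | _ = inj₂ (inj₂ refl)
    ... | false | false | false | h = ⊥-elim (h refl)
  ... | yes (v , Cv) = record
    { centre = v ; L = L ; bridge = bridge ; small = λ i → small (bridge i) ; large = large
    ; size = size ; centre∉ = out ; covers = covers }
    where
    open ThreeLeaves T
    C : VSet n
    C x = not (L 0F x ∨ L 1F x ∨ L 2F x)

    large : ∀ i → suc d ≤ ∣ L i ∣
    large i = let (u , _ , b) = bridge i in small-cut⇒large dense (L i) (BridgeAt.inside b) (small (bridge i)) 3≤d

    partition : ∣ L 0F ∣ + ∣ L 1F ∣ + ∣ L 2F ∣ + ∣ C ∣ ≤ (d + d) + (d + d)
    partition = begin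
      ∣ L 0F ∣ + ∣ L 1F ∣ + ∣ L 2F ∣ + ∣ C ∣
        ≡⟨ cong (λ k → k + ∣ L 2F ∣ + ∣ C ∣) (sym (∑-distrib-+ (⟦_⟧ ∘ L 0F) (⟦_⟧ ∘ L 1F))) ⟩
      sum (λ x → ⟦ L 0F x ⟧ + ⟦ L 1F x ⟧) + ∣ L 2F ∣ + ∣ C ∣
        ≡⟨ cong (_+ ∣ C ∣) (sym (∑-distrib-+ (λ x → ⟦ L 0F x ⟧ + ⟦ L 1F x ⟧) (⟦_⟧ ∘ L 2F))) ⟩
      sum (λ x → ⟦ L 0F x ⟧ + ⟦ L 1F x ⟧ + ⟦ L 2F x ⟧) + ∣ C ∣
        ≡⟨ sym (∑-distrib-+ (λ x → ⟦ L 0F x ⟧ + ⟦ L 1F x ⟧ + ⟦ L 2F x ⟧) (⟦_⟧ ∘ C)) ⟩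
      sum (λ x → ⟦ L 0F x ⟧ + ⟦ L 1F x ⟧ + ⟦ L 2F x ⟧ + ⟦ C x ⟧)
        ≤⟨ sum-mono-≤ {n} at-most-once ⟩
      sum {n} (λ _ → 1)
        ≡⟨ sum-one n ⟩
      n
        ≤⟨ n≤4d ⟩
      (d + d) + (d + d) ∎
      where
      open ≤-Reasoning
      at-most-once : ∀ x → ⟦ L 0F x ⟧ + ⟦ L 1F x ⟧ + ⟦ L 2F x ⟧ + ⟦ C x ⟧ ≤ 1
      at-most-once x with L 0F x in p | L 1F x in q | L 2F x in r
      ... | true  | true  | _     = ⊥-elim (disjoint (λ ()) x p q)
      ... | true  | false | true  = ⊥-elim (disjoint (λ ()) x p r)
      ... | false | true  | true  = ⊥-elim (disjoint (λ ()) x q r)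
      ... | true  | false | false = ≤-refl
      ... | false | true  | false = ≤-refl
      ... | false | false | true  = ≤-refl
      ... | false | false | false = ≤-refl

    1≤∣C∣ : 1 ≤ ∣ C ∣
    1≤∣C∣ = member⇒1≤∣∣ C Cv

    size : ∀ i → ∣ L i ∣ + 3 ≤ d + d
    size 0F = leaf-size (large 1F) (large 2F) 1≤∣C∣ partition
    size 1F = leaf-size (large 0F) (large 2F) 1≤∣C∣ (subst (λ k → k + ∣ L 2F ∣ + ∣ C ∣ ≤ (d + d) + (d + d)) (+-comm (∣ L 0F ∣) (∣ L 1F ∣)) partition)
    size 2F = leaf-size (large 0F) (large 1F) 1≤∣C∣ (subst (λ k → k + ∣ C ∣ ≤ (d + d) + (d + d)) rotate partition)
      where
      rotate : ∣ L 0F ∣ + ∣ L 1F ∣ + ∣ L 2F ∣ ≡ ∣ L 2F ∣ + ∣ L 0F ∣ + ∣ L 1F ∣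
      rotate = trans (+-comm (∣ L 0F ∣ + ∣ L 1F ∣) ∣ L 2F ∣) (sym (+-assoc (∣ L 2F ∣) (∣ L 0F ∣) (∣ L 1F ∣)))

    -- An edge leaving `C` enters a leaf, and each leaf has at most two boundary edges in `A`.
    cutC≤6 : cut A C ≤ 6
    cutC≤6 = begin
      cut A C
        ≤⟨ sum₂-mono-≤ {n} (λ x y → taut (L 0F x) (L 0F y) (L 1F x) (L 1F y) (L 2F x) (L 2F y) (A x y)) ⟩
      sum₂ (λ x y → into 0F x y + into 1F x y + into 2F x y)
        ≡⟨ sum₂-+ (λ x y → into 0F x y + into 1F x y) (into 2F) ⟩
      sum₂ (λ x y → into 0F x y + into 1F x y) + cut A (∁ (L 2F))
        ≡⟨ cong (_+ cut A (∁ (L 2F))) (sum₂-+ (into 0F) (into 1F)) ⟩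
      cut A (∁ (L 0F)) + cut A (∁ (L 1F)) + cut A (∁ (L 2F))
        ≤⟨ +-mono-≤ (+-mono-≤ (small∁ 0F) (small∁ 1F)) (small∁ 2F) ⟩
      6 ∎
      where
      open ≤-Reasoning
      into : Fin 3 → Fin n → Fin n → ℕ
      into i x y = ⟦ not (L i x) ∧ not (not (L i y)) ∧ A x y ⟧
      small∁ : ∀ i → cut A (∁ (L i)) ≤ 2
      small∁ i = ≤-trans (≤-reflexive (cut-∁ A-sym (L i))) (small (bridge i))
      taut : ∀ p p′ q q′ r r′ a → ⟦ not (p ∨ q ∨ r) ∧ not (not (p′ ∨ q′ ∨ r′)) ∧ a ⟧ ≤
        ⟦ not p ∧ not (not p′) ∧ a ⟧ + ⟦ not q ∧ not (not q′) ∧ a ⟧ + ⟦ not r ∧ not (not r′) ∧ a ⟧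
      taut = toWitness {a? = ∀ᵇ? λ p → ∀ᵇ? λ p′ → ∀ᵇ? λ q → ∀ᵇ? λ q′ → ∀ᵇ? λ r → ∀ᵇ? λ r′ → ∀ᵇ? λ a → _ ≤? _} tt

    ∣C∣≤1 : ∣ C ∣ ≤ 1
    ∣C∣≤1 = singleton (≤-trans (size-bound A A-irr deg C) (+-monoʳ-≤ _ cutC≤6))
                      (centre-size (large 0F) (large 1F) (large 2F) partition)

    out : ∀ i → L i v ≡ false
    out i with L i v in p
    ... | false = refl
    ... | true  = ⊥-elim (true≢false (member i p) (not-true Cv))
      where
      member : ∀ i → L i v ≡ true → L 0F v ∨ L 1F v ∨ L 2F v ≡ true
      member 0F p = ∨-introˡ p
      member 1F p = ∨-introʳ (L 0F v) (∨-introˡ p)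
      member 2F p = ∨-introʳ (L 0F v) (∨-introʳ (L 1F v) p)

    covers : ∀ x → x ≢ v → ∃ λ i → L i x ≡ true
    covers x x≢v with L 0F x in p | L 1F x in q | L 2F x in r
    ... | true  | _     | _     = 0F , p
    ... | false | true  | _     = 1F , q
    ... | false | false | true  = 2F , r
    ... | false | false | false = ⊥-elim (<⇒≱ (two-in C Cx Cv x≢v) ∣C∣≤1)
      where
      Cx : C x ≡ true
      Cx rewrite p | q | r = refl
      two-in : ∀ (S : VSet n) {x y} → S x ≡ true → S y ≡ true → x ≢ y → 2 ≤ ∣ S ∣
      two-in S {x} {y} Sx Sy x≢y = ≤-trans (≤-reflexive (sym (cong₂ (λ a b → ⟦ a ⟧ + ⟦ b ⟧) Sx Sy))) (two-terms≤sum (⟦_⟧ ∘ S) x≢y)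

  unilateral-or-tripod : ∀ {σ} → Balanced dense σ → Fin n → Unilateral A ⊎ Tripod A d (bipartite A σ)
  unilateral-or-tripod {σ} bal x₀ with separated-or-three-leaves (bipartite A σ) (bipartite-sym A-sym σ) (Balanced.strong bal) x₀
  ... | inj₂ T = inj₂ (tripod (bipartite-sym A-sym σ) (Balanced.strong bal) (Balanced.small bal) T)
  ... | inj₁ (s , t , sep)
    with D , D⊆H , ow , tot ← unilateral-orientation (bipartite A σ) (bipartite-sym A-sym σ)
                                (λ x → cong (_∧ _) (A-irr x)) (Balanced.strong bal) sep
    = inj₁ (unilateral D σ (λ x y a → ∧-left (D⊆H x y a)) ow (λ x y a → xor⇒≢ (∧-right {A x y} (D⊆H x y a))) tot)

-- In a tripod some leaf L is joined to the centre v by exactly two edges, v a and v a′; as L is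
-- dense, a and a′ have a common neighbour y in L.  Keeping the 4-cycle v a y a′ bipartite
-- while maximising the cut rules out a second tripod.
record Square {n} (A : BRel n) (d : ℕ) : Set where
  field
    v a y a′ : Fin n
    a≢a′     : a ≢ a′
    va       : Arc A v a
    ay       : Arc A a y
    ya′      : Arc A y a′
    a′v      : Arc A a′ v
    L        : VSet n
    small    : cut A L ≤ 2
    large    : suc d ≤ ∣ L ∣
    size     : ∣ L ∣ + 3 ≤ d + d
    v∉L      : L v ≡ false
    a∈L      : L a ≡ true
    y∈L      : L y ≡ true
    leave    : ∀ x z → L x ≡ true → L z ≡ false → Arc A x z → x ≡ a ⊎ x ≡ a′

module _ {n} {A : BRel n} {d} (dense : Dense A d) where

  open Dense dense

  -- All neighbours of the centre lie in the leaves, so otherwise its degree is at most 3. But d + 1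
  -- ≤ ∣ L ∣ ≤ 2 d - 3 gives d ≥ 4.
  double-leaf : ∀ {H} (T : Tripod A d H) → ∃ λ i → 2 ≤ ∣ (λ y → Tripod.L T i y ∧ A (Tripod.centre T) y) ∣
  double-leaf T with 2 ≤? ∣ N 0F ∣ | 2 ≤? ∣ N 1F ∣ | 2 ≤? ∣ N 2F ∣
    where
    open Tripod T
    N : Fin 3 → VSet n
    N i y = L i y ∧ A centre y
  ... | yes p | _     | _     = 0F , p
  ... | no _  | yes p | _     = 1F , p
  ... | no _  | no _  | yes p = 2F , p
  ... | no p  | no q  | no r  = ⊥-elim (<⇒≱ 4≤d d≤3)
    where
    open Tripod T
    N : Fin 3 → VSet n
    N i y = L i y ∧ A centre y
    4≤d : 4 ≤ d
    4≤d = +-cancelˡ-≤ d _ _ (≤-trans (≤-trans (≤-reflexive (+-suc d 3)) (+-monoˡ-≤ 3 (large 0F))) (size 0F))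
    spread : ∀ y → ⟦ A centre y ⟧ ≤ ⟦ N 0F y ⟧ + ⟦ N 1F y ⟧ + ⟦ N 2F y ⟧
    spread y with y ≟ centre
    ... | yes refl rewrite A-irr y = z≤n
    ... | no y≢c with covers y y≢c
    ...   | 0F , e rewrite e = ≤-trans (m≤m+n _ _) (m≤m+n _ _)
    ...   | 1F , e rewrite e = ≤-trans (m≤n+m _ ⟦ N 0F y ⟧) (m≤m+n _ _)
    ...   | 2F , e rewrite e = m≤n+m _ _
    d≤3 : d ≤ 3
    d≤3 = begin
      d                                                      ≤⟨ deg centre ⟩
      ∣ A centre ∣                                           ≤⟨ sum-mono-≤ {n} spread ⟩
      sum (λ y → ⟦ N 0F y ⟧ + ⟦ N 1F y ⟧ + ⟦ N 2F y ⟧)       ≡⟨ ∑-distrib-+ (λ y → ⟦ N 0F y ⟧ + ⟦ N 1F y ⟧) (⟦_⟧ ∘ N 2F) ⟩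
      sum (λ y → ⟦ N 0F y ⟧ + ⟦ N 1F y ⟧) + ∣ N 2F ∣         ≡⟨ cong (_+ ∣ N 2F ∣) (∑-distrib-+ (⟦_⟧ ∘ N 0F) (⟦_⟧ ∘ N 1F)) ⟩
      ∣ N 0F ∣ + ∣ N 1F ∣ + ∣ N 2F ∣                         ≤⟨ +-mono-≤ (+-mono-≤ (≤-pred (≰⇒> p)) (≤-pred (≰⇒> q))) (≤-pred (≰⇒> r)) ⟩
      3                                                      ∎
      where open ≤-Reasoning

  -- The edges from `a` and `a′` to the centre are the whole boundary of the leaf, so each of the
  -- two has at least d - 1 neighbours inside. Since 2 (d - 1) exceeds the size of the leaf, at most
  -- 2 d - 3, they have one in common.
  square : ∀ {H} → Tripod A d H → Square A d
  square T with double-leaf T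
  ... | i , two with two-members _ two
  ... | a , a′ , a≢a′ , p , p′ = found
    where
    open Tripod T renaming (centre to v)
    S : VSet n
    S = L i
    a∈S : S a ≡ true
    a∈S = ∧-left p
    a′∈S : S a′ ≡ true
    a′∈S = ∧-left p′
    va : Arc A v a
    va = ∧-right {S a} p
    va′ : Arc A v a′
    va′ = ∧-right {S a′} p′

    1≤row-a : 1 ≤ row A S a
    1≤row-a = edge⇒1≤row A S a∈S (centre∉ i) (trans (A-sym a v) va)
    1≤row-a′ : 1 ≤ row A S a′
    1≤row-a′ = edge⇒1≤row A S a′∈S (centre∉ i) (trans (A-sym a′ v) va′)

    -- A third vertex with an edge to the outside would raise the cut to 3.
    leave : ∀ x z → S x ≡ true → S z ≡ false → Arc A x z → x ≡ a ⊎ x ≡ a′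
    leave x z Sx Sz e with x ≟ a | x ≟ a′
    ... | yes q | _     = inj₁ q
    ... | no _  | yes q = inj₂ q
    ... | no q  | no q′ = ⊥-elim (<⇒≱ (≤-trans (+-mono-≤ (+-mono-≤ 1≤row-a 1≤row-a′) (edge⇒1≤row A S Sx Sz e))
                                  (three-terms≤sum (row A S) a≢a′ (q ∘ sym) (q′ ∘ sym))) (small i))

    inner : ∀ b → S b ≡ true → row A S b ≤ 1 → d ≤ ∣ (λ y → S y ∧ A b y) ∣ + 1
    inner b Sb le = begin
      d                                                                     ≤⟨ deg b ⟩
      ∣ A b ∣                                                               ≡⟨ sum-cong-≗ {n} (λ y → taut (S y) (A b y)) ⟩
      sum (λ y → ⟦ S y ∧ A b y ⟧ + ⟦ true ∧ not (S y) ∧ A b y ⟧)            ≡⟨ ∑-distrib-+ (λ y → ⟦ S y ∧ A b y ⟧) _ ⟩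
      ∣ (λ y → S y ∧ A b y) ∣ + sum (λ y → ⟦ true ∧ not (S y) ∧ A b y ⟧)    ≡⟨ cong (λ s → ∣ (λ y → S y ∧ A b y) ∣ + sum (λ y → ⟦ s ∧ not (S y) ∧ A b y ⟧)) (sym Sb) ⟩
      ∣ (λ y → S y ∧ A b y) ∣ + row A S b                                   ≤⟨ +-monoʳ-≤ _ le ⟩
      ∣ (λ y → S y ∧ A b y) ∣ + 1                                           ∎
      where
      open ≤-Reasoning
      taut : ∀ s e → ⟦ e ⟧ ≡ ⟦ s ∧ e ⟧ + ⟦ true ∧ not s ∧ e ⟧
      taut = toWitness {a? = ∀ᵇ? λ s → ∀ᵇ? λ e → _ ≟ⁿ _} tt

    rows≤2 : row A S a + row A S a′ ≤ 2
    rows≤2 = ≤-trans (two-terms≤sum (row A S) a≢a′) (small i)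

    found : Square A d
    found with any? (λ y → (S y ≟ᵇ true) ×-dec (A a y ≟ᵇ true) ×-dec (A a′ y ≟ᵇ true))
    ... | yes (y , Sy , ay , a′y) = record
      { v = v ; a = a ; y = y ; a′ = a′ ; a≢a′ = a≢a′ ; va = va ; ay = ay
      ; ya′ = trans (A-sym y a′) a′y ; a′v = trans (A-sym a′ v) va′
      ; L = S ; small = small i ; large = large i ; size = size i ; v∉L = centre∉ i ; a∈L = a∈S ; y∈L = Sy
      ; leave = leave }
    ... | no none = ⊥-elim (<⇒≱ (+-monoʳ-< ∣ S ∣ {2} {3} ≤-refl) (≤-trans (size i) d+d≤))
      where
      open ≤-Reasoning
      q q′ : ℕ
      q = ∣ (λ y → S y ∧ A a y) ∣
      q′ = ∣ (λ y → S y ∧ A a′ y) ∣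
      apart : ∀ y → ⟦ S y ∧ A a y ⟧ + ⟦ S y ∧ A a′ y ⟧ ≤ ⟦ S y ⟧
      apart y with S y in Sy | A a y in ay | A a′ y in a′y
      ... | true  | true  | true  = ⊥-elim (none (y , Sy , ay , a′y))
      ... | true  | true  | false = ≤-refl
      ... | true  | false | true  = ≤-refl
      ... | true  | false | false = z≤n
      ... | false | _     | _     = z≤n
      shape : ∀ q q′ → (q + 1) + (q′ + 1) ≡ q + q′ + 2
      shape = solve-∀
      d+d≤ : d + d ≤ ∣ S ∣ + 2
      d+d≤ = begin
        d + d               ≤⟨ +-mono-≤ (inner a a∈S (+-cancelʳ-≤ 1 _ _ (≤-trans (+-monoʳ-≤ _ 1≤row-a′) rows≤2)))
                                        (inner a′ a′∈S (+-cancelˡ-≤ 1 _ _ (≤-trans (+-monoˡ-≤ _ 1≤row-a) rows≤2))) ⟩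
        (q + 1) + (q′ + 1)  ≡⟨ shape q q′ ⟩
        q + q′ + 2          ≡⟨ cong (_+ 2) (sym (∑-distrib-+ (λ y → ⟦ S y ∧ A a y ⟧) (λ y → ⟦ S y ∧ A a′ y ⟧))) ⟩
        sum (λ y → ⟦ S y ∧ A a y ⟧ + ⟦ S y ∧ A a′ y ⟧) + 2  ≤⟨ +-monoˡ-≤ 2 (sum-mono-≤ {n} apart) ⟩
        ∣ S ∣ + 2           ∎

module _ {n} {A : BRel n} {d} (dense : Dense A d) (Q : Square A d) where

  open Dense dense
  open Square Q

  private
    ∅ K₁ K₂ K₃ : VSet n
    ∅ _ = false
    K₁ = insert a′ ∅
    K₂ = insert y K₁
    K₃ = insert a K₂

  corners : VSet n
  corners = insert v K₃

  corners-elim : ∀ {P : Fin n → Set} → P v → P a → P y → P a′ → ∀ x → corners x ≡ true → P x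
  corners-elim pv pa py pa′ x c with insert-inv v K₃ x c
  ... | inj₂ refl = pv
  ... | inj₁ c₁ with insert-inv a K₂ x c₁
  ...   | inj₂ refl = pa
  ...   | inj₁ c₂ with insert-inv y K₁ x c₂
  ...     | inj₂ refl = py
  ...     | inj₁ c₃ with insert-inv a′ ∅ x c₃
  ...       | inj₂ refl = pa′

  corner-v : corners v ≡ true
  corner-v = insert-self v K₃

  corner-a : corners a ≡ true
  corner-a = insert-⊇ v K₃ a (insert-self a K₂)

  corner-y : corners y ≡ true
  corner-y = insert-⊇ v K₃ y (insert-⊇ a K₂ y (insert-self y K₁))

  corner-a′ : corners a′ ≡ true
  corner-a′ = insert-⊇ v K₃ a′ (insert-⊇ a K₂ a′ (insert-⊇ y K₁ a′ (insert-self a′ ∅)))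

  arc⇒≢ : ∀ {x z} → Arc A x z → x ≢ z
  arc⇒≢ e refl = true≢false e (A-irr _)

  side : VSet n
  side = insert v (insert y ∅)

  side-false : ∀ x → Arc A v x → Arc A y x → side x ≡ false
  side-false x vx yx with side x in e
  ... | false = refl
  ... | true with insert-inv v (insert y ∅) x e
  ...   | inj₂ refl = ⊥-elim (arc⇒≢ vx refl)
  ...   | inj₁ e′ with insert-inv y ∅ x e′
  ...     | inj₂ refl = ⊥-elim (arc⇒≢ yx refl)

  module _ {σ : VSet n} (agrees : ∀ x → corners x ≡ true → σ x ≡ side x) where

    private
      H = bipartite A σ

      σv : σ v ≡ true
      σv = trans (agrees v corner-v) (insert-self v (insert y ∅))
      σy : σ y ≡ true
      σy = trans (agrees y corner-y) (insert-⊇ v (insert y ∅) y (insert-self y ∅))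
      σa : σ a ≡ false
      σa = trans (agrees a corner-a) (side-false a va (trans (A-sym y a) ay))
      σa′ : σ a′ ≡ false
      σa′ = trans (agrees a′ corner-a′) (side-false a′ (trans (A-sym v a′) a′v) ya′)

      H-edge : ∀ {x z} → Arc A x z → σ x ≡ true → σ z ≡ false → Arc H x z × Arc H z x
      H-edge {x} {z} e p q = e₁ , trans (bipartite-sym A-sym σ z x) e₁
        where
        e₁ : Arc H x z
        e₁ rewrite e | p | q = refl

      v-a  = H-edge va σv σa
      y-a  = H-edge (trans (A-sym y a) ay) σy σa
      y-a′ = H-edge ya′ σy σa′
      v-a′ = H-edge (trans (A-sym v a′) a′v) σv σa′

      v≢y : v ≢ y
      v≢y e = true≢false y∈L (subst (λ x → L x ≡ false) e v∉L)

    -- The prescribed sides put all four edges of the cycle into `H`, and a cycle that crosses a cut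
    -- does so at least twice. Each case exhibits two cut edges that `Thin` would identify.
    square-unsplit : ∀ S → Thin H S → Unsplit corners S
    square-unsplit S th with S v in sv | S a in sa | S y in sy | S a′ in sa′
    ... | true  | true  | true  | true  = inj₂ (corners-elim sv sa sy sa′)
    ... | false | false | false | false = inj₁ (corners-elim sv sa sy sa′)
    ... | true  | false | _     | false = ⊥-elim (a≢a′ (proj₂ (th sv sa (proj₁ v-a) sv sa′ (proj₁ v-a′))))
    ... | true  | false | true  | true  = ⊥-elim (v≢y (proj₁ (th sv sa (proj₁ v-a) sy sa (proj₁ y-a))))
    ... | true  | false | false | true  = ⊥-elim (arc⇒≢ a′v (sym (proj₁ (th sv sa (proj₁ v-a) sa′ sy (proj₂ y-a′)))))
    ... | true  | true  | true  | false = ⊥-elim (v≢y (proj₁ (th sv sa′ (proj₁ v-a′) sy sa′ (proj₁ y-a′))))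
    ... | true  | true  | false | false = ⊥-elim (arc⇒≢ va (proj₁ (th sv sa′ (proj₁ v-a′) sa sy (proj₂ y-a))))
    ... | true  | true  | false | true  = ⊥-elim (a≢a′ (proj₁ (th sa sy (proj₂ y-a) sa′ sy (proj₂ y-a′))))
    ... | false | true  | _     | true  = ⊥-elim (a≢a′ (proj₁ (th sa sv (proj₂ v-a) sa′ sv (proj₂ v-a′))))
    ... | false | true  | false | false = ⊥-elim (v≢y (proj₂ (th sa sv (proj₂ v-a) sa sy (proj₂ y-a))))
    ... | false | true  | true  | false = ⊥-elim (arc⇒≢ ay (proj₁ (th sa sv (proj₂ v-a) sy sa′ (proj₁ y-a′))))
    ... | false | false | false | true  = ⊥-elim (v≢y (proj₂ (th sa′ sv (proj₂ v-a′) sa′ sy (proj₂ y-a′))))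
    ... | false | false | true  | true  = ⊥-elim (arc⇒≢ ya′ (sym (proj₁ (th sa′ sv (proj₂ v-a′) sy sa (proj₁ y-a)))))
    ... | false | false | true  | false = ⊥-elim (a≢a′ (proj₂ (th sy sa (proj₁ y-a) sy sa′ (proj₁ y-a′))))

  module _ (M : VSet n) (M-small : cut A M ≤ 2) (M-size : ∣ M ∣ + 3 ≤ d + d)
           (v∈M : M v ≡ true) (a∈M : M a ≡ true) (a′∈M : M a′ ≡ true) where

    private
      -- `Z` is left with at most d - 4 vertices. As it is nonempty, d ≥ 5, so four boundary edges
      -- are fewer than `d` and `Z` would need d + 1 vertices.
      too-small : ∀ (Z W : VSet n) {k x} → Z x ≡ true → cut A Z ≤ 4 → suc d ≤ ∣ W ∣ → ∣ Z ∣ + ∣ W ∣ ≤ k → k + 3 ≤ d + d → ⊥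
      too-small Z W {k} Zx cZ lW part kk = <⇒≱ (small-cut⇒large dense Z Zx cZ 4<d) (≤-trans (m≤m+n _ 4) Z+4≤d)
        where
        open ≤-Reasoning
        shape : ∀ d z → d + (z + 4) ≡ z + suc d + 3
        shape = solve-∀
        Z+4≤d : ∣ Z ∣ + 4 ≤ d
        Z+4≤d = +-cancelˡ-≤ d _ _ (begin
          d + (∣ Z ∣ + 4)      ≡⟨ shape d ∣ Z ∣ ⟩
          ∣ Z ∣ + suc d + 3    ≤⟨ +-monoˡ-≤ 3 (+-monoʳ-≤ ∣ Z ∣ lW) ⟩
          ∣ Z ∣ + ∣ W ∣ + 3    ≤⟨ +-monoˡ-≤ 3 part ⟩
          k + 3                ≤⟨ kk ⟩
          d + d                ∎)
        4<d : 4 < d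
        4<d = ≤-trans (+-monoˡ-≤ 4 (member⇒1≤∣∣ Z Zx)) Z+4≤d

    -- If `L` sticks out of `M`, the part outside has at most two boundary edges, hence more than
    -- `d` vertices, and the part inside `M` is too small. Otherwise `L` lies in `M`, and the rest
    -- of `M`, which contains `v`, is too small.
    enclosed⇒⊥ : ⊥
    enclosed⇒⊥ with any? (λ x → (L x ∧ not (M x)) ≟ᵇ true)
    ... | yes (x₁ , Xx₁) = too-small Y X (∧-intro a∈L a∈M) cutY (small-cut⇒large dense X Xx₁ cutX 3≤d) (≤-reflexive part) size
      where
      X Y : VSet n
      X x = L x ∧ not (M x)
      Y x = L x ∧ M x
      part : ∣ Y ∣ + ∣ X ∣ ≡ ∣ L ∣
      part = trans (sym (∑-distrib-+ (⟦_⟧ ∘ Y) (⟦_⟧ ∘ X))) (sum-cong-≗ {n} (λ x → taut (L x) (M x)))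
        where
        taut : ∀ l m → ⟦ l ∧ m ⟧ + ⟦ l ∧ not m ⟧ ≡ ⟦ l ⟧
        taut = toWitness {a? = ∀ᵇ? λ l → ∀ᵇ? λ m → _ ≟ⁿ _} tt
      -- Edges leaving `L` start at `a` or `a′`, both in `M`. So an edge leaving `X` stays in `L`
      -- and enters `M`.
      enters : ∀ x z → X x ∧ not (X z) ∧ A x z ≡ true → ∁ M x ∧ not (∁ M z) ∧ A x z ≡ true
      enters x z c with crossing⁻¹ {X x} {X z} c
      ... | Xx , Xz , e with L z in Lz | M z in Mz
      ...   | true  | true  = crossing {∁ M x} {not true} (∧-right {L x} Xx) refl e
      enters x z c | Xx , () , e | true | false
      ...   | false | _ with leave x z (∧-left Xx) Lz e
      ...     | inj₁ refl = ⊥-elim (true≢false a∈M (not-true (∧-right {L x} Xx)))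
      ...     | inj₂ refl = ⊥-elim (true≢false a′∈M (not-true (∧-right {L x} Xx)))
      cutX : cut A X ≤ 2
      cutX = ≤-trans (sum₂-mono-≤ {n} (λ x z → ⟦⟧-mono (enters x z))) (≤-trans (≤-reflexive (cut-∁ A-sym M)) M-small)
      cutY : cut A Y ≤ 4
      cutY = ≤-trans (sum₂-mono-≤ {n} (λ x z → taut (L x) (L z) (M x) (M z) (A x z)))
               (≤-trans (≤-reflexive (sum₂-+ (λ x z → ⟦ L x ∧ not (L z) ∧ A x z ⟧) (λ x z → ⟦ M x ∧ not (M z) ∧ A x z ⟧)))
                        (+-mono-≤ small M-small))
        where
        taut : ∀ l l′ m m′ e → ⟦ (l ∧ m) ∧ not (l′ ∧ m′) ∧ e ⟧ ≤ ⟦ l ∧ not l′ ∧ e ⟧ + ⟦ m ∧ not m′ ∧ e ⟧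
        taut = toWitness {a? = ∀ᵇ? λ l → ∀ᵇ? λ l′ → ∀ᵇ? λ m → ∀ᵇ? λ m′ → ∀ᵇ? λ e → _ ≤? _} tt
    ... | no none = too-small Z L (∧-intro v∈M (cong not v∉L)) cutZ large part M-size
      where
      Z : VSet n
      Z x = M x ∧ not (L x)
      part : ∣ Z ∣ + ∣ L ∣ ≤ ∣ M ∣
      part = ≤-trans (≤-reflexive (sym (∑-distrib-+ (⟦_⟧ ∘ Z) (⟦_⟧ ∘ L)))) (sum-mono-≤ {n} pointwise)
        where
        pointwise : ∀ x → ⟦ M x ∧ not (L x) ⟧ + ⟦ L x ⟧ ≤ ⟦ M x ⟧
        pointwise x with M x in Mx | L x in Lx
        ... | true  | true  = ≤-refl
        ... | true  | false = ≤-refl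
        ... | false | false = ≤-refl
        ... | false | true  = ⊥-elim (none (x , ∧-intro Lx (cong not Mx)))
      cutZ : cut A Z ≤ 4
      cutZ = ≤-trans (sum₂-mono-≤ {n} (λ x z → taut (L x) (L z) (M x) (M z) (A x z)))
               (≤-trans (≤-reflexive (sum₂-+ (λ x z → ⟦ ∁ L x ∧ not (∁ L z) ∧ A x z ⟧) (λ x z → ⟦ M x ∧ not (M z) ∧ A x z ⟧)))
                        (+-mono-≤ (≤-trans (≤-reflexive (cut-∁ A-sym L)) small) M-small))
        where
        taut : ∀ l l′ m m′ e → ⟦ (m ∧ not l) ∧ not (m′ ∧ not l′) ∧ e ⟧ ≤ ⟦ not l ∧ not (not l′) ∧ e ⟧ + ⟦ m ∧ not m′ ∧ e ⟧
        taut = toWitness {a? = ∀ᵇ? λ l → ∀ᵇ? λ l′ → ∀ᵇ? λ m → ∀ᵇ? λ m′ → ∀ᵇ? λ e → _ ≤? _} tt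

  -- Some leaf contains a corner, hence all four. If `v` is the new centre, this contradicts that
  -- the centre lies in no leaf; if not, `enclosed⇒⊥` applies.
  second-tripod⇒⊥ : ∀ {H} → (∀ S → Thin H S → Unsplit corners S) → Tripod A d H → ⊥
  second-tripod⇒⊥ unsplit T with v ≟ Tripod.centre T
  ... | yes refl with Tripod.covers T a (λ { refl → arc⇒≢ va refl })
  ...   | i , La with unsplit (Tripod.L T i) (Bridge⇒Thin (Tripod.bridge T i))
  ...     | inj₁ off = true≢false La (off a corner-a)
  ...     | inj₂ on  = true≢false (on v corner-v) (Tripod.centre∉ T i)
  second-tripod⇒⊥ unsplit T | no v≢c with Tripod.covers T v v≢c
  ... | i , Lv with unsplit (Tripod.L T i) (Bridge⇒Thin (Tripod.bridge T i))
  ...   | inj₁ off = true≢false Lv (off v corner-v)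
  ...   | inj₂ on  = enclosed⇒⊥ (Tripod.L T i) (Tripod.small T i) (Tripod.size T i) Lv (on a corner-a) (on a′ corner-a′)

dense⇒unilateral : ∀ {n} {A : BRel n} {d} → Dense A d → Fin n → Unilateral A
dense⇒unilateral {n} {A} dense x₀ with max-cut (Dense.A-sym dense) (λ _ → false) (λ _ → false)
-- With `K` empty this is an unrestricted maximum cut, and no set splits `K`.
... | σ , _ , half with unilateral-or-tripod dense (balanced dense {σ = σ} half (λ _ _ → inj₁ (λ _ ()))) x₀
... | inj₁ U = U
... | inj₂ T with square dense T
... | Q with max-cut (Dense.A-sym dense) (corners dense Q) (side dense Q)
... | τ , agrees , half′ with unilateral-or-tripod dense (balanced dense {σ = τ} half′ (square-unsplit dense Q {τ} agrees)) x₀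
... | inj₁ U  = U
... | inj₂ T′ = ⊥-elim (second-tripod⇒⊥ dense Q (square-unsplit dense Q {τ} agrees) T′)

-- Graphs of order at most 8

steps : ∀ {n} → List (Fin n) → List (Fin n × Fin n)
steps (x ∷ y ∷ w) = (x , y) ∷ steps (y ∷ w)
steps _           = []

Step : ∀ {n} → List (Fin n) → Fin n → Fin n → Set
Step w x y = (x , y) ∈ steps w

walk-from-head : ∀ {n} {x y : Fin n} w → y ∈ x ∷ w → Star (Step (x ∷ w)) x y
walk-from-head w       (here refl) = ε
walk-from-head (z ∷ w) (there p)   = here refl ◅ Star.map there (walk-from-head w p)

walk-total : ∀ {n} {x y : Fin n} w → x ∈ w → y ∈ w → Star (Step w) x y ⊎ Star (Step w) y x
walk-total (x ∷ w)     (here refl) q           = inj₁ (walk-from-head w q)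
walk-total (x ∷ w)     (there p)   (here refl) = inj₂ (walk-from-head w (there p))
walk-total (x ∷ z ∷ w) (there p)   (there q)   = Sum.map (Star.map there) (Star.map there) (walk-total (z ∷ w) p q)

-- For a vertex of the walk: whether its first occurrence has even index. This is the bipartition
-- that the walk dictates; later occurrences are checked against it step by step.
parity : ∀ {n} → List (Fin n) → Fin n → Bool
parity []      x = true
parity (z ∷ w) x = if ⌊ x ≟ z ⌋ then true else not (parity w x)

_≟²_ : ∀ {n} (p q : Fin n × Fin n) → Dec (p ≡ q)
_≟²_ = ≡-dec _≟_ _≟_

-- The earlier of two vertices reaches the later one along the walk. Vertices and arcs may recur, so
-- a walk can go round an even cycle again to leave it at another vertex; only traversing an edge
-- both ways is forbidden.
walk⇒unilateral : ∀ {n} {A : BRel n} (w : List (Fin n)) → (∀ x → x ∈ w) →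
  All (λ (x , y) → Arc A x y × ¬ Step w y x × parity w x ≢ parity w y) (steps w) → Unilateral A
walk⇒unilateral {n} {A} w covers good = unilateral D (parity w)
  (λ x y p → proj₁ (All.lookup good (D⇒Step p)))
  (λ x y p q → proj₁ (proj₂ (All.lookup good (D⇒Step p))) (D⇒Step q))
  (λ x y p → proj₂ (proj₂ (All.lookup good (D⇒Step p))))
  (λ x y → Sum.map (Star.map Step⇒D) (Star.map Step⇒D) (walk-total w (covers x) (covers y)))
  where
  D : BRel n
  D x y = ⌊ mem? _≟²_ (x , y) (steps w) ⌋
  D⇒Step : ∀ {x y} → Arc D x y → Step w x y
  D⇒Step {x} {y} p with mem? _≟²_ (x , y) (steps w)
  ... | yes q = q
  D⇒Step () | no _
  Step⇒D : ∀ {x y} → Step w x y → Arc D x y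
  Step⇒D {x} {y} p with mem? _≟²_ (x , y) (steps w)
  ... | yes _ = refl
  ... | no ¬p = ⊥-elim (¬p p)

-- For orders 5 to 8 the bound on the degrees amounts to degree at least 2, given here by two
-- distinct neighbours.
record Admissible {n} (A : BRel n) : Set where
  field
    A-sym    : Symm A
    A-irr    : ∀ x → A x x ≡ false
    A-strong : Strong A
    degree≥2 : ∀ x → ∃ λ y → ∃ λ z → y ≢ z × Arc A x y × Arc A x z

Iso : ∀ {n k} → BRel n → Graph k → Set
Iso {n} {k} A X = Σ (Fin n ↔ Fin k) λ f → ∀ x y → A x y ≡ adj X (Inverse.to f x) (Inverse.to f y)

relabel : ∀ {n} → Fin n ↔ Fin n → BRel n → BRel n
relabel f A x y = A (Inverse.to f x) (Inverse.to f y)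

module _ {n} (f : Fin n ↔ Fin n) {A : BRel n} where

  open Inverse f using (to; from; strictlyInverseˡ; strictlyInverseʳ)

  relabel-admissible : Admissible A → Admissible (relabel f A)
  relabel-admissible adm = record
    { A-sym    = λ x y → A-sym (to x) (to y)
    ; A-irr    = λ x → A-irr (to x)
    ; A-strong = λ Z c {x} p y → trans (cong Z (sym (strictlyInverseʳ y)))
        (A-strong (Z ∘ from) (closed Z c) {to x} (trans (cong Z (strictlyInverseʳ x)) p) (to y))
    ; degree≥2 = λ x → let (y , z , y≢z , xy , xz) = degree≥2 (to x) in
        from y , from z , (λ e → y≢z (from-injective e)) ,
        trans (cong (A (to x)) (strictlyInverseˡ y)) xy , trans (cong (A (to x)) (strictlyInverseˡ z)) xz
    }
    where
    open Admissible adm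
    from-injective : ∀ {y z} → from y ≡ from z → y ≡ z
    from-injective {y} {z} e = trans (sym (strictlyInverseˡ y)) (trans (cong to e) (strictlyInverseˡ z))
    closed : ∀ Z → Closed (relabel f A) Z → Closed A (Z ∘ from)
    closed Z c x y p a = c (from x) (from y) p (trans (cong₂ A (strictlyInverseˡ x) (strictlyInverseˡ y)) a)

  relabel-unilateral : Unilateral (relabel f A) → Unilateral A
  relabel-unilateral (unilateral D σ D⊆A ow alt total) = unilateral
    (λ x y → D (from x) (from y)) (σ ∘ from)
    (λ x y p → trans (sym (cong₂ A (strictlyInverseˡ x) (strictlyInverseˡ y))) (D⊆A _ _ p))
    (λ x y → ow _ _) (λ x y → alt _ _)
    (λ x y → Sum.map (back x y) (back y x) (total (from x) (from y)))
    where
    D′ : BRel n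
    D′ x y = D (from x) (from y)
    forth : ∀ {i j} → Arc D i j → Arc D′ (to i) (to j)
    forth {i} {j} p = trans (cong₂ D (strictlyInverseʳ i) (strictlyInverseʳ j)) p
    back : ∀ x y → Star (Arc D) (from x) (from y) → Star (Arc D′) x y
    back x y s = subst₂ (Star (Arc D′)) (strictlyInverseˡ x) (strictlyInverseˡ y) (Star.gmap to forth s)

  relabel-iso : ∀ {k} (X : Graph k) → Iso (relabel f A) X → Iso A X
  relabel-iso X (g , h) = g ↔-∘ ↔-sym f ,
    λ x y → trans (sym (cong₂ A (strictlyInverseˡ x) (strictlyInverseˡ y))) (h (from x) (from y))

bijection? : ∀ {n k} → Vec (Fin k) n → Maybe (Fin n ↔ Fin k)
bijection? p with all? (λ j → any? (λ i → lookup p i ≟ j))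
                | all? (λ i → all? (λ j → (lookup p i ≟ lookup p j) →-dec (i ≟ j)))
... | yes onto | yes inj = just (mk↔ₛ′ (lookup p) (proj₁ ∘ onto) (proj₂ ∘ onto) (λ i → inj _ _ (proj₂ (onto (lookup p i)))))
... | _        | _       = nothing

-- Certificates that every admissible graph on n vertices with the path 0, 1, …, m − 1 satisfies
-- the conclusion: branch on whether i j is an edge (first subtree) or not (second subtree) until
--   the present edges contain a path on m + 1 vertices: longer lists it, followed by the other vertices;
--   they contain a spanning walk giving a unilateral orientation: spanned;
--   all edges of i except at most i k are absent: low i k;
--   all edges leaving a set are absent: apart;
--   everything is known and i ↦ lookup p i is an isomorphism to the exceptional graph: isomorphic p.
data Tree (n k : ℕ) : Set where
  branch     : Fin n → Fin n → Tree n k → Tree n k → Tree n k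
  longer     : Vec (Fin n) n → Tree n k
  spanned    : List (Fin n) → Tree n k
  low        : Fin n → Fin n → Tree n k
  apart      : Vec Bool n → Tree n k
  isomorphic : Vec (Fin k) n → Tree n k

Facts : ℕ → Set
Facts n = List ((Fin n × Fin n) × Bool)

Holds : ∀ {n} → BRel n → Facts n → Set
Holds A fs = All (λ ((i , j) , b) → A i j ≡ b) fs

Known : ∀ {n} → Facts n → Fin n → Fin n → Bool → Set
Known fs i j b = ((i , j) , b) ∈ fs ⊎ ((j , i) , b) ∈ fs

known? : ∀ {n} (fs : Facts n) i j b → Dec (Known fs i j b)
known? fs i j b = mem? (≡-dec _≟²_ _≟ᵇ_) ((i , j) , b) fs ⊎-dec mem? (≡-dec _≟²_ _≟ᵇ_) ((j , i) , b) fs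

known⇒holds : ∀ {n} {A : BRel n} {fs} → Symm A → Holds A fs → ∀ {i j b} → Known fs i j b → A i j ≡ b
known⇒holds A-sym h (inj₁ p)             = All.lookup h p
known⇒holds A-sym h {i} {j} (inj₂ p) = trans (A-sym i j) (All.lookup h p)

-- The second argument counts vertices, hence `m ∸ 1` edges; `spine n 1` is empty and so holds in
-- every graph.
spine : ∀ n → ℕ → Facts n
spine zero    m = []
spine (suc n) m = map (λ i → (inject₁ i , suc i) , true) (take (m ∸ 1) (allFin n))

module _ {k} (X : Graph k) {n : ℕ} where

  Outcome : BRel n → Set
  Outcome A = Unilateral A ⊎ Iso A X

  Claim : Facts n → Set
  Claim fs = ∀ A → Admissible A → Holds A fs → Outcome A

  -- Checker and soundness proof in one: a tree is accepted only together with a proof of its claim.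
  -- `next` is the claim for paths on m + 1 vertices; `longer` relabels the graph so that the new
  -- path becomes the spine, keeps no other fact, and appeals to `next`. A Hamiltonian path is
  -- itself a spanning walk, so the descent starts with `nothing` at m = n - 1.
  certify : ∀ m → Maybe (Claim (spine n (suc m))) → ∀ fs → Tree n k → Maybe (Claim fs)
  certify m next fs (branch i j t f)
    with certify m next (((i , j) , true) ∷ fs) t | certify m next (((i , j) , false) ∷ fs) f
  ... | just T | just F = just claim
    where
    claim : Claim fs
    claim A adm h with A i j in e
    ... | true  = T A adm (e ∷ h)
    ... | false = F A adm (e ∷ h)
  ... | _      | _      = nothing
  certify m nothing fs (longer p) = nothing
  certify m (just next) fs (longer p) with bijection? p
  ... | nothing = nothing
  ... | just f with All.all? (λ ((i , j) , b) → known? fs (Inverse.to f i) (Inverse.to f j) b) (spine n (suc m))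
  ...   | no _   = nothing
  ...   | yes ks = just λ A adm h →
    Sum.map (relabel-unilateral f) (relabel-iso f X)
      (next (relabel f A) (relabel-admissible f adm) (All.map (known⇒holds (Admissible.A-sym adm) h) ks))
  certify m next fs (spanned w)
    with all? (λ x → mem? _≟_ x w)
       | All.all? (λ (x , y) → known? fs x y true ×-dec
           (¬? (mem? _≟²_ (y , x) (steps w)) ×-dec ¬? (parity w x ≟ᵇ parity w y))) (steps w)
  ... | yes c | yes g = just λ A adm h →
    inj₁ (walk⇒unilateral w c (All.map (λ (p , q) → known⇒holds (Admissible.A-sym adm) h p , q) g))
  ... | _     | _     = nothing
  certify m next fs (low i l) with all? (λ j → (i ≟ j) ⊎-dec ((j ≟ l) ⊎-dec known? fs i j false))
  ... | no _  = nothing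
  ... | yes c = just λ A adm h → ⊥-elim (absurd A adm h)
    where
    absurd : ∀ A → Admissible A → Holds A fs → ⊥
    absurd A adm h with Admissible.degree≥2 adm i
    ... | y , z , y≢z , iy , iz = y≢z (trans (is-l y iy) (sym (is-l z iz)))
      where
      is-l : ∀ j → Arc A i j → j ≡ l
      is-l j ij with c j
      ... | inj₁ refl     = ⊥-elim (true≢false ij (Admissible.A-irr adm i))
      ... | inj₂ (inj₁ e) = e
      ... | inj₂ (inj₂ p) = ⊥-elim (true≢false ij (known⇒holds (Admissible.A-sym adm) h p))
  certify m next fs (apart S)
    with any? (λ i → lookup S i ≟ᵇ true) | any? (λ j → lookup S j ≟ᵇ false)
       | all? (λ i → all? (λ j → (lookup S i ≟ᵇ true) →-dec ((lookup S j ≟ᵇ false) →-dec known? fs i j false)))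
  ... | yes (i , Si) | yes (j , Sj) | yes c = just λ A adm h →
    ⊥-elim (true≢false (Admissible.A-strong adm (lookup S) (closed A adm h) Si j) Sj)
    where
    closed : ∀ A → Admissible A → Holds A fs → Closed A (lookup S)
    closed A adm h x y p a with lookup S y in q
    ... | true  = refl
    ... | false = ⊥-elim (true≢false a (known⇒holds (Admissible.A-sym adm) h (c x y p q)))
  ... | _ | _ | _ = nothing
  certify m next fs (isomorphic p) with bijection? p
  ... | nothing = nothing
  -- No fact is required on the diagonal, so both graphs must be known to be loopless there.
  ... | just f with all? (λ x → all? (λ y → (x ≟ y) ⊎-dec known? fs x y (adj X (Inverse.to f x) (Inverse.to f y))))
                  | all? (λ x → adj X x x ≟ᵇ false)
  ...   | yes c | yes irr = just λ A adm h → inj₂ (f , agree A adm h)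
    where
    agree : ∀ A → Admissible A → Holds A fs → ∀ x y → A x y ≡ adj X (Inverse.to f x) (Inverse.to f y)
    agree A adm h x y with c x y
    ... | inj₂ p    = known⇒holds (Admissible.A-sym adm) h p
    ... | inj₁ refl = trans (Admissible.A-irr adm x) (sym (irr _))
  ...   | _     | _       = nothing

-- Certificates for orders 5 to 8, from paths missing one vertex down to single vertices

order₅-path₄ : Claim G₁ (spine 5 4)
order₅-path₄ = from-just (certify G₁ 4 nothing (spine 5 4) (
  branch 0F 4F (spanned (3F ∷ 2F ∷ 1F ∷ 0F ∷ 4F ∷ [])) (
  branch 3F 4F (spanned (0F ∷ 1F ∷ 2F ∷ 3F ∷ 4F ∷ [])) (
  branch 1F 4F (
   branch 0F 2F (spanned (3F ∷ 2F ∷ 0F ∷ 1F ∷ 4F ∷ [])) (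
   branch 0F 3F (spanned (0F ∷ 3F ∷ 2F ∷ 1F ∷ 4F ∷ [])) (
   low 0F 1F))) (low 4F 2F)))))

order₅-path₃ : Claim G₁ (spine 5 3)
order₅-path₃ = from-just (certify G₁ 3 (just order₅-path₄) (spine 5 3) (
  branch 0F 3F (longer (2F ∷ 1F ∷ 0F ∷ 3F ∷ 4F ∷ [])) (
  branch 0F 4F (longer (2F ∷ 1F ∷ 0F ∷ 4F ∷ 3F ∷ [])) (
  branch 2F 3F (longer (0F ∷ 1F ∷ 2F ∷ 3F ∷ 4F ∷ [])) (
  branch 2F 4F (longer (0F ∷ 1F ∷ 2F ∷ 4F ∷ 3F ∷ [])) (
  branch 0F 2F (
   branch 1F 3F (longer (0F ∷ 2F ∷ 1F ∷ 3F ∷ 4F ∷ [])) (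
   low 3F 4F)) (low 0F 1F)))))))

order₅-path₂ : Claim G₁ (spine 5 2)
order₅-path₂ = from-just (certify G₁ 2 (just order₅-path₃) (spine 5 2) (
  branch 0F 2F (longer (1F ∷ 0F ∷ 2F ∷ 3F ∷ 4F ∷ [])) (
  branch 0F 3F (longer (1F ∷ 0F ∷ 3F ∷ 2F ∷ 4F ∷ [])) (
  branch 0F 4F (longer (1F ∷ 0F ∷ 4F ∷ 2F ∷ 3F ∷ [])) (
  low 0F 1F)))))

-- A single vertex is always a path, so this claim covers all admissible graphs of order 5; the
-- other orders end likewise.
order₅-path₁ : Claim G₁ (spine 5 1)
order₅-path₁ = from-just (certify G₁ 1 (just order₅-path₂) (spine 5 1) (
  branch 0F 1F (longer (0F ∷ 1F ∷ 2F ∷ 3F ∷ 4F ∷ [])) (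
  branch 0F 2F (longer (0F ∷ 2F ∷ 1F ∷ 3F ∷ 4F ∷ [])) (
  branch 0F 3F (longer (0F ∷ 3F ∷ 1F ∷ 2F ∷ 4F ∷ [])) (
  low 0F 4F)))))

order₆-path₅ : Claim G₁ (spine 6 5)
order₆-path₅ = from-just (certify G₁ 5 nothing (spine 6 5) (
  branch 0F 5F (spanned (4F ∷ 3F ∷ 2F ∷ 1F ∷ 0F ∷ 5F ∷ [])) (
  branch 4F 5F (spanned (0F ∷ 1F ∷ 2F ∷ 3F ∷ 4F ∷ 5F ∷ [])) (
  branch 0F 2F (
   branch 1F 5F (spanned (4F ∷ 3F ∷ 2F ∷ 0F ∷ 1F ∷ 5F ∷ [])) (
   branch 2F 5F (
    branch 0F 3F (spanned (4F ∷ 3F ∷ 0F ∷ 1F ∷ 2F ∷ 5F ∷ [])) (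
    branch 0F 4F (spanned (1F ∷ 0F ∷ 4F ∷ 3F ∷ 2F ∷ 5F ∷ [])) (
    branch 1F 3F (spanned (4F ∷ 3F ∷ 1F ∷ 0F ∷ 2F ∷ 5F ∷ [])) (
    branch 1F 4F (spanned (0F ∷ 1F ∷ 4F ∷ 3F ∷ 2F ∷ 5F ∷ [])) (
    branch 3F 5F (spanned (0F ∷ 1F ∷ 2F ∷ 5F ∷ 3F ∷ 4F ∷ [])) (
    low 5F 2F)))))) (low 5F 3F))) (
  branch 0F 3F (
   branch 1F 5F (spanned (4F ∷ 3F ∷ 2F ∷ 1F ∷ 0F ∷ 3F ∷ 2F ∷ 1F ∷ 5F ∷ [])) (
   branch 2F 5F (spanned (4F ∷ 3F ∷ 0F ∷ 1F ∷ 2F ∷ 5F ∷ [])) (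
   low 5F 3F))) (
  branch 0F 4F (
   branch 1F 5F (spanned (0F ∷ 4F ∷ 3F ∷ 2F ∷ 1F ∷ 5F ∷ [])) (
   branch 2F 5F (spanned (1F ∷ 0F ∷ 4F ∷ 3F ∷ 2F ∷ 5F ∷ [])) (
   low 5F 3F))) (low 0F 1F)))))))

order₆-path₄ : Claim G₁ (spine 6 4)
order₆-path₄ = from-just (certify G₁ 4 (just order₆-path₅) (spine 6 4) (
  branch 0F 4F (longer (3F ∷ 2F ∷ 1F ∷ 0F ∷ 4F ∷ 5F ∷ [])) (
  branch 0F 5F (longer (3F ∷ 2F ∷ 1F ∷ 0F ∷ 5F ∷ 4F ∷ [])) (
  branch 3F 4F (longer (0F ∷ 1F ∷ 2F ∷ 3F ∷ 4F ∷ 5F ∷ [])) (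
  branch 3F 5F (longer (0F ∷ 1F ∷ 2F ∷ 3F ∷ 5F ∷ 4F ∷ [])) (
  branch 0F 2F (
   branch 1F 4F (longer (3F ∷ 2F ∷ 0F ∷ 1F ∷ 4F ∷ 5F ∷ [])) (
   branch 1F 5F (longer (3F ∷ 2F ∷ 0F ∷ 1F ∷ 5F ∷ 4F ∷ [])) (
   branch 2F 4F (
    branch 0F 3F (longer (1F ∷ 0F ∷ 3F ∷ 2F ∷ 4F ∷ 5F ∷ [])) (
    branch 1F 3F (longer (0F ∷ 1F ∷ 3F ∷ 2F ∷ 4F ∷ 5F ∷ [])) (
    low 3F 2F))) (low 4F 5F)))) (
  branch 0F 3F (
   branch 1F 4F (longer (0F ∷ 3F ∷ 2F ∷ 1F ∷ 4F ∷ 5F ∷ [])) (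
   branch 1F 5F (longer (0F ∷ 3F ∷ 2F ∷ 1F ∷ 5F ∷ 4F ∷ [])) (
   branch 2F 4F (longer (1F ∷ 0F ∷ 3F ∷ 2F ∷ 4F ∷ 5F ∷ [])) (
   low 4F 5F)))) (low 0F 1F))))))))

order₆-path₃ : Claim G₁ (spine 6 3)
order₆-path₃ = from-just (certify G₁ 3 (just order₆-path₄) (spine 6 3) (
  branch 0F 3F (longer (2F ∷ 1F ∷ 0F ∷ 3F ∷ 4F ∷ 5F ∷ [])) (
  branch 0F 4F (longer (2F ∷ 1F ∷ 0F ∷ 4F ∷ 3F ∷ 5F ∷ [])) (
  branch 0F 5F (longer (2F ∷ 1F ∷ 0F ∷ 5F ∷ 3F ∷ 4F ∷ [])) (
  branch 2F 3F (longer (0F ∷ 1F ∷ 2F ∷ 3F ∷ 4F ∷ 5F ∷ [])) (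
  branch 2F 4F (longer (0F ∷ 1F ∷ 2F ∷ 4F ∷ 3F ∷ 5F ∷ [])) (
  branch 2F 5F (longer (0F ∷ 1F ∷ 2F ∷ 5F ∷ 3F ∷ 4F ∷ [])) (
  branch 0F 2F (
   branch 1F 3F (longer (0F ∷ 2F ∷ 1F ∷ 3F ∷ 4F ∷ 5F ∷ [])) (
   branch 1F 4F (longer (0F ∷ 2F ∷ 1F ∷ 4F ∷ 3F ∷ 5F ∷ [])) (
   branch 1F 5F (longer (0F ∷ 2F ∷ 1F ∷ 5F ∷ 3F ∷ 4F ∷ [])) (
   apart (true ∷ true ∷ true ∷ false ∷ false ∷ false ∷ []))))) (low 0F 1F)))))))))

order₆-path₂ : Claim G₁ (spine 6 2)
order₆-path₂ = from-just (certify G₁ 2 (just order₆-path₃) (spine 6 2) (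
  branch 0F 2F (longer (1F ∷ 0F ∷ 2F ∷ 3F ∷ 4F ∷ 5F ∷ [])) (
  branch 0F 3F (longer (1F ∷ 0F ∷ 3F ∷ 2F ∷ 4F ∷ 5F ∷ [])) (
  branch 0F 4F (longer (1F ∷ 0F ∷ 4F ∷ 2F ∷ 3F ∷ 5F ∷ [])) (
  branch 0F 5F (longer (1F ∷ 0F ∷ 5F ∷ 2F ∷ 3F ∷ 4F ∷ [])) (
  low 0F 1F))))))

order₆-path₁ : Claim G₁ (spine 6 1)
order₆-path₁ = from-just (certify G₁ 1 (just order₆-path₂) (spine 6 1) (
  branch 0F 1F (longer (0F ∷ 1F ∷ 2F ∷ 3F ∷ 4F ∷ 5F ∷ [])) (
  branch 0F 2F (longer (0F ∷ 2F ∷ 1F ∷ 3F ∷ 4F ∷ 5F ∷ [])) (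
  branch 0F 3F (longer (0F ∷ 3F ∷ 1F ∷ 2F ∷ 4F ∷ 5F ∷ [])) (
  branch 0F 4F (longer (0F ∷ 4F ∷ 1F ∷ 2F ∷ 3F ∷ 5F ∷ [])) (
  low 0F 5F))))))

order₇-path₆ : Claim G₁ (spine 7 6)
order₇-path₆ = from-just (certify G₁ 6 nothing (spine 7 6) (
  branch 0F 6F (spanned (5F ∷ 4F ∷ 3F ∷ 2F ∷ 1F ∷ 0F ∷ 6F ∷ [])) (
  branch 5F 6F (spanned (0F ∷ 1F ∷ 2F ∷ 3F ∷ 4F ∷ 5F ∷ 6F ∷ [])) (
  branch 0F 2F (
   branch 1F 6F (spanned (5F ∷ 4F ∷ 3F ∷ 2F ∷ 0F ∷ 1F ∷ 6F ∷ [])) (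
   branch 2F 6F (
    branch 0F 3F (spanned (5F ∷ 4F ∷ 3F ∷ 0F ∷ 1F ∷ 2F ∷ 6F ∷ [])) (
    branch 0F 5F (spanned (1F ∷ 0F ∷ 5F ∷ 4F ∷ 3F ∷ 2F ∷ 6F ∷ [])) (
    branch 1F 3F (spanned (5F ∷ 4F ∷ 3F ∷ 1F ∷ 0F ∷ 2F ∷ 6F ∷ [])) (
    branch 1F 5F (spanned (0F ∷ 1F ∷ 5F ∷ 4F ∷ 3F ∷ 2F ∷ 6F ∷ [])) (
    branch 2F 5F (spanned (0F ∷ 1F ∷ 2F ∷ 5F ∷ 4F ∷ 3F ∷ 2F ∷ 6F ∷ [])) (
    branch 3F 6F (spanned (0F ∷ 1F ∷ 2F ∷ 6F ∷ 3F ∷ 4F ∷ 5F ∷ [])) (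
    branch 4F 6F (spanned (0F ∷ 1F ∷ 2F ∷ 6F ∷ 4F ∷ 3F ∷ 2F ∷ 6F ∷ 4F ∷ 5F ∷ [])) (
    low 6F 2F)))))))) (
   branch 3F 6F (
    branch 0F 3F (spanned (5F ∷ 4F ∷ 3F ∷ 2F ∷ 1F ∷ 0F ∷ 3F ∷ 6F ∷ [])) (
    branch 0F 4F (spanned (5F ∷ 4F ∷ 0F ∷ 1F ∷ 2F ∷ 3F ∷ 6F ∷ [])) (
    branch 0F 5F (spanned (1F ∷ 2F ∷ 0F ∷ 5F ∷ 4F ∷ 3F ∷ 6F ∷ [])) (
    branch 1F 3F (spanned (5F ∷ 4F ∷ 3F ∷ 1F ∷ 0F ∷ 2F ∷ 3F ∷ 6F ∷ [])) (
    branch 1F 4F (spanned (5F ∷ 4F ∷ 1F ∷ 0F ∷ 2F ∷ 3F ∷ 6F ∷ [])) (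
    branch 1F 5F (spanned (0F ∷ 2F ∷ 1F ∷ 5F ∷ 4F ∷ 3F ∷ 6F ∷ [])) (
    branch 2F 5F (spanned (0F ∷ 1F ∷ 2F ∷ 5F ∷ 4F ∷ 3F ∷ 6F ∷ [])) (
    branch 4F 6F (spanned (0F ∷ 1F ∷ 2F ∷ 3F ∷ 6F ∷ 4F ∷ 5F ∷ [])) (
    low 6F 3F))))))))) (low 6F 4F)))) (
  branch 0F 3F (
   branch 1F 6F (spanned (5F ∷ 4F ∷ 3F ∷ 2F ∷ 1F ∷ 0F ∷ 3F ∷ 2F ∷ 1F ∷ 6F ∷ [])) (
   branch 2F 6F (spanned (5F ∷ 4F ∷ 3F ∷ 0F ∷ 1F ∷ 2F ∷ 6F ∷ [])) (
   branch 3F 6F (spanned (5F ∷ 4F ∷ 3F ∷ 2F ∷ 1F ∷ 0F ∷ 3F ∷ 6F ∷ [])) (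
   low 6F 4F)))) (
  branch 0F 4F (
   branch 3F 6F (spanned (5F ∷ 4F ∷ 0F ∷ 1F ∷ 2F ∷ 3F ∷ 6F ∷ [])) (
   branch 1F 6F (
    branch 0F 5F (spanned (0F ∷ 5F ∷ 4F ∷ 3F ∷ 2F ∷ 1F ∷ 6F ∷ [])) (
    branch 1F 5F (spanned (3F ∷ 2F ∷ 1F ∷ 0F ∷ 4F ∷ 5F ∷ 1F ∷ 6F ∷ [])) (
    branch 2F 5F (spanned (3F ∷ 2F ∷ 5F ∷ 4F ∷ 0F ∷ 1F ∷ 6F ∷ [])) (
    branch 2F 6F (spanned (0F ∷ 1F ∷ 6F ∷ 2F ∷ 3F ∷ 4F ∷ 5F ∷ [])) (
    branch 3F 5F (spanned (0F ∷ 4F ∷ 5F ∷ 3F ∷ 2F ∷ 1F ∷ 6F ∷ [])) (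
    low 5F 4F)))))) (
   branch 2F 6F (
    branch 0F 5F (spanned (1F ∷ 0F ∷ 5F ∷ 4F ∷ 3F ∷ 2F ∷ 6F ∷ [])) (
    branch 1F 3F (spanned (5F ∷ 4F ∷ 0F ∷ 1F ∷ 3F ∷ 2F ∷ 6F ∷ [])) (
    branch 1F 5F (spanned (0F ∷ 1F ∷ 5F ∷ 4F ∷ 3F ∷ 2F ∷ 6F ∷ [])) (
    branch 2F 5F (spanned (0F ∷ 1F ∷ 2F ∷ 5F ∷ 4F ∷ 3F ∷ 2F ∷ 6F ∷ [])) (
    branch 3F 5F (spanned (1F ∷ 0F ∷ 4F ∷ 5F ∷ 3F ∷ 2F ∷ 6F ∷ [])) (
    low 5F 4F)))))) (low 6F 4F)))) (
  branch 0F 5F (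
   branch 1F 6F (spanned (0F ∷ 5F ∷ 4F ∷ 3F ∷ 2F ∷ 1F ∷ 6F ∷ [])) (
   branch 2F 6F (spanned (1F ∷ 0F ∷ 5F ∷ 4F ∷ 3F ∷ 2F ∷ 6F ∷ [])) (
   branch 3F 6F (spanned (2F ∷ 1F ∷ 0F ∷ 5F ∷ 4F ∷ 3F ∷ 6F ∷ [])) (
   low 6F 4F)))) (low 0F 1F))))))))

-- A longest path of `G₁` runs through two of the triangles and has five vertices, so the exception
-- surfaces at this length; vertices 5 and 6 form the third triangle with the middle of the path.
order₇-path₅ : Claim G₁ (spine 7 5)
order₇-path₅ = from-just (certify G₁ 5 (just order₇-path₆) (spine 7 5) (
  branch 0F 5F (longer (4F ∷ 3F ∷ 2F ∷ 1F ∷ 0F ∷ 5F ∷ 6F ∷ [])) (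
  branch 0F 6F (longer (4F ∷ 3F ∷ 2F ∷ 1F ∷ 0F ∷ 6F ∷ 5F ∷ [])) (
  branch 4F 5F (longer (0F ∷ 1F ∷ 2F ∷ 3F ∷ 4F ∷ 5F ∷ 6F ∷ [])) (
  branch 4F 6F (longer (0F ∷ 1F ∷ 2F ∷ 3F ∷ 4F ∷ 6F ∷ 5F ∷ [])) (
  branch 0F 2F (
   branch 1F 5F (longer (4F ∷ 3F ∷ 2F ∷ 0F ∷ 1F ∷ 5F ∷ 6F ∷ [])) (
   branch 1F 6F (longer (4F ∷ 3F ∷ 2F ∷ 0F ∷ 1F ∷ 6F ∷ 5F ∷ [])) (
   branch 0F 4F (
    branch 2F 5F (longer (1F ∷ 0F ∷ 4F ∷ 3F ∷ 2F ∷ 5F ∷ 6F ∷ [])) (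
    branch 2F 6F (longer (1F ∷ 0F ∷ 4F ∷ 3F ∷ 2F ∷ 6F ∷ 5F ∷ [])) (
    branch 3F 5F (longer (1F ∷ 2F ∷ 0F ∷ 4F ∷ 3F ∷ 5F ∷ 6F ∷ [])) (
    low 5F 6F)))) (
   branch 1F 4F (
    branch 2F 5F (longer (0F ∷ 1F ∷ 4F ∷ 3F ∷ 2F ∷ 5F ∷ 6F ∷ [])) (
    branch 2F 6F (longer (0F ∷ 1F ∷ 4F ∷ 3F ∷ 2F ∷ 6F ∷ 5F ∷ [])) (
    branch 3F 5F (longer (0F ∷ 2F ∷ 1F ∷ 4F ∷ 3F ∷ 5F ∷ 6F ∷ [])) (
    low 5F 6F)))) (
   branch 2F 4F (
    branch 3F 5F (longer (0F ∷ 1F ∷ 2F ∷ 4F ∷ 3F ∷ 5F ∷ 6F ∷ [])) (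
    branch 3F 6F (longer (0F ∷ 1F ∷ 2F ∷ 4F ∷ 3F ∷ 6F ∷ 5F ∷ [])) (
    branch 2F 5F (
     branch 0F 3F (longer (1F ∷ 0F ∷ 3F ∷ 4F ∷ 2F ∷ 5F ∷ 6F ∷ [])) (
     branch 1F 3F (longer (0F ∷ 1F ∷ 3F ∷ 4F ∷ 2F ∷ 5F ∷ 6F ∷ [])) (
     branch 2F 6F (
      branch 5F 6F (isomorphic (1F ∷ 2F ∷ 0F ∷ 3F ∷ 4F ∷ 5F ∷ 6F ∷ [])) (
      low 5F 2F)) (low 6F 5F)))) (low 5F 6F)))) (low 4F 3F)))))) (
  branch 0F 3F (
   branch 2F 5F (longer (4F ∷ 3F ∷ 0F ∷ 1F ∷ 2F ∷ 5F ∷ 6F ∷ [])) (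
   branch 2F 6F (longer (4F ∷ 3F ∷ 0F ∷ 1F ∷ 2F ∷ 6F ∷ 5F ∷ [])) (
   branch 0F 4F (
    branch 1F 5F (longer (0F ∷ 4F ∷ 3F ∷ 2F ∷ 1F ∷ 5F ∷ 6F ∷ [])) (
    branch 1F 6F (longer (0F ∷ 4F ∷ 3F ∷ 2F ∷ 1F ∷ 6F ∷ 5F ∷ [])) (
    branch 3F 5F (longer (2F ∷ 1F ∷ 0F ∷ 4F ∷ 3F ∷ 5F ∷ 6F ∷ [])) (
    low 5F 6F)))) (
   branch 1F 4F (
    branch 1F 5F (
     branch 1F 6F (spanned (5F ∷ 1F ∷ 0F ∷ 3F ∷ 2F ∷ 1F ∷ 4F ∷ 3F ∷ 2F ∷ 1F ∷ 6F ∷ [])) (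
     branch 2F 4F (longer (0F ∷ 3F ∷ 2F ∷ 4F ∷ 1F ∷ 5F ∷ 6F ∷ [])) (
     branch 3F 6F (spanned (5F ∷ 1F ∷ 0F ∷ 3F ∷ 2F ∷ 1F ∷ 4F ∷ 3F ∷ 6F ∷ [])) (
     low 6F 5F)))) (
    branch 3F 5F (
     branch 1F 6F (spanned (5F ∷ 3F ∷ 2F ∷ 1F ∷ 0F ∷ 3F ∷ 2F ∷ 1F ∷ 4F ∷ 3F ∷ 2F ∷ 1F ∷ 6F ∷ [])) (
     branch 2F 4F (longer (0F ∷ 1F ∷ 2F ∷ 4F ∷ 3F ∷ 5F ∷ 6F ∷ [])) (
     branch 3F 6F (spanned (5F ∷ 3F ∷ 2F ∷ 1F ∷ 0F ∷ 3F ∷ 2F ∷ 1F ∷ 4F ∷ 3F ∷ 6F ∷ [])) (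
     low 6F 5F)))) (low 5F 6F))) (
   branch 2F 4F (
    branch 1F 5F (longer (0F ∷ 3F ∷ 4F ∷ 2F ∷ 1F ∷ 5F ∷ 6F ∷ [])) (
    branch 1F 6F (longer (0F ∷ 3F ∷ 4F ∷ 2F ∷ 1F ∷ 6F ∷ 5F ∷ [])) (
    branch 3F 5F (longer (0F ∷ 1F ∷ 2F ∷ 4F ∷ 3F ∷ 5F ∷ 6F ∷ [])) (
    low 5F 6F)))) (low 4F 3F)))))) (
  branch 0F 4F (
   branch 1F 5F (longer (0F ∷ 4F ∷ 3F ∷ 2F ∷ 1F ∷ 5F ∷ 6F ∷ [])) (
   branch 1F 6F (longer (0F ∷ 4F ∷ 3F ∷ 2F ∷ 1F ∷ 6F ∷ 5F ∷ [])) (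
   branch 2F 5F (longer (1F ∷ 0F ∷ 4F ∷ 3F ∷ 2F ∷ 5F ∷ 6F ∷ [])) (
   branch 2F 6F (longer (1F ∷ 0F ∷ 4F ∷ 3F ∷ 2F ∷ 6F ∷ 5F ∷ [])) (
   branch 3F 5F (longer (2F ∷ 1F ∷ 0F ∷ 4F ∷ 3F ∷ 5F ∷ 6F ∷ [])) (
   low 5F 6F)))))) (low 0F 1F)))))))))

order₇-path₄ : Claim G₁ (spine 7 4)
order₇-path₄ = from-just (certify G₁ 4 (just order₇-path₅) (spine 7 4) (
  branch 0F 4F (longer (3F ∷ 2F ∷ 1F ∷ 0F ∷ 4F ∷ 5F ∷ 6F ∷ [])) (
  branch 0F 5F (longer (3F ∷ 2F ∷ 1F ∷ 0F ∷ 5F ∷ 4F ∷ 6F ∷ [])) (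
  branch 0F 6F (longer (3F ∷ 2F ∷ 1F ∷ 0F ∷ 6F ∷ 4F ∷ 5F ∷ [])) (
  branch 3F 4F (longer (0F ∷ 1F ∷ 2F ∷ 3F ∷ 4F ∷ 5F ∷ 6F ∷ [])) (
  branch 3F 5F (longer (0F ∷ 1F ∷ 2F ∷ 3F ∷ 5F ∷ 4F ∷ 6F ∷ [])) (
  branch 3F 6F (longer (0F ∷ 1F ∷ 2F ∷ 3F ∷ 6F ∷ 4F ∷ 5F ∷ [])) (
  branch 0F 2F (
   branch 1F 4F (longer (3F ∷ 2F ∷ 0F ∷ 1F ∷ 4F ∷ 5F ∷ 6F ∷ [])) (
   branch 1F 5F (longer (3F ∷ 2F ∷ 0F ∷ 1F ∷ 5F ∷ 4F ∷ 6F ∷ [])) (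
   branch 1F 6F (longer (3F ∷ 2F ∷ 0F ∷ 1F ∷ 6F ∷ 4F ∷ 5F ∷ [])) (
   branch 0F 3F (
    branch 2F 4F (longer (1F ∷ 0F ∷ 3F ∷ 2F ∷ 4F ∷ 5F ∷ 6F ∷ [])) (
    branch 2F 5F (longer (1F ∷ 0F ∷ 3F ∷ 2F ∷ 5F ∷ 4F ∷ 6F ∷ [])) (
    branch 2F 6F (longer (1F ∷ 0F ∷ 3F ∷ 2F ∷ 6F ∷ 4F ∷ 5F ∷ [])) (
    apart (true ∷ true ∷ true ∷ true ∷ false ∷ false ∷ false ∷ []))))) (
   branch 1F 3F (
    branch 2F 4F (longer (0F ∷ 1F ∷ 3F ∷ 2F ∷ 4F ∷ 5F ∷ 6F ∷ [])) (
    branch 2F 5F (longer (0F ∷ 1F ∷ 3F ∷ 2F ∷ 5F ∷ 4F ∷ 6F ∷ [])) (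
    branch 2F 6F (longer (0F ∷ 1F ∷ 3F ∷ 2F ∷ 6F ∷ 4F ∷ 5F ∷ [])) (
    apart (true ∷ true ∷ true ∷ true ∷ false ∷ false ∷ false ∷ []))))) (low 3F 2F)))))) (
  branch 0F 3F (
   branch 1F 4F (longer (0F ∷ 3F ∷ 2F ∷ 1F ∷ 4F ∷ 5F ∷ 6F ∷ [])) (
   branch 1F 5F (longer (0F ∷ 3F ∷ 2F ∷ 1F ∷ 5F ∷ 4F ∷ 6F ∷ [])) (
   branch 1F 6F (longer (0F ∷ 3F ∷ 2F ∷ 1F ∷ 6F ∷ 4F ∷ 5F ∷ [])) (
   branch 2F 4F (longer (1F ∷ 0F ∷ 3F ∷ 2F ∷ 4F ∷ 5F ∷ 6F ∷ [])) (
   branch 2F 5F (longer (1F ∷ 0F ∷ 3F ∷ 2F ∷ 5F ∷ 4F ∷ 6F ∷ [])) (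
   branch 2F 6F (longer (1F ∷ 0F ∷ 3F ∷ 2F ∷ 6F ∷ 4F ∷ 5F ∷ [])) (
   apart (true ∷ true ∷ true ∷ true ∷ false ∷ false ∷ false ∷ [])))))))) (low 0F 1F))))))))))

order₇-path₃ : Claim G₁ (spine 7 3)
order₇-path₃ = from-just (certify G₁ 3 (just order₇-path₄) (spine 7 3) (
  branch 0F 3F (longer (2F ∷ 1F ∷ 0F ∷ 3F ∷ 4F ∷ 5F ∷ 6F ∷ [])) (
  branch 0F 4F (longer (2F ∷ 1F ∷ 0F ∷ 4F ∷ 3F ∷ 5F ∷ 6F ∷ [])) (
  branch 0F 5F (longer (2F ∷ 1F ∷ 0F ∷ 5F ∷ 3F ∷ 4F ∷ 6F ∷ [])) (
  branch 0F 6F (longer (2F ∷ 1F ∷ 0F ∷ 6F ∷ 3F ∷ 4F ∷ 5F ∷ [])) (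
  branch 2F 3F (longer (0F ∷ 1F ∷ 2F ∷ 3F ∷ 4F ∷ 5F ∷ 6F ∷ [])) (
  branch 2F 4F (longer (0F ∷ 1F ∷ 2F ∷ 4F ∷ 3F ∷ 5F ∷ 6F ∷ [])) (
  branch 2F 5F (longer (0F ∷ 1F ∷ 2F ∷ 5F ∷ 3F ∷ 4F ∷ 6F ∷ [])) (
  branch 2F 6F (longer (0F ∷ 1F ∷ 2F ∷ 6F ∷ 3F ∷ 4F ∷ 5F ∷ [])) (
  branch 0F 2F (
   branch 1F 3F (longer (0F ∷ 2F ∷ 1F ∷ 3F ∷ 4F ∷ 5F ∷ 6F ∷ [])) (
   branch 1F 4F (longer (0F ∷ 2F ∷ 1F ∷ 4F ∷ 3F ∷ 5F ∷ 6F ∷ [])) (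
   branch 1F 5F (longer (0F ∷ 2F ∷ 1F ∷ 5F ∷ 3F ∷ 4F ∷ 6F ∷ [])) (
   branch 1F 6F (longer (0F ∷ 2F ∷ 1F ∷ 6F ∷ 3F ∷ 4F ∷ 5F ∷ [])) (
   apart (true ∷ true ∷ true ∷ false ∷ false ∷ false ∷ false ∷ [])))))) (low 0F 1F)))))))))))

order₇-path₂ : Claim G₁ (spine 7 2)
order₇-path₂ = from-just (certify G₁ 2 (just order₇-path₃) (spine 7 2) (
  branch 0F 2F (longer (1F ∷ 0F ∷ 2F ∷ 3F ∷ 4F ∷ 5F ∷ 6F ∷ [])) (
  branch 0F 3F (longer (1F ∷ 0F ∷ 3F ∷ 2F ∷ 4F ∷ 5F ∷ 6F ∷ [])) (
  branch 0F 4F (longer (1F ∷ 0F ∷ 4F ∷ 2F ∷ 3F ∷ 5F ∷ 6F ∷ [])) (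
  branch 0F 5F (longer (1F ∷ 0F ∷ 5F ∷ 2F ∷ 3F ∷ 4F ∷ 6F ∷ [])) (
  branch 0F 6F (longer (1F ∷ 0F ∷ 6F ∷ 2F ∷ 3F ∷ 4F ∷ 5F ∷ [])) (
  low 0F 1F)))))))

order₇-path₁ : Claim G₁ (spine 7 1)
order₇-path₁ = from-just (certify G₁ 1 (just order₇-path₂) (spine 7 1) (
  branch 0F 1F (longer (0F ∷ 1F ∷ 2F ∷ 3F ∷ 4F ∷ 5F ∷ 6F ∷ [])) (
  branch 0F 2F (longer (0F ∷ 2F ∷ 1F ∷ 3F ∷ 4F ∷ 5F ∷ 6F ∷ [])) (
  branch 0F 3F (longer (0F ∷ 3F ∷ 1F ∷ 2F ∷ 4F ∷ 5F ∷ 6F ∷ [])) (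
  branch 0F 4F (longer (0F ∷ 4F ∷ 1F ∷ 2F ∷ 3F ∷ 5F ∷ 6F ∷ [])) (
  branch 0F 5F (longer (0F ∷ 5F ∷ 1F ∷ 2F ∷ 3F ∷ 4F ∷ 6F ∷ [])) (
  low 0F 6F)))))))

order₈-path₇ : Claim G₂ (spine 8 7)
order₈-path₇ = from-just (certify G₂ 7 nothing (spine 8 7) (
  branch 0F 7F (spanned (6F ∷ 5F ∷ 4F ∷ 3F ∷ 2F ∷ 1F ∷ 0F ∷ 7F ∷ [])) (
  branch 6F 7F (spanned (0F ∷ 1F ∷ 2F ∷ 3F ∷ 4F ∷ 5F ∷ 6F ∷ 7F ∷ [])) (
  branch 0F 2F (
   branch 1F 7F (spanned (6F ∷ 5F ∷ 4F ∷ 3F ∷ 2F ∷ 0F ∷ 1F ∷ 7F ∷ [])) (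
   branch 2F 7F (
    branch 0F 3F (spanned (6F ∷ 5F ∷ 4F ∷ 3F ∷ 0F ∷ 1F ∷ 2F ∷ 7F ∷ [])) (
    branch 0F 5F (spanned (6F ∷ 5F ∷ 4F ∷ 3F ∷ 2F ∷ 1F ∷ 0F ∷ 5F ∷ 4F ∷ 3F ∷ 2F ∷ 7F ∷ [])) (
    branch 0F 6F (spanned (1F ∷ 0F ∷ 6F ∷ 5F ∷ 4F ∷ 3F ∷ 2F ∷ 7F ∷ [])) (
    branch 1F 3F (spanned (6F ∷ 5F ∷ 4F ∷ 3F ∷ 1F ∷ 0F ∷ 2F ∷ 7F ∷ [])) (
    branch 1F 5F (spanned (6F ∷ 5F ∷ 1F ∷ 0F ∷ 2F ∷ 3F ∷ 4F ∷ 5F ∷ 1F ∷ 0F ∷ 2F ∷ 7F ∷ [])) (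
    branch 1F 6F (spanned (0F ∷ 1F ∷ 6F ∷ 5F ∷ 4F ∷ 3F ∷ 2F ∷ 7F ∷ [])) (
    branch 3F 7F (spanned (0F ∷ 1F ∷ 2F ∷ 7F ∷ 3F ∷ 4F ∷ 5F ∷ 6F ∷ [])) (
    branch 4F 7F (spanned (0F ∷ 1F ∷ 2F ∷ 7F ∷ 4F ∷ 3F ∷ 2F ∷ 7F ∷ 4F ∷ 5F ∷ 6F ∷ [])) (
    branch 5F 7F (
     branch 0F 4F (spanned (1F ∷ 0F ∷ 4F ∷ 3F ∷ 2F ∷ 7F ∷ 5F ∷ 6F ∷ [])) (
     branch 1F 4F (spanned (0F ∷ 1F ∷ 4F ∷ 3F ∷ 2F ∷ 7F ∷ 5F ∷ 6F ∷ [])) (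
     branch 2F 6F (spanned (0F ∷ 1F ∷ 2F ∷ 6F ∷ 5F ∷ 7F ∷ 2F ∷ 3F ∷ 4F ∷ [])) (
     branch 3F 6F (spanned (0F ∷ 1F ∷ 2F ∷ 7F ∷ 5F ∷ 4F ∷ 3F ∷ 6F ∷ [])) (
     branch 4F 6F (spanned (0F ∷ 1F ∷ 2F ∷ 3F ∷ 4F ∷ 6F ∷ 5F ∷ 7F ∷ [])) (
     low 6F 5F)))))) (low 7F 2F)))))))))) (
   branch 3F 7F (
    branch 0F 3F (spanned (6F ∷ 5F ∷ 4F ∷ 3F ∷ 2F ∷ 1F ∷ 0F ∷ 3F ∷ 7F ∷ [])) (
    branch 0F 4F (spanned (6F ∷ 5F ∷ 4F ∷ 0F ∷ 1F ∷ 2F ∷ 3F ∷ 7F ∷ [])) (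
    branch 0F 5F (spanned (6F ∷ 5F ∷ 4F ∷ 3F ∷ 2F ∷ 1F ∷ 0F ∷ 5F ∷ 4F ∷ 3F ∷ 7F ∷ [])) (
    branch 0F 6F (spanned (1F ∷ 2F ∷ 0F ∷ 6F ∷ 5F ∷ 4F ∷ 3F ∷ 7F ∷ [])) (
    branch 1F 3F (spanned (6F ∷ 5F ∷ 4F ∷ 3F ∷ 1F ∷ 0F ∷ 2F ∷ 3F ∷ 7F ∷ [])) (
    branch 1F 4F (spanned (6F ∷ 5F ∷ 4F ∷ 1F ∷ 0F ∷ 2F ∷ 3F ∷ 7F ∷ [])) (
    branch 1F 5F (spanned (6F ∷ 5F ∷ 1F ∷ 0F ∷ 2F ∷ 3F ∷ 4F ∷ 5F ∷ 1F ∷ 0F ∷ 2F ∷ 3F ∷ 7F ∷ [])) (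
    branch 1F 6F (spanned (0F ∷ 2F ∷ 1F ∷ 6F ∷ 5F ∷ 4F ∷ 3F ∷ 7F ∷ [])) (
    branch 2F 6F (spanned (0F ∷ 1F ∷ 2F ∷ 6F ∷ 5F ∷ 4F ∷ 3F ∷ 7F ∷ [])) (
    branch 3F 6F (spanned (1F ∷ 0F ∷ 2F ∷ 3F ∷ 6F ∷ 5F ∷ 4F ∷ 3F ∷ 7F ∷ [])) (
    branch 4F 7F (spanned (0F ∷ 1F ∷ 2F ∷ 3F ∷ 7F ∷ 4F ∷ 5F ∷ 6F ∷ [])) (
    branch 5F 7F (spanned (1F ∷ 0F ∷ 2F ∷ 3F ∷ 7F ∷ 5F ∷ 4F ∷ 3F ∷ 7F ∷ 5F ∷ 6F ∷ [])) (
    low 7F 3F))))))))))))) (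
   branch 4F 7F (
    branch 0F 5F (spanned (6F ∷ 5F ∷ 0F ∷ 1F ∷ 2F ∷ 3F ∷ 4F ∷ 7F ∷ [])) (
    branch 0F 6F (spanned (3F ∷ 2F ∷ 1F ∷ 0F ∷ 6F ∷ 5F ∷ 4F ∷ 7F ∷ [])) (
    branch 1F 5F (spanned (6F ∷ 5F ∷ 1F ∷ 0F ∷ 2F ∷ 3F ∷ 4F ∷ 7F ∷ [])) (
    branch 1F 6F (spanned (3F ∷ 2F ∷ 0F ∷ 1F ∷ 6F ∷ 5F ∷ 4F ∷ 7F ∷ [])) (
    branch 3F 6F (spanned (0F ∷ 1F ∷ 2F ∷ 3F ∷ 6F ∷ 5F ∷ 4F ∷ 7F ∷ [])) (
    branch 5F 7F (spanned (0F ∷ 1F ∷ 2F ∷ 3F ∷ 4F ∷ 7F ∷ 5F ∷ 6F ∷ [])) (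
    low 7F 4F))))))) (low 7F 5F))))) (
  branch 0F 3F (
   branch 1F 7F (spanned (6F ∷ 5F ∷ 4F ∷ 3F ∷ 2F ∷ 1F ∷ 0F ∷ 3F ∷ 2F ∷ 1F ∷ 7F ∷ [])) (
   branch 2F 7F (spanned (6F ∷ 5F ∷ 4F ∷ 3F ∷ 0F ∷ 1F ∷ 2F ∷ 7F ∷ [])) (
   branch 3F 7F (spanned (6F ∷ 5F ∷ 4F ∷ 3F ∷ 2F ∷ 1F ∷ 0F ∷ 3F ∷ 7F ∷ [])) (
   branch 4F 7F (
    branch 0F 5F (spanned (6F ∷ 5F ∷ 0F ∷ 1F ∷ 2F ∷ 3F ∷ 4F ∷ 7F ∷ [])) (
    branch 0F 6F (spanned (1F ∷ 2F ∷ 3F ∷ 0F ∷ 6F ∷ 5F ∷ 4F ∷ 7F ∷ [])) (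
    branch 1F 4F (spanned (6F ∷ 5F ∷ 4F ∷ 3F ∷ 2F ∷ 1F ∷ 0F ∷ 3F ∷ 2F ∷ 1F ∷ 4F ∷ 7F ∷ [])) (
    branch 1F 5F (spanned (6F ∷ 5F ∷ 1F ∷ 0F ∷ 3F ∷ 2F ∷ 1F ∷ 0F ∷ 3F ∷ 4F ∷ 7F ∷ [])) (
    branch 1F 6F (spanned (0F ∷ 3F ∷ 2F ∷ 1F ∷ 6F ∷ 5F ∷ 4F ∷ 7F ∷ [])) (
    branch 2F 5F (spanned (6F ∷ 5F ∷ 2F ∷ 1F ∷ 0F ∷ 3F ∷ 4F ∷ 7F ∷ [])) (
    branch 2F 6F (spanned (1F ∷ 0F ∷ 3F ∷ 2F ∷ 6F ∷ 5F ∷ 4F ∷ 7F ∷ [])) (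
    branch 3F 5F (spanned (6F ∷ 5F ∷ 3F ∷ 2F ∷ 1F ∷ 0F ∷ 3F ∷ 4F ∷ 7F ∷ [])) (
    branch 3F 6F (spanned (0F ∷ 1F ∷ 2F ∷ 3F ∷ 6F ∷ 5F ∷ 4F ∷ 7F ∷ [])) (
    branch 5F 7F (spanned (0F ∷ 1F ∷ 2F ∷ 3F ∷ 4F ∷ 7F ∷ 5F ∷ 6F ∷ [])) (
    low 7F 4F))))))))))) (low 7F 5F))))) (
  branch 0F 4F (
   branch 3F 7F (spanned (6F ∷ 5F ∷ 4F ∷ 0F ∷ 1F ∷ 2F ∷ 3F ∷ 7F ∷ [])) (
   branch 1F 7F (
    branch 0F 5F (spanned (6F ∷ 5F ∷ 0F ∷ 4F ∷ 3F ∷ 2F ∷ 1F ∷ 7F ∷ [])) (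
    branch 0F 6F (spanned (0F ∷ 6F ∷ 5F ∷ 4F ∷ 3F ∷ 2F ∷ 1F ∷ 7F ∷ [])) (
    branch 1F 6F (spanned (0F ∷ 1F ∷ 6F ∷ 5F ∷ 4F ∷ 3F ∷ 2F ∷ 1F ∷ 7F ∷ [])) (
    branch 2F 5F (spanned (6F ∷ 5F ∷ 2F ∷ 3F ∷ 4F ∷ 0F ∷ 1F ∷ 7F ∷ [])) (
    branch 2F 6F (spanned (3F ∷ 2F ∷ 6F ∷ 5F ∷ 4F ∷ 0F ∷ 1F ∷ 7F ∷ [])) (
    branch 2F 7F (spanned (0F ∷ 1F ∷ 7F ∷ 2F ∷ 3F ∷ 4F ∷ 5F ∷ 6F ∷ [])) (
    branch 3F 5F (spanned (6F ∷ 5F ∷ 3F ∷ 2F ∷ 1F ∷ 0F ∷ 4F ∷ 5F ∷ 3F ∷ 2F ∷ 1F ∷ 7F ∷ [])) (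
    branch 3F 6F (spanned (0F ∷ 4F ∷ 5F ∷ 6F ∷ 3F ∷ 2F ∷ 1F ∷ 7F ∷ [])) (
    branch 4F 7F (spanned (2F ∷ 3F ∷ 4F ∷ 7F ∷ 1F ∷ 0F ∷ 4F ∷ 5F ∷ 6F ∷ [])) (
    branch 5F 7F (spanned (0F ∷ 4F ∷ 3F ∷ 2F ∷ 1F ∷ 7F ∷ 5F ∷ 6F ∷ [])) (
    low 7F 1F))))))))))) (
   branch 2F 7F (
    branch 0F 5F (spanned (6F ∷ 5F ∷ 4F ∷ 3F ∷ 2F ∷ 1F ∷ 0F ∷ 5F ∷ 4F ∷ 3F ∷ 2F ∷ 7F ∷ [])) (
    branch 0F 6F (spanned (1F ∷ 0F ∷ 6F ∷ 5F ∷ 4F ∷ 3F ∷ 2F ∷ 7F ∷ [])) (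
    branch 1F 3F (spanned (6F ∷ 5F ∷ 4F ∷ 0F ∷ 1F ∷ 3F ∷ 2F ∷ 7F ∷ [])) (
    branch 1F 5F (spanned (6F ∷ 5F ∷ 1F ∷ 0F ∷ 4F ∷ 3F ∷ 2F ∷ 7F ∷ [])) (
    branch 1F 6F (spanned (0F ∷ 1F ∷ 6F ∷ 5F ∷ 4F ∷ 3F ∷ 2F ∷ 7F ∷ [])) (
    branch 2F 6F (spanned (3F ∷ 2F ∷ 1F ∷ 0F ∷ 4F ∷ 5F ∷ 6F ∷ 2F ∷ 7F ∷ [])) (
    branch 3F 5F (spanned (6F ∷ 5F ∷ 3F ∷ 4F ∷ 0F ∷ 1F ∷ 2F ∷ 7F ∷ [])) (
    branch 3F 6F (spanned (1F ∷ 0F ∷ 4F ∷ 5F ∷ 6F ∷ 3F ∷ 2F ∷ 7F ∷ [])) (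
    branch 4F 7F (spanned (1F ∷ 0F ∷ 4F ∷ 3F ∷ 2F ∷ 7F ∷ 4F ∷ 5F ∷ 6F ∷ [])) (
    branch 5F 7F (spanned (1F ∷ 0F ∷ 4F ∷ 3F ∷ 2F ∷ 7F ∷ 5F ∷ 6F ∷ [])) (
    low 7F 2F))))))))))) (
   branch 4F 7F (
    branch 0F 5F (spanned (6F ∷ 5F ∷ 0F ∷ 1F ∷ 2F ∷ 3F ∷ 4F ∷ 7F ∷ [])) (
    branch 0F 6F (spanned (3F ∷ 2F ∷ 1F ∷ 0F ∷ 6F ∷ 5F ∷ 4F ∷ 7F ∷ [])) (
    branch 1F 6F (spanned (0F ∷ 4F ∷ 3F ∷ 2F ∷ 1F ∷ 6F ∷ 5F ∷ 4F ∷ 7F ∷ [])) (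
    branch 2F 6F (spanned (3F ∷ 4F ∷ 5F ∷ 6F ∷ 2F ∷ 1F ∷ 0F ∷ 4F ∷ 7F ∷ [])) (
    branch 3F 5F (spanned (6F ∷ 5F ∷ 3F ∷ 2F ∷ 1F ∷ 0F ∷ 4F ∷ 7F ∷ [])) (
    branch 3F 6F (spanned (0F ∷ 1F ∷ 2F ∷ 3F ∷ 6F ∷ 5F ∷ 4F ∷ 7F ∷ [])) (
    branch 5F 7F (spanned (0F ∷ 1F ∷ 2F ∷ 3F ∷ 4F ∷ 7F ∷ 5F ∷ 6F ∷ [])) (
    low 7F 4F)))))))) (low 7F 5F))))) (
  branch 0F 5F (
   branch 1F 7F (spanned (6F ∷ 5F ∷ 4F ∷ 3F ∷ 2F ∷ 1F ∷ 0F ∷ 5F ∷ 4F ∷ 3F ∷ 2F ∷ 1F ∷ 7F ∷ [])) (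
   branch 2F 7F (spanned (6F ∷ 5F ∷ 4F ∷ 3F ∷ 2F ∷ 1F ∷ 0F ∷ 5F ∷ 4F ∷ 3F ∷ 2F ∷ 7F ∷ [])) (
   branch 3F 7F (spanned (6F ∷ 5F ∷ 4F ∷ 3F ∷ 2F ∷ 1F ∷ 0F ∷ 5F ∷ 4F ∷ 3F ∷ 7F ∷ [])) (
   branch 4F 7F (spanned (6F ∷ 5F ∷ 0F ∷ 1F ∷ 2F ∷ 3F ∷ 4F ∷ 7F ∷ [])) (
   low 7F 5F))))) (
  branch 0F 6F (
   branch 1F 7F (spanned (0F ∷ 6F ∷ 5F ∷ 4F ∷ 3F ∷ 2F ∷ 1F ∷ 7F ∷ [])) (
   branch 2F 7F (spanned (1F ∷ 0F ∷ 6F ∷ 5F ∷ 4F ∷ 3F ∷ 2F ∷ 7F ∷ [])) (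
   branch 3F 7F (spanned (2F ∷ 1F ∷ 0F ∷ 6F ∷ 5F ∷ 4F ∷ 3F ∷ 7F ∷ [])) (
   branch 4F 7F (spanned (3F ∷ 2F ∷ 1F ∷ 0F ∷ 6F ∷ 5F ∷ 4F ∷ 7F ∷ [])) (
   low 7F 5F))))) (low 0F 1F)))))))))

-- A longest path of `G₂` has six vertices and uses the edge between the two centres. It can be read
-- from either end, which accounts for two `isomorphic` leaves.
order₈-path₆ : Claim G₂ (spine 8 6)
order₈-path₆ = from-just (certify G₂ 6 (just order₈-path₇) (spine 8 6) (
  branch 0F 6F (longer (5F ∷ 4F ∷ 3F ∷ 2F ∷ 1F ∷ 0F ∷ 6F ∷ 7F ∷ [])) (
  branch 0F 7F (longer (5F ∷ 4F ∷ 3F ∷ 2F ∷ 1F ∷ 0F ∷ 7F ∷ 6F ∷ [])) (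
  branch 5F 6F (longer (0F ∷ 1F ∷ 2F ∷ 3F ∷ 4F ∷ 5F ∷ 6F ∷ 7F ∷ [])) (
  branch 5F 7F (longer (0F ∷ 1F ∷ 2F ∷ 3F ∷ 4F ∷ 5F ∷ 7F ∷ 6F ∷ [])) (
  branch 0F 2F (
   branch 1F 6F (longer (5F ∷ 4F ∷ 3F ∷ 2F ∷ 0F ∷ 1F ∷ 6F ∷ 7F ∷ [])) (
   branch 1F 7F (longer (5F ∷ 4F ∷ 3F ∷ 2F ∷ 0F ∷ 1F ∷ 7F ∷ 6F ∷ [])) (
   branch 0F 5F (
    branch 2F 6F (longer (1F ∷ 0F ∷ 5F ∷ 4F ∷ 3F ∷ 2F ∷ 6F ∷ 7F ∷ [])) (
    branch 2F 7F (longer (1F ∷ 0F ∷ 5F ∷ 4F ∷ 3F ∷ 2F ∷ 7F ∷ 6F ∷ [])) (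
    branch 3F 6F (longer (1F ∷ 2F ∷ 0F ∷ 5F ∷ 4F ∷ 3F ∷ 6F ∷ 7F ∷ [])) (
    branch 3F 7F (longer (1F ∷ 2F ∷ 0F ∷ 5F ∷ 4F ∷ 3F ∷ 7F ∷ 6F ∷ [])) (
    branch 4F 6F (longer (3F ∷ 2F ∷ 1F ∷ 0F ∷ 5F ∷ 4F ∷ 6F ∷ 7F ∷ [])) (
    low 6F 7F)))))) (
   branch 1F 5F (
    branch 2F 6F (longer (0F ∷ 1F ∷ 5F ∷ 4F ∷ 3F ∷ 2F ∷ 6F ∷ 7F ∷ [])) (
    branch 2F 7F (longer (0F ∷ 1F ∷ 5F ∷ 4F ∷ 3F ∷ 2F ∷ 7F ∷ 6F ∷ [])) (
    branch 3F 6F (longer (0F ∷ 2F ∷ 1F ∷ 5F ∷ 4F ∷ 3F ∷ 6F ∷ 7F ∷ [])) (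
    branch 3F 7F (longer (0F ∷ 2F ∷ 1F ∷ 5F ∷ 4F ∷ 3F ∷ 7F ∷ 6F ∷ [])) (
    branch 4F 6F (longer (3F ∷ 2F ∷ 0F ∷ 1F ∷ 5F ∷ 4F ∷ 6F ∷ 7F ∷ [])) (
    low 6F 7F)))))) (
   branch 2F 5F (
    branch 3F 6F (longer (0F ∷ 1F ∷ 2F ∷ 5F ∷ 4F ∷ 3F ∷ 6F ∷ 7F ∷ [])) (
    branch 3F 7F (longer (0F ∷ 1F ∷ 2F ∷ 5F ∷ 4F ∷ 3F ∷ 7F ∷ 6F ∷ [])) (
    branch 2F 6F (
     branch 0F 3F (longer (1F ∷ 0F ∷ 3F ∷ 4F ∷ 5F ∷ 2F ∷ 6F ∷ 7F ∷ [])) (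
     branch 1F 3F (longer (0F ∷ 1F ∷ 3F ∷ 4F ∷ 5F ∷ 2F ∷ 6F ∷ 7F ∷ [])) (
     branch 6F 7F (spanned (1F ∷ 0F ∷ 2F ∷ 5F ∷ 4F ∷ 3F ∷ 2F ∷ 6F ∷ 7F ∷ [])) (
     branch 2F 7F (
      branch 4F 6F (spanned (0F ∷ 1F ∷ 2F ∷ 5F ∷ 4F ∷ 3F ∷ 2F ∷ 6F ∷ 4F ∷ 3F ∷ 2F ∷ 7F ∷ [])) (
      low 6F 2F)) (low 7F 4F))))) (
    branch 4F 6F (
     branch 0F 3F (longer (1F ∷ 0F ∷ 3F ∷ 2F ∷ 5F ∷ 4F ∷ 6F ∷ 7F ∷ [])) (
     branch 1F 3F (longer (0F ∷ 1F ∷ 3F ∷ 2F ∷ 5F ∷ 4F ∷ 6F ∷ 7F ∷ [])) (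
     branch 3F 5F (longer (0F ∷ 1F ∷ 2F ∷ 3F ∷ 5F ∷ 4F ∷ 6F ∷ 7F ∷ [])) (
     branch 6F 7F (longer (0F ∷ 1F ∷ 2F ∷ 3F ∷ 4F ∷ 6F ∷ 7F ∷ 5F ∷ [])) (
     low 6F 4F))))) (low 6F 7F))))) (
   branch 3F 5F (
    branch 4F 6F (longer (0F ∷ 1F ∷ 2F ∷ 3F ∷ 5F ∷ 4F ∷ 6F ∷ 7F ∷ [])) (
    branch 4F 7F (longer (0F ∷ 1F ∷ 2F ∷ 3F ∷ 5F ∷ 4F ∷ 7F ∷ 6F ∷ [])) (
    branch 2F 6F (
     branch 0F 3F (longer (4F ∷ 5F ∷ 3F ∷ 0F ∷ 1F ∷ 2F ∷ 6F ∷ 7F ∷ [])) (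
     branch 0F 4F (longer (1F ∷ 0F ∷ 4F ∷ 5F ∷ 3F ∷ 2F ∷ 6F ∷ 7F ∷ [])) (
     branch 1F 3F (longer (4F ∷ 5F ∷ 3F ∷ 1F ∷ 0F ∷ 2F ∷ 6F ∷ 7F ∷ [])) (
     branch 1F 4F (longer (0F ∷ 1F ∷ 4F ∷ 5F ∷ 3F ∷ 2F ∷ 6F ∷ 7F ∷ [])) (
     branch 3F 6F (longer (0F ∷ 1F ∷ 2F ∷ 6F ∷ 3F ∷ 4F ∷ 5F ∷ 7F ∷ [])) (
     branch 6F 7F (
      branch 2F 4F (spanned (1F ∷ 0F ∷ 2F ∷ 3F ∷ 5F ∷ 4F ∷ 2F ∷ 6F ∷ 7F ∷ [])) (
      branch 3F 7F (longer (0F ∷ 1F ∷ 2F ∷ 6F ∷ 7F ∷ 3F ∷ 4F ∷ 5F ∷ [])) (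
      branch 2F 7F (isomorphic (4F ∷ 7F ∷ 3F ∷ 0F ∷ 1F ∷ 2F ∷ 5F ∷ 6F ∷ [])) (
      low 7F 6F)))) (low 6F 2F))))))) (
    branch 3F 6F (
     branch 0F 4F (longer (1F ∷ 2F ∷ 0F ∷ 4F ∷ 5F ∷ 3F ∷ 6F ∷ 7F ∷ [])) (
     branch 1F 4F (longer (0F ∷ 2F ∷ 1F ∷ 4F ∷ 5F ∷ 3F ∷ 6F ∷ 7F ∷ [])) (
     branch 2F 4F (longer (0F ∷ 1F ∷ 2F ∷ 4F ∷ 5F ∷ 3F ∷ 6F ∷ 7F ∷ [])) (
     branch 6F 7F (
      branch 0F 3F (spanned (5F ∷ 4F ∷ 3F ∷ 2F ∷ 1F ∷ 0F ∷ 3F ∷ 6F ∷ 7F ∷ [])) (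
      branch 1F 3F (spanned (5F ∷ 4F ∷ 3F ∷ 1F ∷ 0F ∷ 2F ∷ 3F ∷ 6F ∷ 7F ∷ [])) (
      branch 2F 7F (longer (0F ∷ 1F ∷ 2F ∷ 7F ∷ 6F ∷ 3F ∷ 4F ∷ 5F ∷ [])) (
      branch 3F 7F (isomorphic (1F ∷ 2F ∷ 0F ∷ 3F ∷ 4F ∷ 7F ∷ 5F ∷ 6F ∷ [])) (
      low 7F 6F))))) (low 6F 3F))))) (low 6F 7F))))) (low 5F 4F))))))) (
  branch 0F 3F (
   branch 2F 6F (longer (5F ∷ 4F ∷ 3F ∷ 0F ∷ 1F ∷ 2F ∷ 6F ∷ 7F ∷ [])) (
   branch 2F 7F (longer (5F ∷ 4F ∷ 3F ∷ 0F ∷ 1F ∷ 2F ∷ 7F ∷ 6F ∷ [])) (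
   branch 0F 5F (
    branch 1F 6F (longer (0F ∷ 5F ∷ 4F ∷ 3F ∷ 2F ∷ 1F ∷ 6F ∷ 7F ∷ [])) (
    branch 1F 7F (longer (0F ∷ 5F ∷ 4F ∷ 3F ∷ 2F ∷ 1F ∷ 7F ∷ 6F ∷ [])) (
    branch 3F 6F (longer (2F ∷ 1F ∷ 0F ∷ 5F ∷ 4F ∷ 3F ∷ 6F ∷ 7F ∷ [])) (
    branch 3F 7F (longer (2F ∷ 1F ∷ 0F ∷ 5F ∷ 4F ∷ 3F ∷ 7F ∷ 6F ∷ [])) (
    branch 4F 6F (longer (1F ∷ 2F ∷ 3F ∷ 0F ∷ 5F ∷ 4F ∷ 6F ∷ 7F ∷ [])) (
    low 6F 7F)))))) (
   branch 1F 5F (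
    branch 4F 6F (longer (0F ∷ 3F ∷ 2F ∷ 1F ∷ 5F ∷ 4F ∷ 6F ∷ 7F ∷ [])) (
    branch 4F 7F (longer (0F ∷ 3F ∷ 2F ∷ 1F ∷ 5F ∷ 4F ∷ 7F ∷ 6F ∷ [])) (
    branch 1F 6F (
     branch 0F 4F (longer (2F ∷ 3F ∷ 0F ∷ 4F ∷ 5F ∷ 1F ∷ 6F ∷ 7F ∷ [])) (
     branch 2F 4F (longer (0F ∷ 3F ∷ 2F ∷ 4F ∷ 5F ∷ 1F ∷ 6F ∷ 7F ∷ [])) (
     branch 2F 5F (longer (0F ∷ 3F ∷ 4F ∷ 5F ∷ 2F ∷ 1F ∷ 6F ∷ 7F ∷ [])) (
     branch 6F 7F (longer (0F ∷ 3F ∷ 4F ∷ 5F ∷ 1F ∷ 6F ∷ 7F ∷ 2F ∷ [])) (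
     branch 1F 7F (
      branch 3F 6F (spanned (4F ∷ 5F ∷ 1F ∷ 0F ∷ 3F ∷ 2F ∷ 1F ∷ 6F ∷ 3F ∷ 2F ∷ 1F ∷ 7F ∷ [])) (
      low 6F 1F)) (low 7F 3F)))))) (
    branch 3F 6F (
     branch 0F 4F (longer (0F ∷ 4F ∷ 5F ∷ 1F ∷ 2F ∷ 3F ∷ 6F ∷ 7F ∷ [])) (
     branch 2F 4F (longer (0F ∷ 1F ∷ 5F ∷ 4F ∷ 2F ∷ 3F ∷ 6F ∷ 7F ∷ [])) (
     branch 2F 5F (longer (0F ∷ 1F ∷ 2F ∷ 5F ∷ 4F ∷ 3F ∷ 6F ∷ 7F ∷ [])) (
     branch 6F 7F (longer (0F ∷ 1F ∷ 5F ∷ 4F ∷ 3F ∷ 6F ∷ 7F ∷ 2F ∷ [])) (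
     low 6F 3F))))) (low 6F 7F))))) (
   branch 2F 5F (
    branch 1F 6F (longer (0F ∷ 3F ∷ 4F ∷ 5F ∷ 2F ∷ 1F ∷ 6F ∷ 7F ∷ [])) (
    branch 1F 7F (longer (0F ∷ 3F ∷ 4F ∷ 5F ∷ 2F ∷ 1F ∷ 7F ∷ 6F ∷ [])) (
    branch 3F 6F (longer (0F ∷ 1F ∷ 2F ∷ 5F ∷ 4F ∷ 3F ∷ 6F ∷ 7F ∷ [])) (
    branch 3F 7F (longer (0F ∷ 1F ∷ 2F ∷ 5F ∷ 4F ∷ 3F ∷ 7F ∷ 6F ∷ [])) (
    branch 4F 6F (longer (1F ∷ 0F ∷ 3F ∷ 2F ∷ 5F ∷ 4F ∷ 6F ∷ 7F ∷ [])) (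
    low 6F 7F)))))) (
   branch 3F 5F (
    branch 4F 6F (longer (0F ∷ 1F ∷ 2F ∷ 3F ∷ 5F ∷ 4F ∷ 6F ∷ 7F ∷ [])) (
    branch 4F 7F (longer (0F ∷ 1F ∷ 2F ∷ 3F ∷ 5F ∷ 4F ∷ 7F ∷ 6F ∷ [])) (
    branch 1F 6F (
     branch 0F 4F (longer (0F ∷ 4F ∷ 5F ∷ 3F ∷ 2F ∷ 1F ∷ 6F ∷ 7F ∷ [])) (
     branch 2F 4F (longer (0F ∷ 3F ∷ 5F ∷ 4F ∷ 2F ∷ 1F ∷ 6F ∷ 7F ∷ [])) (
     branch 6F 7F (longer (4F ∷ 5F ∷ 3F ∷ 0F ∷ 1F ∷ 6F ∷ 7F ∷ 2F ∷ [])) (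
     branch 1F 7F (
      branch 3F 6F (spanned (4F ∷ 5F ∷ 3F ∷ 2F ∷ 1F ∷ 0F ∷ 3F ∷ 2F ∷ 1F ∷ 6F ∷ 3F ∷ 2F ∷ 1F ∷ 7F ∷ [])) (
      low 6F 1F)) (low 7F 3F))))) (
    branch 3F 6F (
     branch 0F 4F (longer (2F ∷ 1F ∷ 0F ∷ 4F ∷ 5F ∷ 3F ∷ 6F ∷ 7F ∷ [])) (
     branch 2F 4F (longer (0F ∷ 1F ∷ 2F ∷ 4F ∷ 5F ∷ 3F ∷ 6F ∷ 7F ∷ [])) (
     branch 6F 7F (spanned (5F ∷ 4F ∷ 3F ∷ 2F ∷ 1F ∷ 0F ∷ 3F ∷ 6F ∷ 7F ∷ [])) (
     low 6F 3F)))) (low 6F 7F))))) (low 5F 4F))))))) (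
  branch 0F 4F (
   branch 3F 6F (longer (5F ∷ 4F ∷ 0F ∷ 1F ∷ 2F ∷ 3F ∷ 6F ∷ 7F ∷ [])) (
   branch 3F 7F (longer (5F ∷ 4F ∷ 0F ∷ 1F ∷ 2F ∷ 3F ∷ 7F ∷ 6F ∷ [])) (
   branch 0F 5F (
    branch 1F 6F (longer (0F ∷ 5F ∷ 4F ∷ 3F ∷ 2F ∷ 1F ∷ 6F ∷ 7F ∷ [])) (
    branch 1F 7F (longer (0F ∷ 5F ∷ 4F ∷ 3F ∷ 2F ∷ 1F ∷ 7F ∷ 6F ∷ [])) (
    branch 2F 6F (longer (1F ∷ 0F ∷ 5F ∷ 4F ∷ 3F ∷ 2F ∷ 6F ∷ 7F ∷ [])) (
    branch 2F 7F (longer (1F ∷ 0F ∷ 5F ∷ 4F ∷ 3F ∷ 2F ∷ 7F ∷ 6F ∷ [])) (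
    branch 4F 6F (longer (3F ∷ 2F ∷ 1F ∷ 0F ∷ 5F ∷ 4F ∷ 6F ∷ 7F ∷ [])) (
    low 6F 7F)))))) (
   branch 1F 5F (
    branch 2F 6F (longer (0F ∷ 1F ∷ 5F ∷ 4F ∷ 3F ∷ 2F ∷ 6F ∷ 7F ∷ [])) (
    branch 2F 7F (longer (0F ∷ 1F ∷ 5F ∷ 4F ∷ 3F ∷ 2F ∷ 7F ∷ 6F ∷ [])) (
    branch 1F 6F (
     branch 2F 5F (longer (0F ∷ 4F ∷ 3F ∷ 2F ∷ 5F ∷ 1F ∷ 6F ∷ 7F ∷ [])) (
     branch 3F 5F (longer (0F ∷ 4F ∷ 5F ∷ 3F ∷ 2F ∷ 1F ∷ 6F ∷ 7F ∷ [])) (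
     branch 6F 7F (longer (0F ∷ 4F ∷ 3F ∷ 2F ∷ 1F ∷ 6F ∷ 7F ∷ 5F ∷ [])) (
     branch 1F 7F (
      branch 4F 6F (spanned (3F ∷ 2F ∷ 1F ∷ 0F ∷ 4F ∷ 5F ∷ 1F ∷ 6F ∷ 4F ∷ 5F ∷ 1F ∷ 7F ∷ [])) (
      low 6F 1F)) (low 7F 4F))))) (
    branch 4F 6F (
     branch 2F 5F (longer (0F ∷ 1F ∷ 5F ∷ 2F ∷ 3F ∷ 4F ∷ 6F ∷ 7F ∷ [])) (
     branch 3F 5F (longer (0F ∷ 1F ∷ 2F ∷ 3F ∷ 5F ∷ 4F ∷ 6F ∷ 7F ∷ [])) (
     branch 6F 7F (longer (0F ∷ 1F ∷ 2F ∷ 3F ∷ 4F ∷ 6F ∷ 7F ∷ 5F ∷ [])) (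
     low 6F 4F)))) (low 6F 7F))))) (
   branch 2F 5F (
    branch 1F 6F (longer (3F ∷ 2F ∷ 5F ∷ 4F ∷ 0F ∷ 1F ∷ 6F ∷ 7F ∷ [])) (
    branch 1F 7F (longer (3F ∷ 2F ∷ 5F ∷ 4F ∷ 0F ∷ 1F ∷ 7F ∷ 6F ∷ [])) (
    branch 2F 6F (
     branch 1F 3F (longer (0F ∷ 1F ∷ 3F ∷ 4F ∷ 5F ∷ 2F ∷ 6F ∷ 7F ∷ [])) (
     branch 3F 5F (longer (1F ∷ 0F ∷ 4F ∷ 3F ∷ 5F ∷ 2F ∷ 6F ∷ 7F ∷ [])) (
     branch 6F 7F (longer (1F ∷ 0F ∷ 4F ∷ 3F ∷ 2F ∷ 6F ∷ 7F ∷ 5F ∷ [])) (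
     branch 2F 7F (
      branch 4F 6F (spanned (0F ∷ 1F ∷ 2F ∷ 5F ∷ 4F ∷ 3F ∷ 2F ∷ 6F ∷ 4F ∷ 3F ∷ 2F ∷ 7F ∷ [])) (
      low 6F 2F)) (low 7F 4F))))) (
    branch 4F 6F (
     branch 1F 3F (longer (0F ∷ 1F ∷ 3F ∷ 2F ∷ 5F ∷ 4F ∷ 6F ∷ 7F ∷ [])) (
     branch 3F 5F (longer (0F ∷ 1F ∷ 2F ∷ 3F ∷ 5F ∷ 4F ∷ 6F ∷ 7F ∷ [])) (
     branch 6F 7F (longer (0F ∷ 1F ∷ 2F ∷ 3F ∷ 4F ∷ 6F ∷ 7F ∷ 5F ∷ [])) (
     low 6F 4F)))) (low 6F 7F))))) (
   branch 3F 5F (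
    branch 1F 6F (longer (0F ∷ 4F ∷ 5F ∷ 3F ∷ 2F ∷ 1F ∷ 6F ∷ 7F ∷ [])) (
    branch 1F 7F (longer (0F ∷ 4F ∷ 5F ∷ 3F ∷ 2F ∷ 1F ∷ 7F ∷ 6F ∷ [])) (
    branch 2F 6F (longer (1F ∷ 0F ∷ 4F ∷ 5F ∷ 3F ∷ 2F ∷ 6F ∷ 7F ∷ [])) (
    branch 2F 7F (longer (1F ∷ 0F ∷ 4F ∷ 5F ∷ 3F ∷ 2F ∷ 7F ∷ 6F ∷ [])) (
    branch 4F 6F (longer (0F ∷ 1F ∷ 2F ∷ 3F ∷ 5F ∷ 4F ∷ 6F ∷ 7F ∷ [])) (
    low 6F 7F)))))) (low 5F 4F))))))) (
  branch 0F 5F (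
   branch 1F 6F (longer (0F ∷ 5F ∷ 4F ∷ 3F ∷ 2F ∷ 1F ∷ 6F ∷ 7F ∷ [])) (
   branch 1F 7F (longer (0F ∷ 5F ∷ 4F ∷ 3F ∷ 2F ∷ 1F ∷ 7F ∷ 6F ∷ [])) (
   branch 2F 6F (longer (1F ∷ 0F ∷ 5F ∷ 4F ∷ 3F ∷ 2F ∷ 6F ∷ 7F ∷ [])) (
   branch 2F 7F (longer (1F ∷ 0F ∷ 5F ∷ 4F ∷ 3F ∷ 2F ∷ 7F ∷ 6F ∷ [])) (
   branch 3F 6F (longer (2F ∷ 1F ∷ 0F ∷ 5F ∷ 4F ∷ 3F ∷ 6F ∷ 7F ∷ [])) (
   branch 3F 7F (longer (2F ∷ 1F ∷ 0F ∷ 5F ∷ 4F ∷ 3F ∷ 7F ∷ 6F ∷ [])) (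
   branch 4F 6F (longer (3F ∷ 2F ∷ 1F ∷ 0F ∷ 5F ∷ 4F ∷ 6F ∷ 7F ∷ [])) (
   low 6F 7F)))))))) (low 0F 1F))))))))))

order₈-path₅ : Claim G₂ (spine 8 5)
order₈-path₅ = from-just (certify G₂ 5 (just order₈-path₆) (spine 8 5) (
  branch 0F 5F (longer (4F ∷ 3F ∷ 2F ∷ 1F ∷ 0F ∷ 5F ∷ 6F ∷ 7F ∷ [])) (
  branch 0F 6F (longer (4F ∷ 3F ∷ 2F ∷ 1F ∷ 0F ∷ 6F ∷ 5F ∷ 7F ∷ [])) (
  branch 0F 7F (longer (4F ∷ 3F ∷ 2F ∷ 1F ∷ 0F ∷ 7F ∷ 5F ∷ 6F ∷ [])) (
  branch 4F 5F (longer (0F ∷ 1F ∷ 2F ∷ 3F ∷ 4F ∷ 5F ∷ 6F ∷ 7F ∷ [])) (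
  branch 4F 6F (longer (0F ∷ 1F ∷ 2F ∷ 3F ∷ 4F ∷ 6F ∷ 5F ∷ 7F ∷ [])) (
  branch 4F 7F (longer (0F ∷ 1F ∷ 2F ∷ 3F ∷ 4F ∷ 7F ∷ 5F ∷ 6F ∷ [])) (
  branch 0F 2F (
   branch 1F 5F (longer (4F ∷ 3F ∷ 2F ∷ 0F ∷ 1F ∷ 5F ∷ 6F ∷ 7F ∷ [])) (
   branch 1F 6F (longer (4F ∷ 3F ∷ 2F ∷ 0F ∷ 1F ∷ 6F ∷ 5F ∷ 7F ∷ [])) (
   branch 1F 7F (longer (4F ∷ 3F ∷ 2F ∷ 0F ∷ 1F ∷ 7F ∷ 5F ∷ 6F ∷ [])) (
   branch 0F 4F (
    branch 2F 5F (longer (1F ∷ 0F ∷ 4F ∷ 3F ∷ 2F ∷ 5F ∷ 6F ∷ 7F ∷ [])) (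
    branch 2F 6F (longer (1F ∷ 0F ∷ 4F ∷ 3F ∷ 2F ∷ 6F ∷ 5F ∷ 7F ∷ [])) (
    branch 2F 7F (longer (1F ∷ 0F ∷ 4F ∷ 3F ∷ 2F ∷ 7F ∷ 5F ∷ 6F ∷ [])) (
    branch 3F 5F (longer (1F ∷ 2F ∷ 0F ∷ 4F ∷ 3F ∷ 5F ∷ 6F ∷ 7F ∷ [])) (
    branch 3F 6F (longer (1F ∷ 2F ∷ 0F ∷ 4F ∷ 3F ∷ 6F ∷ 5F ∷ 7F ∷ [])) (
    branch 3F 7F (longer (1F ∷ 2F ∷ 0F ∷ 4F ∷ 3F ∷ 7F ∷ 5F ∷ 6F ∷ [])) (
    apart (true ∷ true ∷ true ∷ true ∷ true ∷ false ∷ false ∷ false ∷ [])))))))) (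
   branch 1F 4F (
    branch 2F 5F (longer (0F ∷ 1F ∷ 4F ∷ 3F ∷ 2F ∷ 5F ∷ 6F ∷ 7F ∷ [])) (
    branch 2F 6F (longer (0F ∷ 1F ∷ 4F ∷ 3F ∷ 2F ∷ 6F ∷ 5F ∷ 7F ∷ [])) (
    branch 2F 7F (longer (0F ∷ 1F ∷ 4F ∷ 3F ∷ 2F ∷ 7F ∷ 5F ∷ 6F ∷ [])) (
    branch 3F 5F (longer (0F ∷ 2F ∷ 1F ∷ 4F ∷ 3F ∷ 5F ∷ 6F ∷ 7F ∷ [])) (
    branch 3F 6F (longer (0F ∷ 2F ∷ 1F ∷ 4F ∷ 3F ∷ 6F ∷ 5F ∷ 7F ∷ [])) (
    branch 3F 7F (longer (0F ∷ 2F ∷ 1F ∷ 4F ∷ 3F ∷ 7F ∷ 5F ∷ 6F ∷ [])) (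
    apart (true ∷ true ∷ true ∷ true ∷ true ∷ false ∷ false ∷ false ∷ [])))))))) (
   branch 2F 4F (
    branch 3F 5F (longer (0F ∷ 1F ∷ 2F ∷ 4F ∷ 3F ∷ 5F ∷ 6F ∷ 7F ∷ [])) (
    branch 3F 6F (longer (0F ∷ 1F ∷ 2F ∷ 4F ∷ 3F ∷ 6F ∷ 5F ∷ 7F ∷ [])) (
    branch 3F 7F (longer (0F ∷ 1F ∷ 2F ∷ 4F ∷ 3F ∷ 7F ∷ 5F ∷ 6F ∷ [])) (
    branch 2F 5F (
     branch 0F 3F (longer (1F ∷ 0F ∷ 3F ∷ 4F ∷ 2F ∷ 5F ∷ 6F ∷ 7F ∷ [])) (
     branch 1F 3F (longer (0F ∷ 1F ∷ 3F ∷ 4F ∷ 2F ∷ 5F ∷ 6F ∷ 7F ∷ [])) (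
     branch 5F 6F (
      branch 6F 7F (longer (0F ∷ 1F ∷ 2F ∷ 5F ∷ 6F ∷ 7F ∷ 3F ∷ 4F ∷ [])) (
      branch 2F 6F (
       branch 5F 7F (longer (0F ∷ 1F ∷ 2F ∷ 6F ∷ 5F ∷ 7F ∷ 3F ∷ 4F ∷ [])) (
       low 7F 2F)) (low 6F 5F))) (
     branch 2F 6F (
      branch 5F 7F (
       branch 6F 7F (longer (0F ∷ 1F ∷ 2F ∷ 5F ∷ 7F ∷ 6F ∷ 3F ∷ 4F ∷ [])) (
       low 6F 2F)) (low 5F 2F)) (low 6F 7F))))) (
    branch 5F 6F (
     branch 5F 7F (
      branch 2F 6F (longer (0F ∷ 1F ∷ 2F ∷ 6F ∷ 5F ∷ 7F ∷ 3F ∷ 4F ∷ [])) (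
      branch 2F 7F (longer (0F ∷ 1F ∷ 2F ∷ 7F ∷ 5F ∷ 6F ∷ 3F ∷ 4F ∷ [])) (
      apart (true ∷ true ∷ true ∷ true ∷ true ∷ false ∷ false ∷ false ∷ [])))) (low 5F 6F)) (low 5F 7F)))))) (low 4F 3F))))))) (
  branch 0F 3F (
   branch 2F 5F (longer (4F ∷ 3F ∷ 0F ∷ 1F ∷ 2F ∷ 5F ∷ 6F ∷ 7F ∷ [])) (
   branch 2F 6F (longer (4F ∷ 3F ∷ 0F ∷ 1F ∷ 2F ∷ 6F ∷ 5F ∷ 7F ∷ [])) (
   branch 2F 7F (longer (4F ∷ 3F ∷ 0F ∷ 1F ∷ 2F ∷ 7F ∷ 5F ∷ 6F ∷ [])) (
   branch 0F 4F (
    branch 1F 5F (longer (0F ∷ 4F ∷ 3F ∷ 2F ∷ 1F ∷ 5F ∷ 6F ∷ 7F ∷ [])) (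
    branch 1F 6F (longer (0F ∷ 4F ∷ 3F ∷ 2F ∷ 1F ∷ 6F ∷ 5F ∷ 7F ∷ [])) (
    branch 1F 7F (longer (0F ∷ 4F ∷ 3F ∷ 2F ∷ 1F ∷ 7F ∷ 5F ∷ 6F ∷ [])) (
    branch 3F 5F (longer (2F ∷ 1F ∷ 0F ∷ 4F ∷ 3F ∷ 5F ∷ 6F ∷ 7F ∷ [])) (
    branch 3F 6F (longer (2F ∷ 1F ∷ 0F ∷ 4F ∷ 3F ∷ 6F ∷ 5F ∷ 7F ∷ [])) (
    branch 3F 7F (longer (2F ∷ 1F ∷ 0F ∷ 4F ∷ 3F ∷ 7F ∷ 5F ∷ 6F ∷ [])) (
    apart (true ∷ true ∷ true ∷ true ∷ true ∷ false ∷ false ∷ false ∷ [])))))))) (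
   branch 1F 4F (
    branch 1F 5F (
     branch 2F 4F (longer (0F ∷ 3F ∷ 2F ∷ 4F ∷ 1F ∷ 5F ∷ 6F ∷ 7F ∷ [])) (
     branch 5F 6F (longer (0F ∷ 3F ∷ 2F ∷ 1F ∷ 5F ∷ 6F ∷ 4F ∷ 7F ∷ [])) (
     branch 5F 7F (longer (0F ∷ 3F ∷ 2F ∷ 1F ∷ 5F ∷ 7F ∷ 4F ∷ 6F ∷ [])) (
     branch 3F 5F (
      branch 1F 6F (
       branch 1F 7F (spanned (6F ∷ 1F ∷ 0F ∷ 3F ∷ 2F ∷ 1F ∷ 4F ∷ 3F ∷ 5F ∷ 1F ∷ 7F ∷ [])) (
       branch 3F 7F (spanned (6F ∷ 1F ∷ 0F ∷ 3F ∷ 2F ∷ 1F ∷ 0F ∷ 3F ∷ 5F ∷ 1F ∷ 4F ∷ 3F ∷ 7F ∷ [])) (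
       low 7F 6F))) (
      branch 3F 6F (
       branch 1F 7F (spanned (6F ∷ 3F ∷ 2F ∷ 1F ∷ 0F ∷ 3F ∷ 2F ∷ 1F ∷ 4F ∷ 3F ∷ 5F ∷ 1F ∷ 7F ∷ [])) (
       branch 3F 7F (spanned (6F ∷ 3F ∷ 2F ∷ 1F ∷ 0F ∷ 3F ∷ 5F ∷ 1F ∷ 4F ∷ 3F ∷ 7F ∷ [])) (
       low 7F 6F))) (low 6F 7F))) (low 5F 1F))))) (
    branch 3F 5F (
     branch 2F 4F (longer (0F ∷ 1F ∷ 2F ∷ 4F ∷ 3F ∷ 5F ∷ 6F ∷ 7F ∷ [])) (
     branch 5F 6F (longer (0F ∷ 1F ∷ 2F ∷ 3F ∷ 5F ∷ 6F ∷ 4F ∷ 7F ∷ [])) (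
     branch 5F 7F (longer (0F ∷ 1F ∷ 2F ∷ 3F ∷ 5F ∷ 7F ∷ 4F ∷ 6F ∷ [])) (
     low 5F 3F)))) (
    branch 5F 6F (
     branch 1F 6F (longer (0F ∷ 3F ∷ 2F ∷ 1F ∷ 6F ∷ 5F ∷ 4F ∷ 7F ∷ [])) (
     branch 3F 6F (longer (0F ∷ 1F ∷ 2F ∷ 3F ∷ 6F ∷ 5F ∷ 4F ∷ 7F ∷ [])) (
     branch 5F 7F (
      branch 1F 7F (longer (0F ∷ 3F ∷ 2F ∷ 1F ∷ 7F ∷ 5F ∷ 4F ∷ 6F ∷ [])) (
      branch 3F 7F (longer (0F ∷ 1F ∷ 2F ∷ 3F ∷ 7F ∷ 5F ∷ 4F ∷ 6F ∷ [])) (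
      apart (true ∷ true ∷ true ∷ true ∷ true ∷ false ∷ false ∷ false ∷ [])))) (low 5F 6F)))) (low 5F 7F)))) (
   branch 2F 4F (
    branch 1F 5F (longer (0F ∷ 3F ∷ 4F ∷ 2F ∷ 1F ∷ 5F ∷ 6F ∷ 7F ∷ [])) (
    branch 1F 6F (longer (0F ∷ 3F ∷ 4F ∷ 2F ∷ 1F ∷ 6F ∷ 5F ∷ 7F ∷ [])) (
    branch 1F 7F (longer (0F ∷ 3F ∷ 4F ∷ 2F ∷ 1F ∷ 7F ∷ 5F ∷ 6F ∷ [])) (
    branch 3F 5F (longer (0F ∷ 1F ∷ 2F ∷ 4F ∷ 3F ∷ 5F ∷ 6F ∷ 7F ∷ [])) (
    branch 3F 6F (longer (0F ∷ 1F ∷ 2F ∷ 4F ∷ 3F ∷ 6F ∷ 5F ∷ 7F ∷ [])) (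
    branch 3F 7F (longer (0F ∷ 1F ∷ 2F ∷ 4F ∷ 3F ∷ 7F ∷ 5F ∷ 6F ∷ [])) (
    apart (true ∷ true ∷ true ∷ true ∷ true ∷ false ∷ false ∷ false ∷ [])))))))) (low 4F 3F))))))) (
  branch 0F 4F (
   branch 1F 5F (longer (0F ∷ 4F ∷ 3F ∷ 2F ∷ 1F ∷ 5F ∷ 6F ∷ 7F ∷ [])) (
   branch 1F 6F (longer (0F ∷ 4F ∷ 3F ∷ 2F ∷ 1F ∷ 6F ∷ 5F ∷ 7F ∷ [])) (
   branch 1F 7F (longer (0F ∷ 4F ∷ 3F ∷ 2F ∷ 1F ∷ 7F ∷ 5F ∷ 6F ∷ [])) (
   branch 2F 5F (longer (1F ∷ 0F ∷ 4F ∷ 3F ∷ 2F ∷ 5F ∷ 6F ∷ 7F ∷ [])) (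
   branch 2F 6F (longer (1F ∷ 0F ∷ 4F ∷ 3F ∷ 2F ∷ 6F ∷ 5F ∷ 7F ∷ [])) (
   branch 2F 7F (longer (1F ∷ 0F ∷ 4F ∷ 3F ∷ 2F ∷ 7F ∷ 5F ∷ 6F ∷ [])) (
   branch 3F 5F (longer (2F ∷ 1F ∷ 0F ∷ 4F ∷ 3F ∷ 5F ∷ 6F ∷ 7F ∷ [])) (
   branch 3F 6F (longer (2F ∷ 1F ∷ 0F ∷ 4F ∷ 3F ∷ 6F ∷ 5F ∷ 7F ∷ [])) (
   branch 3F 7F (longer (2F ∷ 1F ∷ 0F ∷ 4F ∷ 3F ∷ 7F ∷ 5F ∷ 6F ∷ [])) (
   apart (true ∷ true ∷ true ∷ true ∷ true ∷ false ∷ false ∷ false ∷ []))))))))))) (low 0F 1F)))))))))))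

order₈-path₄ : Claim G₂ (spine 8 4)
order₈-path₄ = from-just (certify G₂ 4 (just order₈-path₅) (spine 8 4) (
  branch 0F 4F (longer (3F ∷ 2F ∷ 1F ∷ 0F ∷ 4F ∷ 5F ∷ 6F ∷ 7F ∷ [])) (
  branch 0F 5F (longer (3F ∷ 2F ∷ 1F ∷ 0F ∷ 5F ∷ 4F ∷ 6F ∷ 7F ∷ [])) (
  branch 0F 6F (longer (3F ∷ 2F ∷ 1F ∷ 0F ∷ 6F ∷ 4F ∷ 5F ∷ 7F ∷ [])) (
  branch 0F 7F (longer (3F ∷ 2F ∷ 1F ∷ 0F ∷ 7F ∷ 4F ∷ 5F ∷ 6F ∷ [])) (
  branch 3F 4F (longer (0F ∷ 1F ∷ 2F ∷ 3F ∷ 4F ∷ 5F ∷ 6F ∷ 7F ∷ [])) (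
  branch 3F 5F (longer (0F ∷ 1F ∷ 2F ∷ 3F ∷ 5F ∷ 4F ∷ 6F ∷ 7F ∷ [])) (
  branch 3F 6F (longer (0F ∷ 1F ∷ 2F ∷ 3F ∷ 6F ∷ 4F ∷ 5F ∷ 7F ∷ [])) (
  branch 3F 7F (longer (0F ∷ 1F ∷ 2F ∷ 3F ∷ 7F ∷ 4F ∷ 5F ∷ 6F ∷ [])) (
  branch 0F 2F (
   branch 1F 4F (longer (3F ∷ 2F ∷ 0F ∷ 1F ∷ 4F ∷ 5F ∷ 6F ∷ 7F ∷ [])) (
   branch 1F 5F (longer (3F ∷ 2F ∷ 0F ∷ 1F ∷ 5F ∷ 4F ∷ 6F ∷ 7F ∷ [])) (
   branch 1F 6F (longer (3F ∷ 2F ∷ 0F ∷ 1F ∷ 6F ∷ 4F ∷ 5F ∷ 7F ∷ [])) (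
   branch 1F 7F (longer (3F ∷ 2F ∷ 0F ∷ 1F ∷ 7F ∷ 4F ∷ 5F ∷ 6F ∷ [])) (
   branch 0F 3F (
    branch 2F 4F (longer (1F ∷ 0F ∷ 3F ∷ 2F ∷ 4F ∷ 5F ∷ 6F ∷ 7F ∷ [])) (
    branch 2F 5F (longer (1F ∷ 0F ∷ 3F ∷ 2F ∷ 5F ∷ 4F ∷ 6F ∷ 7F ∷ [])) (
    branch 2F 6F (longer (1F ∷ 0F ∷ 3F ∷ 2F ∷ 6F ∷ 4F ∷ 5F ∷ 7F ∷ [])) (
    branch 2F 7F (longer (1F ∷ 0F ∷ 3F ∷ 2F ∷ 7F ∷ 4F ∷ 5F ∷ 6F ∷ [])) (
    apart (true ∷ true ∷ true ∷ true ∷ false ∷ false ∷ false ∷ false ∷ [])))))) (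
   branch 1F 3F (
    branch 2F 4F (longer (0F ∷ 1F ∷ 3F ∷ 2F ∷ 4F ∷ 5F ∷ 6F ∷ 7F ∷ [])) (
    branch 2F 5F (longer (0F ∷ 1F ∷ 3F ∷ 2F ∷ 5F ∷ 4F ∷ 6F ∷ 7F ∷ [])) (
    branch 2F 6F (longer (0F ∷ 1F ∷ 3F ∷ 2F ∷ 6F ∷ 4F ∷ 5F ∷ 7F ∷ [])) (
    branch 2F 7F (longer (0F ∷ 1F ∷ 3F ∷ 2F ∷ 7F ∷ 4F ∷ 5F ∷ 6F ∷ [])) (
    apart (true ∷ true ∷ true ∷ true ∷ false ∷ false ∷ false ∷ false ∷ [])))))) (low 3F 2F))))))) (
  branch 0F 3F (
   branch 1F 4F (longer (0F ∷ 3F ∷ 2F ∷ 1F ∷ 4F ∷ 5F ∷ 6F ∷ 7F ∷ [])) (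
   branch 1F 5F (longer (0F ∷ 3F ∷ 2F ∷ 1F ∷ 5F ∷ 4F ∷ 6F ∷ 7F ∷ [])) (
   branch 1F 6F (longer (0F ∷ 3F ∷ 2F ∷ 1F ∷ 6F ∷ 4F ∷ 5F ∷ 7F ∷ [])) (
   branch 1F 7F (longer (0F ∷ 3F ∷ 2F ∷ 1F ∷ 7F ∷ 4F ∷ 5F ∷ 6F ∷ [])) (
   branch 2F 4F (longer (1F ∷ 0F ∷ 3F ∷ 2F ∷ 4F ∷ 5F ∷ 6F ∷ 7F ∷ [])) (
   branch 2F 5F (longer (1F ∷ 0F ∷ 3F ∷ 2F ∷ 5F ∷ 4F ∷ 6F ∷ 7F ∷ [])) (
   branch 2F 6F (longer (1F ∷ 0F ∷ 3F ∷ 2F ∷ 6F ∷ 4F ∷ 5F ∷ 7F ∷ [])) (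
   branch 2F 7F (longer (1F ∷ 0F ∷ 3F ∷ 2F ∷ 7F ∷ 4F ∷ 5F ∷ 6F ∷ [])) (
   apart (true ∷ true ∷ true ∷ true ∷ false ∷ false ∷ false ∷ false ∷ [])))))))))) (low 0F 1F))))))))))))

order₈-path₃ : Claim G₂ (spine 8 3)
order₈-path₃ = from-just (certify G₂ 3 (just order₈-path₄) (spine 8 3) (
  branch 0F 3F (longer (2F ∷ 1F ∷ 0F ∷ 3F ∷ 4F ∷ 5F ∷ 6F ∷ 7F ∷ [])) (
  branch 0F 4F (longer (2F ∷ 1F ∷ 0F ∷ 4F ∷ 3F ∷ 5F ∷ 6F ∷ 7F ∷ [])) (
  branch 0F 5F (longer (2F ∷ 1F ∷ 0F ∷ 5F ∷ 3F ∷ 4F ∷ 6F ∷ 7F ∷ [])) (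
  branch 0F 6F (longer (2F ∷ 1F ∷ 0F ∷ 6F ∷ 3F ∷ 4F ∷ 5F ∷ 7F ∷ [])) (
  branch 0F 7F (longer (2F ∷ 1F ∷ 0F ∷ 7F ∷ 3F ∷ 4F ∷ 5F ∷ 6F ∷ [])) (
  branch 2F 3F (longer (0F ∷ 1F ∷ 2F ∷ 3F ∷ 4F ∷ 5F ∷ 6F ∷ 7F ∷ [])) (
  branch 2F 4F (longer (0F ∷ 1F ∷ 2F ∷ 4F ∷ 3F ∷ 5F ∷ 6F ∷ 7F ∷ [])) (
  branch 2F 5F (longer (0F ∷ 1F ∷ 2F ∷ 5F ∷ 3F ∷ 4F ∷ 6F ∷ 7F ∷ [])) (
  branch 2F 6F (longer (0F ∷ 1F ∷ 2F ∷ 6F ∷ 3F ∷ 4F ∷ 5F ∷ 7F ∷ [])) (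
  branch 2F 7F (longer (0F ∷ 1F ∷ 2F ∷ 7F ∷ 3F ∷ 4F ∷ 5F ∷ 6F ∷ [])) (
  branch 0F 2F (
   branch 1F 3F (longer (0F ∷ 2F ∷ 1F ∷ 3F ∷ 4F ∷ 5F ∷ 6F ∷ 7F ∷ [])) (
   branch 1F 4F (longer (0F ∷ 2F ∷ 1F ∷ 4F ∷ 3F ∷ 5F ∷ 6F ∷ 7F ∷ [])) (
   branch 1F 5F (longer (0F ∷ 2F ∷ 1F ∷ 5F ∷ 3F ∷ 4F ∷ 6F ∷ 7F ∷ [])) (
   branch 1F 6F (longer (0F ∷ 2F ∷ 1F ∷ 6F ∷ 3F ∷ 4F ∷ 5F ∷ 7F ∷ [])) (
   branch 1F 7F (longer (0F ∷ 2F ∷ 1F ∷ 7F ∷ 3F ∷ 4F ∷ 5F ∷ 6F ∷ [])) (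
   apart (true ∷ true ∷ true ∷ false ∷ false ∷ false ∷ false ∷ false ∷ []))))))) (low 0F 1F)))))))))))))

order₈-path₂ : Claim G₂ (spine 8 2)
order₈-path₂ = from-just (certify G₂ 2 (just order₈-path₃) (spine 8 2) (
  branch 0F 2F (longer (1F ∷ 0F ∷ 2F ∷ 3F ∷ 4F ∷ 5F ∷ 6F ∷ 7F ∷ [])) (
  branch 0F 3F (longer (1F ∷ 0F ∷ 3F ∷ 2F ∷ 4F ∷ 5F ∷ 6F ∷ 7F ∷ [])) (
  branch 0F 4F (longer (1F ∷ 0F ∷ 4F ∷ 2F ∷ 3F ∷ 5F ∷ 6F ∷ 7F ∷ [])) (
  branch 0F 5F (longer (1F ∷ 0F ∷ 5F ∷ 2F ∷ 3F ∷ 4F ∷ 6F ∷ 7F ∷ [])) (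
  branch 0F 6F (longer (1F ∷ 0F ∷ 6F ∷ 2F ∷ 3F ∷ 4F ∷ 5F ∷ 7F ∷ [])) (
  branch 0F 7F (longer (1F ∷ 0F ∷ 7F ∷ 2F ∷ 3F ∷ 4F ∷ 5F ∷ 6F ∷ [])) (
  low 0F 1F))))))))

order₈-path₁ : Claim G₂ (spine 8 1)
order₈-path₁ = from-just (certify G₂ 1 (just order₈-path₂) (spine 8 1) (
  branch 0F 1F (longer (0F ∷ 1F ∷ 2F ∷ 3F ∷ 4F ∷ 5F ∷ 6F ∷ 7F ∷ [])) (
  branch 0F 2F (longer (0F ∷ 2F ∷ 1F ∷ 3F ∷ 4F ∷ 5F ∷ 6F ∷ 7F ∷ [])) (
  branch 0F 3F (longer (0F ∷ 3F ∷ 1F ∷ 2F ∷ 4F ∷ 5F ∷ 6F ∷ 7F ∷ [])) (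
  branch 0F 4F (longer (0F ∷ 4F ∷ 1F ∷ 2F ∷ 3F ∷ 5F ∷ 6F ∷ 7F ∷ [])) (
  branch 0F 5F (longer (0F ∷ 5F ∷ 1F ∷ 2F ∷ 3F ∷ 4F ∷ 6F ∷ 7F ∷ [])) (
  branch 0F 6F (longer (0F ∷ 6F ∷ 1F ∷ 2F ∷ 3F ∷ 4F ∷ 5F ∷ 7F ∷ [])) (
  low 0F 7F))))))))

-- Degrees and the lower bound

listSum-tabulate : ∀ {n} {B : Set} (f : B → ℕ) (g : Fin n → B) → ListAction.sum (map f (tabulate g)) ≡ sum (f ∘ g)
listSum-tabulate {zero}  f g = refl
listSum-tabulate {suc n} f g = cong (f (g zero) +_) (listSum-tabulate f (g ∘ suc))

degree≡∣∣ : ∀ {n} (G : Graph n) x → degree G x ≡ ∣ adj G x ∣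
degree≡∣∣ G x = listSum-tabulate (λ y → ⟦ adj G x y ⟧) id

Closed-Linked : ∀ {n} {A : BRel n} {Z} → Closed A Z → ∀ x xs {y} → Linked (Arc A) (x ∷ xs ++ y ∷ []) → Z x ≡ true → Z y ≡ true
Closed-Linked c x []       (e ∷ _) p = c _ _ p e
Closed-Linked c x (z ∷ xs) (e ∷ l) p = Closed-Linked c z xs l (c _ _ p e)

connected⇒strong : ∀ {n} (G : Graph n) → Connected G → Strong (adj G)
connected⇒strong G conn Z c {x} p y with x ≟ y
... | yes refl = p
... | no x≢y with conn x y x≢y
...   | xs , _ , l = Closed-Linked c x xs l p

module _ {n} (G : Graph n) (simple : IsSimple G) (conn : Connected G) (quarter : MinDegreeAtLeastQuarter G) where

  admissible : 5 ≤ n → Admissible (adj G)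
  admissible 5≤n = record
    { A-sym = proj₁ simple ; A-irr = proj₂ simple ; A-strong = connected⇒strong G conn
    ; degree≥2 = λ x → two-members (adj G x) (subst (2 ≤_) (degree≡∣∣ G x) (degree≥2 x)) }
    where
    degree≥2 : ∀ x → 2 ≤ degree G x
    degree≥2 x with 2 ≤? degree G x
    ... | yes p = p
    -- A vertex of degree at most 1 would give `n ≤ 4`.
    ... | no ¬p = ⊥-elim (<⇒≱ 5≤n (≤-trans (quarter x) (*-monoʳ-≤ 4 (≤-pred (≰⇒> ¬p)))))

  large-unilateral : 9 ≤ n → Fin n → Unilateral (adj G)
  large-unilateral 9≤n x₀ = dense⇒unilateral dense x₀
    where
    -- Both `deg` and `n≤4d` must hold for the same `d`, so the quarter bound is applied at a vertex
    -- of minimum degree.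
    least : Fin n
    least = argmin (degree G) x₀ (allFin n)
    d : ℕ
    d = degree G least
    least-min : ∀ x → d ≤ degree G x
    least-min x = All.lookup (f[argmin]≤f[xs] {f = degree G} x₀ (allFin n)) (∈-allFin x)
    4*d : ∀ d → 4 * d ≡ (d + d) + (d + d)
    4*d = solve-∀
    3≤d : 3 ≤ d
    3≤d with 3 ≤? d
    ... | yes p = p
    ... | no ¬p = ⊥-elim (<⇒≱ 9≤n (≤-trans (quarter least) (*-monoʳ-≤ 4 (≤-pred (≰⇒> ¬p)))))
    dense : Dense (adj G) d
    dense = record
      { A-sym = proj₁ simple ; A-irr = proj₂ simple ; A-strong = connected⇒strong G conn ; 3≤d = 3≤d
      ; n≤4d = ≤-trans (quarter least) (≤-reflexive (4*d d))
      ; deg  = λ x → ≤-trans (least-min x) (≤-reflexive (degree≡∣∣ G x)) }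

resolve : ∀ {n k} (G : Graph n) (X : Graph k) → ¬ Isomorphic G X → Outcome X (adj G) → Unilateral (adj G)
resolve G X ¬iso (inj₁ U)       = U
resolve G X ¬iso (inj₂ (f , h)) = ⊥-elim (¬iso (↔⇒⤖ f , h))

small-unilateral : ∀ n (G : Graph n) → Admissible (adj G) → 5 ≤ n → n < 9 →
  ¬ Isomorphic G G₁ → ¬ Isomorphic G G₂ → Unilateral (adj G)
small-unilateral 5 G adm _ _ ¬G₁ _ = resolve G G₁ ¬G₁ (order₅-path₁ (adj G) adm [])
small-unilateral 6 G adm _ _ ¬G₁ _ = resolve G G₁ ¬G₁ (order₆-path₁ (adj G) adm [])
small-unilateral 7 G adm _ _ ¬G₁ _ = resolve G G₁ ¬G₁ (order₇-path₁ (adj G) adm [])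
small-unilateral 8 G adm _ _ _ ¬G₂ = resolve G G₂ ¬G₂ (order₈-path₁ (adj G) adm [])
small-unilateral 0 G adm ()
small-unilateral 1 G adm (s≤s ())
small-unilateral 2 G adm (s≤s (s≤s ()))
small-unilateral 3 G adm (s≤s (s≤s (s≤s ())))
small-unilateral 4 G adm (s≤s (s≤s (s≤s (s≤s ()))))
small-unilateral (suc (suc (suc (suc (suc (suc (suc (suc (suc n))))))))) G adm _ (s≤s (s≤s (s≤s (s≤s (s≤s (s≤s (s≤s (s≤s (s≤s ())))))))))

Fin1-unique : (i j : Fin 1) → i ≡ j
Fin1-unique zero zero = refl

-- Two consecutive edges cannot differ in their only colour, so every proper path is a single edge.
one-colour⇒complete : ∀ {n} (G : Graph n) → ProperlyConnectableWith G 1 → Complete G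
one-colour⇒complete G (c , pc) u v u≢v with pc u v u≢v
... | []         , (_ , e ∷ _) , _ = e
... | x ∷ []     , _ , ≢ , _ = ⊥-elim (≢ (Fin1-unique _ _))
... | x ∷ y ∷ xs , _ , ≢ , _ = ⊥-elim (≢ (Fin1-unique _ _))

-- A colouring assigns a colour to every ordered pair, even `x`, `x`, so one vertex is enough.
no-colour : ∀ {n} (G : Graph n) → Fin n → ¬ ProperlyConnectableWith G 0
no-colour G x (c , _) with () ← col c x x

theorem2 : ∀ (n : ℕ) (G : Graph n) → IsSimple G → 5 ≤ n → Connected G → ¬ Complete G → MinDegreeAtLeastQuarter G → ¬ Isomorphic G G₁ → ¬ Isomorphic G G₂ → PCEquals G 2
theorem2 n G simple 5≤n conn ¬complete quarter ¬G₁ ¬G₂ =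
  Unilateral⇒connectable G (proj₁ simple) U , fewer
  where
  x₀ : Fin n
  x₀ = fromℕ< (≤-trans (s≤s z≤n) 5≤n)
  U : Unilateral (adj G)
  U with 9 ≤? n
  ... | yes 9≤n = large-unilateral G simple conn quarter 9≤n x₀
  ... | no  9≰n = small-unilateral n G (admissible G simple conn quarter 5≤n) 5≤n (≰⇒> 9≰n) ¬G₁ ¬G₂
  fewer : ∀ j → j < 2 → ¬ ProperlyConnectableWith G j
  fewer 0 _ = no-colour G x₀
  fewer 1 _ = ¬complete ∘ one-colour⇒complete G
  fewer (suc (suc j)) (s≤s (s≤s ()))
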